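{- Let $G$ be a fixed finite simple graph with minimum degree $\delta(G)\ge 5$ which contains two edge-disjoint Hamilton cycles $H_1,H_2$ such that the graph $H_1\cup H_2$ is not bipartite. Then asymptotically almost surely (as $n\to\infty$) a random $n$-lift $\tilde G$ of $G$ is Hamiltonian, i.e. $\Pr[\tilde G \text{ contains a Hamilton cycle}]\to 1$ as $n\to\infty$.
   Context: For a graph $G$ and a positive integer $n$, an $n$-lift of $G$ is a graph $\tilde G$ obtained as follows: each vertex $u$ of $G$ is replaced by a set (fiber) $\tilde G_u=\{u_1,\dots,u_n\}$ of $n$ vertices, the fibers being pairwise disjoint, and for every edge $uv$ of $G$ the fibers $\tilde G_u$ and $\tilde G_v$ are joined by a perfect matching (i.e. for some permutation $\sigma_{uv}$ of $[n]$, $u_i$ is joined to $v_{\sigma_{uv}(i)}$ for all $i$); there are no other edges. A random $n$-lift of $G$ is obtained by choosing, independently for each edge $uv$ of $G$, the permutation $\sigma_{uv}$ uniformly at random among all $n!$ permutations of $[n]$ (equivalently, a uniformly random element of the set $L_n(G)$ of all $n$-lifts). A property holds asymptotically almost surely (aas) if its probability tends to $1$ as $n\to\infty$, with $G$ fixed. -}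

module Defs where

open import Data.Nat using (ℕ; zero; suc; _+_; _*_; _^_; _≤_; _<_; _!)
open import Data.Fin using (Fin; toℕ)
open import Data.Fin.Properties using (_≟_)
open import Data.Product using (Σ; ∃; _×_; _,_; proj₁; proj₂; swap)
open import Data.Sum using (_⊎_)
open import Data.Bool using (Bool)
open import Data.List using (List; []; _∷_; _++_; [_]; zip; length; filterᵇ)
open import Data.List.Relation.Unary.Unique.Propositional using (Unique)
open import Data.List.Membership.Propositional using (_∈_)
open import Data.Vec using (Vec; lookup; toList)
open import Data.Bool using (_∨_)
open import Relation.Binary.PropositionalEquality using (_≡_; _≢_)
open import Relation.Nullary using (¬_)
open import Relation.Nullary.Decidable using (⌊_⌋)

record Graph : Set where
  field
    V     : ℕ
    m     : ℕ
    edges : Vec (Fin V × Fin V) m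
open Graph public

-- Simple: each edge stored canonically with a < b (so no loops), and
-- no edge is listed twice (no multiple edges).
IsSimple : Graph → Set
IsSimple G =
  (∀ e → toℕ (proj₁ (lookup (edges G) e)) < toℕ (proj₂ (lookup (edges G) e)))
  × (∀ e f → lookup (edges G) e ≡ lookup (edges G) f → e ≡ f)

Adj : (G : Graph) → Fin (V G) → Fin (V G) → Set
Adj G u w = ((u , w) ∈ toList (edges G)) ⊎ ((w , u) ∈ toList (edges G))

degree : (G : Graph) → Fin (V G) → ℕ
degree G u = length (filterᵇ (λ p → ⌊ proj₁ p ≟ u ⌋ ∨ ⌊ proj₂ p ≟ u ⌋) (toList (edges G)))

cyclicPairs : {A : Set} → List A → List (A × A)
cyclicPairs []       = []
cyclicPairs (x ∷ xs) = zip (x ∷ xs) (xs ++ [ x ])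

IsHamCycle : {A : Set} → (A → A → Set) → List A → Set
IsHamCycle {A} R c =
  Unique c × (∀ a → a ∈ c) × (3 ≤ length c)
  × (∀ {x y} → (x , y) ∈ cyclicPairs c → R x y)

Hamiltonian : {A : Set} → (A → A → Set) → Set
Hamiltonian R = ∃ λ c → IsHamCycle R c

EdgeDisjoint : {A : Set} → List A → List A → Set
EdgeDisjoint c d = ∀ {p q} → p ∈ cyclicPairs c → q ∈ cyclicPairs d →
  ¬ (p ≡ q ⊎ p ≡ swap q)

UnionBipartite : {k : ℕ} → List (Fin k) → List (Fin k) → Set
UnionBipartite {k} c d = Σ (Fin k → Bool) λ col →
  ∀ {x y} → ((x , y) ∈ cyclicPairs c ⊎ (x , y) ∈ cyclicPairs d) → col x ≢ col y

IsPerm : {n : ℕ} → Vec (Fin n) n → Set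
IsPerm p = ∀ i j → lookup p i ≡ lookup p j → i ≡ j

LiftData : Graph → ℕ → Set
LiftData G n = Vec (Vec (Fin n) n) (m G)

IsLift : (G : Graph) {n : ℕ} → LiftData G n → Set
IsLift G σ = ∀ e → IsPerm (lookup σ e)

LiftAdj : (G : Graph) {n : ℕ} → LiftData G n →
  (Fin (V G) × Fin n) → (Fin (V G) × Fin n) → Set
LiftAdj G σ (u , i) (w , j) = ∃ λ e →
  (lookup (edges G) e ≡ (u , w) × lookup (lookup σ e) i ≡ j)
  ⊎ (lookup (edges G) e ≡ (w , u) × lookup (lookup σ e) j ≡ i)

numLifts : Graph → ℕ → ℕ
numLifts G n = (n !) ^ m G

-- Expose the lift of H₁ first: it is a union of cycles, and since E[2^#cycles] is polynomial in n
-- there are only O(log n) of them.  A vertex of a lift is a pair (fibre, index); ρ is the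
-- permutation of the vertices given by the lift of H₁.  The cycles are merged one at a time into
-- a big one by exposing edges of the still random lift of H₂.  Cut a small cycle into a path with
-- ends x and b.  An exposed edge from the active end to a vertex w that has not been touched yet
-- either rotates the path (Pósa) or absorbs the cycle through w, and the new active end is
-- ρ w or ρ⁻¹ w, whose two H₂-edges are again unexposed.
--
-- Growing a binary tree from x gives almost n different ends a.  A second tree, grown from b, is
-- shared by all these paths: its next edge leads to w in every path, and only the side (ρ w or
-- ρ⁻¹ w) depends on the path.  Splitting the family of paths according to that side, a few nodes
-- carry many more than n pairs of ends in total, so that one of the closing edges is likely to be
-- present.  The fibres of the two ends are matched with the help of reserved runs of the big
-- cycle: hitting a run in the right order gives moves f ↦ s (t^±1 f) of the fibre (s and t are the
-- successor maps of H₁ and H₂), and these act transitively because H₁ ∪ H₂ is not bipartite.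
--
-- Probabilities are ratios of numbers of lifts consistent with the edges exposed so far, and the
-- failure bounds are potentials that do not increase on average under one more exposure.
module Submission where

open import Defs
open import Data.Nat hiding (_≟_)
open import Data.Nat.Properties hiding (_≟_)
open import Relation.Binary.PropositionalEquality hiding ([_])
open import Relation.Nullary
open import Data.Bool using (Bool; false; not; true)
open import Data.Bool.Properties as Bool using (not-involutive; ¬-not) renaming (_≟_ to _≟ᵇ_)
open import Data.Empty using (⊥; ⊥-elim)
open import Data.Fin using (Fin; suc; toℕ; zero)
import Data.Fin.Properties as Fin
open import Data.List using (List; []; [_]; _++_; _∷_; _∷ʳ_; allFin; cartesianProduct; concat; drop; filter; length; map; reverse; take; zip)
import Data.List.Membership.DecPropositional as DecMem
open import Data.List.Membership.Propositional using (_∈_; _∉_)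
open import Data.List.Membership.Propositional.Properties using (∈-++⁺ʳ; ∈-++⁺ˡ; ∈-++⁻; ∈-allFin; ∈-cartesianProduct⁺; ∈-concat⁺′; ∈-concat⁻′; ∈-filter⁺; ∈-filter⁻; ∈-length; ∈-map⁺; ∈-map⁻; ∈-∃++)
open import Data.List.Properties using (++-assoc; ++-identityʳ; concat-++; filter-++; length-++; length-drop; length-filter; length-map; length-reverse; length-tabulate; length-take; map-++; reverse-++; reverse-involutive; take++drop≡id; unfold-reverse; ∷-injective; ∷-injectiveˡ)
open import Data.List.Relation.Binary.Permutation.Propositional using (_↭_; module PermutationReasoning; ↭-refl; ↭-reflexive; ↭-sym; ↭-trans; ↭⇒↭ₛ)
open import Data.List.Relation.Binary.Permutation.Propositional.Properties as Perm using (++-comm; ++⁺; ++⁺ʳ; ++⁺ˡ; shift; shifts; ↭-length; ↭-reverse; ∈-resp-↭)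
import Data.List.Relation.Binary.Permutation.Setoid.Properties as PermS
open import Data.List.Relation.Unary.All as All using (All; []; _∷_; all?)
import Data.List.Relation.Unary.All.Properties as AllP
open import Data.List.Relation.Unary.AllPairs using ([]; _∷_)
open import Data.List.Relation.Unary.Any using (here; there)
open import Data.List.Relation.Unary.Unique.Propositional using (Unique)
open import Data.List.Relation.Unary.Unique.Propositional.Properties as Uniq using (Unique[x∷xs]⇒x∉xs)
open import Data.Nat.Solver using (module +-*-Solver)
open import Data.Nat.Tactic.RingSolver using (solve-∀)
open import Data.Product using (_,_; _×_; proj₁; proj₂; Σ; ∃)
open import Data.Product.Properties using (,-injectiveˡ; ≡-dec)
open import Data.Sum as Sum using ([_,_]′; _⊎_; inj₁; inj₂; swap)
open import Data.Unit using (tt; ⊤)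
open import Data.Vec using (Vec; []; _∷_; lookup; toList)
open import Data.Vec.Relation.Binary.Pointwise.Extensional using (Pointwise-≡⇒≡; ext)
open import Function using (_∘_)
open import Level using (Level)
open import Relation.Unary using (Decidable; Pred)

-- The obstacle is that only o(n) vertices may be touched, or untouched partners run out. The first
-- tree therefore has at most n / y^24 ends, where y is a small power of n, and a single closing
-- exposure from `b` would succeed with probability o(1) only. Many trials are needed, one at each
-- leaf of the second tree; using the same exposures for all paths is what lets the number of (leaf,
-- end) pairs exceed n. The price of sharing is that an exposure may leave paths on both sides, with
-- two half-edges each, so the second tree can cost 4^depth exposures and is kept much shallower
-- than the first.
--
-- An edge in the lift of H₂ joins prescribed fibres, so before closing, the fibre of the active end
-- has to be corrected for a whole family at once. Inside a run that all paths of the family still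
-- contain in one direction, the predecessor of a vertex does not depend on the path, hence the
-- family moves without splitting. Each prescribed hit is only guaranteed probability 1/G; the
-- second tree is deep enough to make up for these factors.

-- Finite sums, duplicate-free lists, chains and cyclic lists.

module ListTools where

 private variable
   ℓ : Level
   A B : Set

 ∑ : List A → (A → ℕ) → ℕ
 ∑ []       f = 0
 ∑ (x ∷ xs) f = f x + ∑ xs f

 ∑-mono : ∀ (xs : List A) {f g} → (∀ {x} → x ∈ xs → f x ≤ g x) → ∑ xs f ≤ ∑ xs g
 ∑-mono []       h = z≤n
 ∑-mono (x ∷ xs) h = +-mono-≤ (h (here refl)) (∑-mono xs (h ∘ there))

 ∑-cong : ∀ (xs : List A) {f g} → (∀ x → f x ≡ g x) → ∑ xs f ≡ ∑ xs g
 ∑-cong []       h = refl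
 ∑-cong (x ∷ xs) h = cong₂ _+_ (h x) (∑-cong xs h)

 open import Algebra.Properties.CommutativeSemigroup +-commutativeSemigroup
   using (x∙yz≈y∙xz) renaming (interchange to +-interchange)

 ∑-+ : ∀ (xs : List A) f g → ∑ xs (λ x → f x + g x) ≡ ∑ xs f + ∑ xs g
 ∑-+ []       f g = refl
 ∑-+ (x ∷ xs) f g = trans (cong (f x + g x +_) (∑-+ xs f g)) (+-interchange (f x) (g x) _ _)

 ∑-*ˡ : ∀ (xs : List A) c f → ∑ xs (λ x → c * f x) ≡ c * ∑ xs f
 ∑-*ˡ []       c f = sym (*-zeroʳ c)
 ∑-*ˡ (x ∷ xs) c f = trans (cong (c * f x +_) (∑-*ˡ xs c f)) (sym (*-distribˡ-+ c (f x) _))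

 ∑-*ʳ : ∀ (xs : List A) c f → ∑ xs (λ x → f x * c) ≡ ∑ xs f * c
 ∑-*ʳ []       c f = refl
 ∑-*ʳ (x ∷ xs) c f = trans (cong (f x * c +_) (∑-*ʳ xs c f)) (sym (*-distribʳ-+ c (f x) _))

 ∑-const : ∀ (xs : List A) c → ∑ xs (λ _ → c) ≡ length xs * c
 ∑-const []       c = refl
 ∑-const (x ∷ xs) c = cong (c +_) (∑-const xs c)

 ∑-++ : ∀ (xs ys : List A) f → ∑ (xs ++ ys) f ≡ ∑ xs f + ∑ ys f
 ∑-++ []       ys f = refl
 ∑-++ (x ∷ xs) ys f = trans (cong (f x +_) (∑-++ xs ys f)) (sym (+-assoc (f x) _ _))

 ∑-swap : ∀ (xs : List A) (ys : List B) (f : A → B → ℕ) →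
   ∑ xs (λ x → ∑ ys (f x)) ≡ ∑ ys (λ y → ∑ xs (λ x → f x y))
 ∑-swap []       ys f = sym (trans (∑-const ys 0) (*-zeroʳ (length ys)))
 ∑-swap (x ∷ xs) ys f = trans (cong (∑ ys (f x) +_) (∑-swap xs ys f)) (sym (∑-+ ys _ _))

 ∑-split : ∀ (xs : List A) {P : Pred A ℓ} (P? : Decidable P) f →
   ∑ xs f ≡ ∑ (filter P? xs) f + ∑ (filter (¬? ∘ P?) xs) f
 ∑-split []       P? f = refl
 ∑-split (x ∷ xs) P? f with P? x
 ... | yes _ = trans (cong (f x +_) (∑-split xs P? f)) (sym (+-assoc (f x) _ _))
 ... | no  _ = trans (cong (f x +_) (∑-split xs P? f)) (x∙yz≈y∙xz (f x) (∑ (filter P? xs) f) _)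

 ind : {P : Set ℓ} → Dec P → ℕ
 ind (yes _) = 1
 ind (no _)  = 0

 ∑-ind : ∀ (xs : List A) {P : Pred A ℓ} (P? : Decidable P) → ∑ xs (λ x → ind (P? x)) ≡ length (filter P? xs)
 ∑-ind []       P? = refl
 ∑-ind (x ∷ xs) P? with P? x
 ... | yes _ = cong suc (∑-ind xs P?)
 ... | no  _ = ∑-ind xs P?

 unique-head : {x : A} {xs : List A} → Unique (x ∷ xs) → x ∉ xs
 unique-head = Unique[x∷xs]⇒x∉xs

 unique-tail : {x : A} {xs : List A} → Unique (x ∷ xs) → Unique xs
 unique-tail (_ ∷ u) = u

 unique-∷ : {x : A} {xs : List A} → x ∉ xs → Unique xs → Unique (x ∷ xs)
 unique-∷ x∉ u = All.tabulate (λ y∈ x≡y → x∉ (subst (_∈ _) (sym x≡y) y∈)) ∷ u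

 unique-++ˡ : (xs : List A) {ys : List A} → Unique (xs ++ ys) → Unique xs
 unique-++ˡ []       u = []
 unique-++ˡ (x ∷ xs) u = unique-∷ (unique-head u ∘ ∈-++⁺ˡ) (unique-++ˡ xs (unique-tail u))

 unique-++ʳ : (xs : List A) {ys : List A} → Unique (xs ++ ys) → Unique ys
 unique-++ʳ []       u = u
 unique-++ʳ (x ∷ xs) u = unique-++ʳ xs (unique-tail u)

 unique-disj : (xs : List A) {ys : List A} → Unique (xs ++ ys) → ∀ {z} → z ∈ xs → z ∉ ys
 unique-disj (x ∷ xs) u (here refl) z∈ = unique-head u (∈-++⁺ʳ xs z∈)
 unique-disj (x ∷ xs) u (there i)   z∈ = unique-disj xs (unique-tail u) i z∈

 unique-++⁺ : {xs ys : List A} → Unique xs → Unique ys → (∀ {z} → z ∈ xs → z ∉ ys) → Unique (xs ++ ys)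
 unique-++⁺ ux uy d = Uniq.++⁺ ux uy (λ (i , j) → d i j)

 unique-↭ : {xs ys : List A} → xs ↭ ys → Unique xs → Unique ys
 unique-↭ {A = A} p = PermS.Unique-resp-↭ (setoid A) (↭⇒↭ₛ p)

 unique-map : {f : A → B} {xs : List A} → (∀ {x y} → x ∈ xs → y ∈ xs → f x ≡ f y → x ≡ y) →
   Unique xs → Unique (map f xs)
 unique-map {xs = []}     inj u = []
 unique-map {f = f} {xs = x ∷ xs} inj u = unique-∷
   (λ fx∈ → let (y , y∈ , eq) = ∈-map⁻ f fx∈ in unique-head u (subst (_∈ xs) (sym (inj (here refl) (there y∈) eq)) y∈))
   (unique-map (λ i j → inj (there i) (there j)) (unique-tail u))

 Unique⊆⇒length≤ : {xs ys : List A} → Unique xs → (∀ {z} → z ∈ xs → z ∈ ys) → length xs ≤ length ys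
 Unique⊆⇒length≤ {xs = []}     u h = z≤n
 Unique⊆⇒length≤ {xs = x ∷ xs} u h with ∈-∃++ (h (here refl))
 ... | as , bs , refl = ≤-trans (s≤s (Unique⊆⇒length≤ (unique-tail u) h′)) (≤-reflexive (sym (↭-length (shift x as bs))))
   where
   h′ : ∀ {z} → z ∈ xs → z ∈ as ++ bs
   h′ z∈ with ∈-resp-↭ (shift x as bs) (h (there z∈))
   ... | here refl = ⊥-elim (unique-head u z∈)
   ... | there j   = j

 ∑-ind≤ : ∀ {xs : List A} {P : Pred A ℓ} (P? : Decidable P) {bs} → Unique xs →
   (∀ {x} → x ∈ xs → P x → x ∈ bs) → ∑ xs (λ x → ind (P? x)) ≤ length bs
 ∑-ind≤ {xs = xs} P? u h = ≤-trans (≤-reflexive (∑-ind xs P?))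
   (Unique⊆⇒length≤ (Uniq.filter⁺ P? u) (λ i → let (j , p) = ∈-filter⁻ P? i in h j p))

 module _ {A B : Set} (f : A → B) (_≟_ : (x y : B) → Dec (x ≡ y)) where

   count : List A → B → ℕ
   count xs c = length (filter (λ x → f x ≟ c) xs)

   pigeonhole-class : ∀ (cs : List B) (xs : List A) → (∀ {x} → x ∈ xs → f x ∈ cs) →
     0 < length xs → ∃ λ c → length xs ≤ length cs * count xs c
   pigeonhole-class cs xs all ne = go cs (subst (length xs ≤_) refl total)
     where
     one≤ : ∀ (bs : List B) {b} → b ∈ bs → 1 ≤ ∑ bs (λ c → ind (b ≟ c))
     one≤ (c ∷ bs) {b} i with b ≟ c
     ... | yes _ = s≤s z≤n
     one≤ (c ∷ bs) (here refl) | no b≢ = ⊥-elim (b≢ refl)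
     one≤ (c ∷ bs) (there i) | no _ = one≤ bs i
     total : length xs ≤ ∑ cs (count xs)
     total = begin
       length xs                                   ≡⟨ sym (*-identityʳ _) ⟩
       length xs * 1                               ≡⟨ sym (∑-const xs 1) ⟩
       ∑ xs (λ _ → 1)                              ≤⟨ ∑-mono xs (λ i → one≤ cs (all i)) ⟩
       ∑ xs (λ x → ∑ cs (λ c → ind (f x ≟ c)))     ≡⟨ ∑-swap xs cs _ ⟩
       ∑ cs (λ c → ∑ xs (λ x → ind (f x ≟ c)))     ≡⟨ ∑-cong cs (λ c → ∑-ind xs _) ⟩
       ∑ cs (count xs)                             ∎
       where open ≤-Reasoning
     max : ∀ bs → 0 < length bs → ∃ λ c → ∑ bs (count xs) ≤ length bs * count xs c
     max (c ∷ []) _ = c , ≤-refl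
     max (c ∷ bs@(_ ∷ _)) _ with max bs (s≤s z≤n)
     ... | d , le with ≤-total (count xs c) (count xs d)
     ...   | inj₁ c≤d = d , +-mono-≤ c≤d le
     ...   | inj₂ d≤c = c , +-monoʳ-≤ (count xs c) (≤-trans le (*-monoʳ-≤ (length bs) d≤c))
     go : ∀ bs → length xs ≤ ∑ bs (count xs) → ∃ λ c → length xs ≤ length bs * count xs c
     go [] le = ⊥-elim (<⇒≱ ne le)
     go bs@(_ ∷ _) le with max bs (s≤s z≤n)
     ... | c , le′ = c , ≤-trans le le′

 module _ {A : Set} {P : Pred A ℓ} (P? : Decidable P) where

   length-filter-∖ : ∀ {xs bs} {Q : Pred A ℓ} (Q? : Decidable Q) → Unique xs →
     (∀ {x} → x ∈ xs → P x → ¬ Q x → x ∈ bs) →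
     length (filter P? xs) ≤ length (filter Q? (filter P? xs)) + length bs
   length-filter-∖ {xs} {bs} Q? u h = ≤-trans
     (Unique⊆⇒length≤ (Uniq.filter⁺ P? u) sub) (≤-reflexive (length-++ (filter Q? (filter P? xs))))
     where
     sub : ∀ {z} → z ∈ filter P? xs → z ∈ filter Q? (filter P? xs) ++ bs
     sub {z} i with Q? z
     ... | yes q = ∈-++⁺ˡ (∈-filter⁺ Q? i q)
     ... | no ¬q = let (j , p) = ∈-filter⁻ P? i in ∈-++⁺ʳ _ (h j p ¬q)

 snoc-view : (x : A) (xs : List A) → ∃ λ m → ∃ λ y → x ∷ xs ≡ m ∷ʳ y
 snoc-view x []       = [] , x , refl
 snoc-view x (y ∷ ys) with snoc-view y ys
 ... | m , z , eq = x ∷ m , z , cong (x ∷_) eq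

 module _ {A : Set} where

   Chain : (A → A → Set) → List A → Set
   Chain K []           = ⊤
   Chain K (x ∷ [])     = ⊤
   Chain K (x ∷ y ∷ l)  = K x y × Chain K (y ∷ l)

   -- The first vertex is repeated at the end, so the starting point is arbitrary up to
   -- `closed-rotate`. A one-element list is closed only through a loop `K x x`, which is how
   -- one-vertex cycles get excluded.
   Closed : (A → A → Set) → List A → Set
   Closed K []      = ⊥
   Closed K (x ∷ l) = Chain K (x ∷ l ++ [ x ])

   module _ {K K′ : A → A → Set} (h : ∀ {x y} → K x y → K′ x y) where
     chain-map : ∀ l → Chain K l → Chain K′ l
     chain-map []          c = c
     chain-map (x ∷ [])    c = c
     chain-map (x ∷ y ∷ l) (k , c) = h k , chain-map (y ∷ l) c

     closed-map : ∀ l → Closed K l → Closed K′ l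
     closed-map (x ∷ l) c = chain-map (x ∷ l ++ [ x ]) c

   module _ {K : A → A → Set} where
     chain-tail : ∀ x l → Chain K (x ∷ l) → Chain K l
     chain-tail x []      c = tt
     chain-tail x (y ∷ l) (_ , c) = c

     chain-right : ∀ l {r} → Chain K (l ++ r) → Chain K r
     chain-right []      c = c
     chain-right (x ∷ l) c = chain-right l (chain-tail x (l ++ _) c)

     chain-left : ∀ l {r} → Chain K (l ++ r) → Chain K l
     chain-left []          c = tt
     chain-left (x ∷ [])    c = tt
     chain-left (x ∷ y ∷ l) (k , c) = k , chain-left (y ∷ l) c

     chain-mid : ∀ l {x y r} → Chain K (l ++ x ∷ y ∷ r) → K x y
     chain-mid l c = proj₁ (chain-right l c)

     chain-glue : ∀ l {x r} → Chain K (l ++ [ x ]) → Chain K (x ∷ r) → Chain K (l ++ x ∷ r)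
     chain-glue []          c d = d
     chain-glue (y ∷ [])    (k , _) d = k , d
     chain-glue (y ∷ z ∷ l) (k , c) d = k , chain-glue (z ∷ l) c d

     closed-rotate : ∀ us w vs → Closed K (us ++ w ∷ vs) → Chain K (w ∷ vs ++ us ++ [ w ])
     closed-rotate [] w vs c = c
     closed-rotate (u ∷ us) w vs c = subst (Chain K) (cong (w ∷_) refl)
       (chain-glue (w ∷ vs) {r = us ++ [ w ]}
         (chain-right (u ∷ us) (subst (Chain K) (++-assoc (u ∷ us) (w ∷ vs) [ u ]) c))
         (chain-left (u ∷ us ++ [ w ]) (subst (Chain K) (trans (++-assoc (u ∷ us) (w ∷ vs) [ u ]) (sym (++-assoc (u ∷ us) [ w ] (vs ++ [ u ])))) c)))

   chain-reverse : ∀ {K K′ : A → A → Set} → (∀ {x y} → K x y → K′ y x) → ∀ l → Chain K l → Chain K′ (reverse l)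
   chain-reverse s [] c = tt
   chain-reverse s (x ∷ []) c = tt
   chain-reverse {K′ = K′} s (x ∷ y ∷ l) (k , c) = subst (Chain K′) (sym eq)
     (chain-glue (reverse l) (subst (Chain K′) (unfold-reverse y l) (chain-reverse s (y ∷ l) c)) (s k , tt))
     where
     eq : reverse (x ∷ y ∷ l) ≡ reverse l ++ y ∷ x ∷ []
     eq = trans (unfold-reverse x (y ∷ l)) (trans (cong (_++ [ x ]) (unfold-reverse y l)) (++-assoc (reverse l) [ y ] [ x ]))

   Infix : List A → List A → Set
   Infix r l = ∃ λ xs → ∃ λ ys → l ≡ xs ++ r ++ ys

   infix-++ˡ : ∀ {r l} z → Infix r l → Infix r (z ++ l)
   infix-++ˡ z (xs , ys , refl) = z ++ xs , ys , sym (++-assoc z xs _)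

   infix-++ʳ : ∀ {r l} z → Infix r l → Infix r (l ++ z)
   infix-++ʳ {r} z (xs , ys , refl) = xs , ys ++ z , trans (++-assoc xs (r ++ ys) z) (cong (xs ++_) (++-assoc r ys z))

   infix-reverse : ∀ {r l} → Infix r l → Infix (reverse r) (reverse l)
   infix-reverse {r} (xs , ys , refl) = reverse ys , reverse xs ,
     trans (reverse-++ xs (r ++ ys)) (trans (cong (_++ reverse xs) (reverse-++ r ys)) (++-assoc (reverse ys) (reverse r) (reverse xs)))

   private
     prefix-avoid : ∀ {w : A} (r : List A) {us vs ys : List A} → w ∉ r → us ++ w ∷ vs ≡ r ++ ys → ∃ λ z → us ≡ r ++ z
     prefix-avoid [] w∉ eq = _ , refl
     prefix-avoid (a ∷ r) {[]} w∉ refl = ⊥-elim (w∉ (here refl))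
     prefix-avoid (a ∷ r) {u ∷ us} w∉ eq with ∷-injective eq
     ... | refl , eq′ = let (z , e) = prefix-avoid r (w∉ ∘ there) eq′ in z , cong (a ∷_) e

   -- A contiguous run avoiding `w` cannot straddle the cut at `w`; hence reserved runs survive
   -- every rotation or absorption at a vertex outside them.
   infix-split : ∀ {w r} us {vs} → w ∉ r → Infix r (us ++ w ∷ vs) → Infix r us ⊎ Infix r vs
   infix-split {r = r} us w∉ ([] , ys , eq) = let (z , e) = prefix-avoid r w∉ eq in inj₁ ([] , z , e)
   infix-split [] w∉ (x ∷ xs , ys , refl) = inj₂ (xs , ys , refl)
   infix-split (u ∷ us) w∉ (x ∷ xs , ys , eq) with ∷-injective eq
   ... | refl , eq′ with infix-split us w∉ (xs , ys , eq′)
   ... | inj₁ i = inj₁ (infix-++ˡ [ u ] i)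
   ... | inj₂ j = inj₂ j

   infix-∈ : ∀ {r l : List A} {w : A} → Infix r l → w ∈ r → w ∈ l
   infix-∈ (xs , ys , refl) i = ∈-++⁺ʳ xs (∈-++⁺ˡ i)

   last-suffix : ∀ (us : List A) {w : A} {vs t : List A} {a : A} → us ++ w ∷ vs ≡ t ++ a ∷ [] → ∃ λ t′ → w ∷ vs ≡ t′ ++ a ∷ []
   last-suffix [] {t = t} eq = t , eq
   last-suffix (u ∷ us) {t = []} eq with ∷-injective eq
   last-suffix (u ∷ []) {t = []} eq | refl , ()
   last-suffix (u ∷ (_ ∷ us)) {t = []} eq | refl , ()
   last-suffix (u ∷ us) {t = x ∷ t} eq = last-suffix us (proj₂ (∷-injective eq))

-- Counting the lifts that extend exposed partial matchings.

module LiftCounting where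

 open ListTools

 ∏ : ∀ {m} → (Fin m → ℕ) → ℕ
 ∏ {zero}  f = 1
 ∏ {suc m} f = f zero * ∏ (f ∘ suc)

 ∏-cong : ∀ {m} {f g : Fin m → ℕ} → (∀ e → f e ≡ g e) → ∏ f ≡ ∏ g
 ∏-cong {zero}  h = refl
 ∏-cong {suc m} h = cong₂ _*_ (h zero) (∏-cong (h ∘ suc))

 ∏-const : ∀ m c → ∏ {m} (λ _ → c) ≡ c ^ m
 ∏-const zero    c = refl
 ∏-const (suc m) c = cong (c *_) (∏-const m c)

 ∏-pos : ∀ {m} (f : Fin m → ℕ) → (∀ e → 1 ≤ f e) → 1 ≤ ∏ f
 ∏-pos {zero}  f h = ≤-refl
 ∏-pos {suc m} f h = *-mono-≤ (h zero) (∏-pos (f ∘ suc) (h ∘ suc))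

 -- Only factor `e` changes; the ratio `b / a` is cross-multiplied to stay within the naturals. Used
 -- both for the weight `W` and for the martingale factor `ψ`.
 ∏-update : ∀ {m} {f g : Fin m → ℕ} e a b → (∀ e′ → e′ ≢ e → f e′ ≡ g e′) → a * f e ≡ b * g e →
   a * ∏ f ≡ b * ∏ g
 ∏-update {suc m} {f} {g} zero a b h eq = begin-equality
   a * (f zero * ∏ (f ∘ suc)) ≡⟨ sym (*-assoc a _ _) ⟩
   a * f zero * ∏ (f ∘ suc)   ≡⟨ cong₂ _*_ eq (∏-cong (λ e → h (suc e) λ ())) ⟩
   b * g zero * ∏ (g ∘ suc)   ≡⟨ *-assoc b _ _ ⟩
   b * (g zero * ∏ (g ∘ suc)) ∎
   where open ≤-Reasoning
 ∏-update {suc m} {f} {g} (suc e) a b h eq = begin-equality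
   a * (f zero * ∏ (f ∘ suc)) ≡⟨ x∙yz≈y∙xz a (f zero) _ ⟩
   f zero * (a * ∏ (f ∘ suc)) ≡⟨ cong₂ _*_ (h zero λ ()) (∏-update {f = f ∘ suc} {g = g ∘ suc} e a b (λ e′ ne → h (suc e′) (ne ∘ Fin.suc-injective)) eq) ⟩
   g zero * (b * ∏ (g ∘ suc)) ≡⟨ x∙yz≈y∙xz (g zero) b _ ⟩
   b * (g zero * ∏ (g ∘ suc)) ∎
   where
   open ≤-Reasoning
   open import Algebra.Properties.CommutativeSemigroup *-commutativeSemigroup using (x∙yz≈y∙xz)

 pr : {A : Set} → Bool → A × A → A
 pr false = proj₁
 pr true  = proj₂

 mk : {A : Set} → Bool → A → A → A × A
 mk false i j = i , j
 mk true  i j = j , i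

 pr-mk : {A : Set} (b : Bool) {i j : A} → pr b (mk b i j) ≡ i
 pr-mk false = refl
 pr-mk true  = refl

 pr-not-mk : {A : Set} (b : Bool) {i j : A} → pr (not b) (mk b i j) ≡ j
 pr-not-mk false = refl
 pr-not-mk true  = refl

 mk-not : {A : Set} (b : Bool) {i j : A} → mk (not b) i j ≡ mk b j i
 mk-not false = refl
 mk-not true  = refl

 mk-injective : {A : Set} (b : Bool) {i j k l : A} → mk b i j ≡ mk b k l → i ≡ k × j ≡ l
 mk-injective false refl = refl , refl
 mk-injective true  refl = refl , refl

 -- A Hamilton cycle of the base graph, as the two rotations of the vertex set it defines
 -- (go true = successor) together with the edge used by each step and its stored orientation.
 record HamRot (G : Graph) : Set where
   field
     go     : Bool → Fin (V G) → Fin (V G)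
     go-inv : ∀ d u → go (not d) (go d u) ≡ u
     go-≢   : ∀ d u → go d u ≢ u
     go-≢²  : ∀ d u → go d u ≢ go (not d) u
     ed     : Bool → Fin (V G) → Fin (m G)
     fl     : Bool → Fin (V G) → Bool
     ed-ok  : ∀ d u → lookup (edges G) (ed d u) ≡ mk (fl d u) u (go d u)
     ed-rev : ∀ d u → ed (not d) (go d u) ≡ ed d u
     fl-rev : ∀ d u → fl (not d) (go d u) ≡ not (fl d u)

 module Count (G : Graph) (n : ℕ) (L : List (LiftData G n))
   (liftL : All (IsLift G) L) (uL : Unique L) where

   X : Set
   X = Fin (V G) × Fin n

   _≟X_ : (x y : X) → Dec (x ≡ y)
   _≟X_ = ≡-dec Fin._≟_ Fin._≟_

   Pairs : Set
   Pairs = Fin (m G) → List (Fin n × Fin n)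

   PartialMatching : Pairs → Set
   PartialMatching s = ∀ e b → Unique (map (pr b) (s e))

   S : Set
   S = Σ Pairs PartialMatching

   Match : LiftData G n → Fin (m G) → Fin n × Fin n → Set
   Match σ e ij = lookup (lookup σ e) (proj₁ ij) ≡ proj₂ ij

   Cons : S → LiftData G n → Set
   Cons s σ = ∀ e → All (Match σ e) (proj₁ s e)

   cons? : ∀ s σ → Dec (Cons s σ)
   cons? s σ = Fin.all? λ e → all? (λ ij → lookup (lookup σ e) (proj₁ ij) Fin.≟ proj₂ ij) (proj₁ s e)

   cnt : S → ℕ
   cnt s = ∑ L (λ σ → ind (cons? s σ))

   unexp : S → Fin (m G) → ℕ
   unexp s e = n ∸ length (proj₁ s e)

   -- The number of lifts extending the exposed pairs: an edge with `unexp s e` unmatched vertices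
   -- on each side can be completed in that many factorial ways.
   W : S → ℕ
   W s = ∏ (λ e → unexp s e !)

   W-pos : ∀ s → 1 ≤ W s
   W-pos s = ∏-pos _ (λ e → 1≤n! (unexp s e))

   length-fins : ∀ k → length (allFin k) ≡ k
   length-fins k = length-tabulate {n = k} (λ i → i)

   unique-fins-≤ : {xs : List (Fin n)} → Unique xs → length xs ≤ n
   unique-fins-≤ {xs} u = subst (length xs ≤_) (length-fins n) (Unique⊆⇒length≤ u (λ {z} _ → ∈-allFin z))

   _∈?_ : (i : Fin n) (xs : List (Fin n)) → Dec (i ∈ xs)
   _∈?_ = DecMem._∈?_ Fin._≟_

   surjective : (p : Vec (Fin n) n) → IsPerm p → ∀ j → ∃ λ i → lookup p i ≡ j
   surjective p inj j with Fin.any? (λ i → lookup p i Fin.≟ j)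
   ... | yes r = r
   ... | no ¬r = ⊥-elim (<-irrefl refl (≤-trans (≤-reflexive (cong suc (sym len))) (unique-fins-≤ uniq)))
     where
     img = map (lookup p) (allFin n)
     len : length img ≡ n
     len = trans (length-map _ (allFin n)) (length-fins n)
     uniq : Unique (j ∷ img)
     uniq = unique-∷ (λ j∈ → let (i , _ , eq) = ∈-map⁻ (lookup p) j∈ in ¬r (i , sym eq))
       (Uniq.map⁺ (λ {x} {y} → inj x y) (Uniq.allFin⁺ n))

   act : ∀ σ → IsLift G σ → ∀ e b i → ∃ λ j → Match σ e (mk b i j)
   act σ lf e false i = lookup (lookup σ e) i , refl
   act σ lf e true  i = surjective (lookup σ e) (lf e) i

   match-unique : ∀ σ → IsLift G σ → ∀ e b {i j i′ j′} → Match σ e (mk b i j) → Match σ e (mk b i′ j′) →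
     i ≡ i′ → j ≡ j′
   match-unique σ lf e false p q refl = trans (sym p) q
   match-unique σ lf e true  p q refl = lf e _ _ (trans p (sym q))

   match-source : ∀ σ → IsLift G σ → ∀ e b ij {i j} → Match σ e ij → Match σ e (mk b i j) →
     j ≡ pr (not b) ij → pr b ij ≡ i
   match-source σ lf e false ij p q eq = lf e _ _ (trans p (sym (trans q eq)))
   match-source σ lf e true  ij p q eq = trans (sym p) (trans (cong (lookup (lookup σ e)) (sym eq)) q)

   reveal : Pairs → Fin (m G) → Fin n × Fin n → Pairs
   reveal s e ij e′ with e′ Fin.≟ e
   ... | yes _ = ij ∷ s e′
   ... | no  _ = s e′

   reveal-≡ : ∀ s e ij → reveal s e ij e ≡ ij ∷ s e
   reveal-≡ s e ij with e Fin.≟ e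
   ... | yes _ = refl
   ... | no ne = ⊥-elim (ne refl)

   reveal-≢ : ∀ s {e} ij {e′} → e′ ≢ e → reveal s e ij e′ ≡ s e′
   reveal-≢ s {e} ij {e′} ne with e′ Fin.≟ e
   ... | yes eq = ⊥-elim (ne eq)
   ... | no _   = refl

   Exposed : S → Fin (m G) → Bool → Fin n → Set
   Exposed s e b i = i ∈ map (pr b) (proj₁ s e)

   mk-unique : ∀ b c {ps : List (Fin n × Fin n)} {i j} → (∀ c → Unique (map (pr c) ps)) →
     i ∉ map (pr b) ps → j ∉ map (pr (not b)) ps → Unique (map (pr c) (mk b i j ∷ ps))
   mk-unique false false u i∉ j∉ = unique-∷ i∉ (u false)
   mk-unique false true  u i∉ j∉ = unique-∷ j∉ (u true)
   mk-unique true  false u i∉ j∉ = unique-∷ j∉ (u false)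
   mk-unique true  true  u i∉ j∉ = unique-∷ i∉ (u true)

   extend : ∀ s e b i j → ¬ Exposed s e b i → ¬ Exposed s e (not b) j → S
   extend (s , pm) e b i j i∉ j∉ = reveal s e (mk b i j) , pm′
     where
     pm′ : PartialMatching (reveal s e (mk b i j))
     pm′ e′ c with e′ Fin.≟ e
     ... | yes refl = mk-unique b c (pm e) i∉ j∉
     ... | no _     = pm e′ c

   module Edge (s : S) (e : Fin (m G)) (b : Bool) (i : Fin n) (i∉ : ¬ Exposed s e b i) where
     outs : List (Fin n)
     outs = filter (λ j → ¬? (j ∈? map (pr (not b)) (proj₁ s e))) (allFin n)

     outs-fresh : ∀ {j} → j ∈ outs → ¬ Exposed s e (not b) j
     outs-fresh = proj₂ ∘ ∈-filter⁻ _ {xs = allFin n}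

     outs-complete : ∀ {j} → ¬ Exposed s e (not b) j → j ∈ outs
     outs-complete {j} f = ∈-filter⁺ _ (∈-allFin j) f

     outs-unique : Unique outs
     outs-unique = Uniq.filter⁺ _ (Uniq.allFin⁺ n)

     k : ℕ
     k = length (proj₁ s e)

     length-outs : length outs ≡ n ∸ k
     length-outs = ≤-antisym upper lower
       where
       ts = map (pr (not b)) (proj₁ s e)
       lt : length ts ≡ k
       lt = length-map _ (proj₁ s e)
       upper : length outs ≤ n ∸ k
       upper = subst (_≤ n ∸ k) (m+n∸n≡m (length outs) k) (∸-monoˡ-≤ k (subst (_≤ n)
         (trans (length-++ outs) (cong (length outs +_) lt))
         (unique-fins-≤ (unique-++⁺ outs-unique (proj₂ s e (not b)) outs-fresh))))
       lower : n ∸ k ≤ length outs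
       lower = m≤n+o⇒m∸n≤o n k (subst₂ _≤_ (length-fins n)
         (trans (length-++ outs) (trans (cong (length outs +_) lt) (+-comm (length outs) k)))
         (Unique⊆⇒length≤ (Uniq.allFin⁺ n) sub))
         where
         sub : ∀ {z} → z ∈ allFin n → z ∈ outs ++ ts
         sub {z} _ with z ∈? ts
         ... | yes i = ∈-++⁺ʳ outs i
         ... | no f  = ∈-++⁺ˡ (outs-complete f)

     k<n : k < n
     k<n = subst (_≤ n) (cong suc (length-map _ (proj₁ s e))) (unique-fins-≤ (unique-∷ i∉ (proj₂ s e b)))

     next : ∀ j → S
     next j with j ∈? map (pr (not b)) (proj₁ s e)
     -- Default for a partner that is already taken; `next` is only used at elements of `outs`.
     ... | yes _ = s
     ... | no j∉ = extend s e b i j i∉ j∉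

     next-≡ : ∀ {j} → j ∈ outs → proj₁ (next j) ≡ reveal (proj₁ s) e (mk b i j)
     next-≡ {j} j∈ with j ∈? map (pr (not b)) (proj₁ s e)
     ... | yes e = ⊥-elim (outs-fresh j∈ e)
     ... | no  _ = refl

     cons-next : ∀ {j} → j ∈ outs → ∀ σ → Cons s σ → Match σ e (mk b i j) → Cons (next j) σ
     cons-next {j} j∈ σ c mt e′ rewrite next-≡ j∈ with e′ Fin.≟ e
     ... | yes refl = mt ∷ c e
     ... | no _     = c e′

     next-cons : ∀ {j} → j ∈ outs → ∀ σ → Cons (next j) σ → Cons s σ
     next-cons {j} j∈ σ c e′ with c e′
     ... | r rewrite next-≡ j∈ with e′ Fin.≟ e | r
     ...   | yes refl | _ ∷ a = a
     ...   | no _     | a     = a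

     next-match : ∀ {j} → j ∈ outs → ∀ σ → Cons (next j) σ → Match σ e (mk b i j)
     next-match {j} j∈ σ c with c e
     ... | r rewrite next-≡ j∈ | reveal-≡ (proj₁ s) e (mk b i j) with r
     ...   | a ∷ _ = a

     fresh-image : ∀ σ (lf : IsLift G σ) → Cons s σ → proj₁ (act σ lf e b i) ∈ outs
     fresh-image σ lf c = outs-complete λ j∈ →
       let (ij , ij∈ , eq) = ∈-map⁻ (pr (not b)) j∈
           mt = proj₂ (act σ lf e b i)
       in i∉ (subst (_∈ map (pr b) (proj₁ s e)) (match-source σ lf e b ij (All.lookup (c e) ij∈) mt eq) (∈-map⁺ (pr b) ij∈))

     -- A lift agreeing with `s` matches `i` to a partner not yet taken, and is counted again in the
     -- branch of that partner.
     cnt-next : cnt s ≤ ∑ outs (cnt ∘ next)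
     cnt-next = ≤-trans (∑-mono L (λ {σ} σ∈ → one σ (All.lookup liftL σ∈)))
       (≤-reflexive (sym (∑-swap outs L (λ j σ → ind (cons? (next j) σ)))))
       where
       pick : ∀ {A : Set} (xs : List A) {f x} → x ∈ xs → f x ≤ ∑ xs f
       pick (x ∷ xs) (here refl) = m≤m+n _ _
       pick (x ∷ xs) (there i)   = ≤-trans (pick xs i) (m≤n+m _ _)
       one : ∀ σ → IsLift G σ → ind (cons? s σ) ≤ ∑ outs (λ j → ind (cons? (next j) σ))
       one σ lf with cons? s σ
       ... | no _  = z≤n
       ... | yes c = ≤-trans hit (pick outs {λ j → ind (cons? (next j) σ)} (fresh-image σ lf c))
         where
         hit : 1 ≤ ind (cons? (next (proj₁ (act σ lf e b i))) σ)
         hit with cons? (next (proj₁ (act σ lf e b i))) σ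
         ... | yes _ = ≤-refl
         ... | no ¬c = ⊥-elim (¬c (cons-next (fresh-image σ lf c) σ c (proj₂ (act σ lf e b i))))

     unexp-next : ∀ {j} → j ∈ outs → length outs ≡ suc (unexp (next j) e)
     unexp-next {j} j∈ = trans length-outs (trans (+-∸-assoc 1 k<n)
       (cong (λ l → suc (n ∸ length l)) (sym (trans (cong (λ f → f e) (next-≡ j∈)) (reveal-≡ (proj₁ s) e _)))))

     unexp-next-≢ : ∀ {j} → j ∈ outs → ∀ e′ → e′ ≢ e → unexp s e′ ≡ unexp (next j) e′
     unexp-next-≢ {j} j∈ e′ ne = cong (λ l → n ∸ length l)
       (sym (trans (cong (λ f → f e′) (next-≡ j∈)) (reveal-≢ (proj₁ s) _ ne)))

     -- `r! = r * (r - 1)!` on the exposed edge. All branches thus have equal weight: the partner is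
     -- uniform over `outs`.
     W-next : ∀ {j} → j ∈ outs → W s ≡ length outs * W (next j)
     W-next {j} j∈ = trans (sym (*-identityˡ (W s))) (∏-update e 1 (length outs)
       (λ e′ ne → cong _! (unexp-next-≢ j∈ e′ ne))
       (trans (*-identityˡ (unexp s e !)) (trans (cong _! (trans (sym length-outs) (unexp-next j∈)))
         (cong (_* (unexp (next j) e !)) (sym (unexp-next j∈))))))

     W-next-const : ∀ {j j′} → j ∈ outs → j′ ∈ outs → W (next j) ≡ W (next j′)
     W-next-const {j} {j′} j∈ j′∈ = *-cancelˡ-≡ (W (next j)) (W (next j′)) (suc (unexp (next j) e))
       (subst (λ r → r * W (next j) ≡ r * W (next j′)) (unexp-next j∈) (trans (sym (W-next j∈)) (W-next j′∈)))

   -- Expose the remaining pairs one by one: `cnt` splits over the branches while `W` divides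
   -- equally, and a fully exposed state determines the lift, of which `L` has at most one copy.
   cnt≤W : ∀ s → cnt s ≤ W s
   cnt≤W s = go (total s) s ≤-refl
     where
     total : S → ℕ
     total s = ∑ (allFin (m G)) (unexp s)
     total-< : ∀ (es : List (Fin (m G))) {f g e} → e ∈ es → f e < g e → (∀ e′ → f e′ ≤ g e′) → ∑ es f < ∑ es g
     total-< (e ∷ es) (here refl) lt le = +-mono-<-≤ lt (∑-mono es (λ _ → le _))
     total-< (e ∷ es) (there i)   lt le = +-mono-≤-< (le e) (total-< es i lt le)
     full-cnt : ∀ s → (∀ e i → Exposed s e false i) → cnt s ≤ 1
     full-cnt s full = ≤-trans (≤-reflexive (∑-ind L (cons? s))) (at-most _ (Uniq.filter⁺ (cons? s) uL)
       (λ σ∈ → proj₂ (∈-filter⁻ (cons? s) {xs = L} σ∈)))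
       where
       same : ∀ {σ τ} → Cons s σ → Cons s τ → σ ≡ τ
       same {σ} {τ} c d = Pointwise-≡⇒≡ (ext λ e → Pointwise-≡⇒≡ (ext λ i →
         let (ij , ij∈ , eq) = ∈-map⁻ proj₁ (full e i)
         in trans (cong (lookup (lookup σ e)) eq) (trans (All.lookup (c e) ij∈)
              (trans (sym (All.lookup (d e) ij∈)) (cong (lookup (lookup τ e)) (sym eq))))))
       at-most : ∀ ys → Unique ys → (∀ {σ} → σ ∈ ys → Cons s σ) → length ys ≤ 1
       at-most [] u h = z≤n
       at-most (x ∷ []) u h = ≤-refl
       at-most (x ∷ y ∷ ys) u h = ⊥-elim (unique-head u (here (same (h (here refl)) (h (there (here refl))))))
     go : ∀ t s → total s ≤ t → cnt s ≤ W s
     go t s le with Fin.all? (λ e → Fin.all? (λ i → i ∈? map proj₁ (proj₁ s e)))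
     ... | yes full = ≤-trans (full-cnt s full) (W-pos s)
     ... | no ¬full with Fin.¬∀⟶∃¬ _ _ (λ e → Fin.all? (λ i → i ∈? map proj₁ (proj₁ s e))) ¬full
     ...   | e , ¬e with Fin.¬∀⟶∃¬ _ _ (λ i → i ∈? map proj₁ (proj₁ s e)) ¬e
     ...     | i , i∉ = step t le
       where
       open Edge s e false i i∉
       step : ∀ t → total s ≤ t → cnt s ≤ W s
       step zero le = ⊥-elim (<⇒≱ (≤-trans (s≤s z≤n) (total-< (allFin (m G)) {λ _ → 0} (∈-allFin e)
         (m<n⇒0<n∸m k<n) (λ _ → z≤n))) le)
       step (suc t) le with outs in eqo
       ... | [] = ⊥-elim (<-irrefl (trans (cong length (sym eqo)) length-outs) (m<n⇒0<n∸m k<n))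
       ... | j₀ ∷ _ = begin
         cnt s                         ≤⟨ cnt-next ⟩
         ∑ outs (cnt ∘ next)           ≤⟨ ∑-mono outs (λ j∈ → ≤-trans (go t (next _) (s≤s⁻¹ (<-≤-trans (dec j∈) le)))
                                           (≤-reflexive (W-next-const j∈ j₀∈))) ⟩
         ∑ outs (λ _ → W (next j₀))    ≡⟨ ∑-const outs _ ⟩
         length outs * W (next j₀)     ≡⟨ sym (W-next j₀∈) ⟩
         W s ∎
         where
         open ≤-Reasoning
         j₀∈ : j₀ ∈ outs
         j₀∈ = subst (j₀ ∈_) (sym eqo) (here refl)
         lt : ∀ {j} (j∈ : j ∈ outs) → unexp (next j) e < unexp s e
         lt j∈ = ≤-reflexive (trans (sym (unexp-next j∈)) length-outs)
         dec : ∀ {j} → j ∈ outs → total (next j) < total s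
         dec {j} j∈ = total-< (allFin (m G)) (∈-allFin e) (lt j∈) le′
           where
           le′ : ∀ e′ → unexp (next j) e′ ≤ unexp s e′
           le′ e′ with e′ Fin.≟ e
           ... | yes refl = <⇒≤ (lt j∈)
           ... | no ne    = ≤-reflexive (sym (unexp-next-≢ j∈ e′ ne))

-- Exposing a random lift one half-edge at a time.

module ExposureOracle where

 open ListTools

 -- Sequential exposure of a random lift of one Hamilton cycle.  In state s, cnt s counts the
 -- lifts of a fixed list that agree with s and W s counts all of them, so that cnt s / W s is a
 -- conditional probability.  A half-edge (x , d) is fresh while its partner is unexposed.
 record Exposure : Set₁ where
   field
     {X F S} : Set
     _≟_   : (x y : X) → Dec (x ≡ y)
     fib   : X → F
     n     : ℕ
     go    : Bool → F → F
     cnt W : S → ℕ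
     cnt≤W : ∀ s → cnt s ≤ W s
     W-pos : ∀ s → 1 ≤ W s
     Fresh : S → X → Bool → Set
     Ad    : S → X → X → Set
     Ad-sym : ∀ {s x y} → Ad s x y → Ad s y x

   record Outcome (s : S) (x : X) (d : Bool) (w : X) (s′ : S) : Set where
     field
       fib-eq   : fib w ≡ go d (fib x)
       fresh-w  : Fresh s w (not d)
       adjacent : Ad s′ x w
       Ad-mono  : ∀ {y z} → Ad s y z → Ad s′ y z
       transfer : ∀ {z c} → Fresh s z c → ¬ (z ≡ x × c ≡ d) → ¬ (z ≡ w × c ≡ not d) → Fresh s′ z c

   -- The conditional law of the partner: uniform on `outs`, each outcome carrying weight `W′`.
   -- `cnt-next` plays the role of the law of total probability.
   record Query (s : S) (x : X) (d : Bool) : Set where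
     field
       outs     : List X
       next     : X → S
       W′       : ℕ
       unique   : Unique outs
       complete : ∀ {w} → fib w ≡ go d (fib x) → Fresh s w (not d) → w ∈ outs
       outcome  : ∀ {w} → w ∈ outs → Outcome s x d w (next w)
       cnt-next : cnt s ≤ ∑ outs (cnt ∘ next)
       W-next   : ∀ {w} → w ∈ outs → W (next w) ≡ W′
       W-split  : W s ≡ length outs * W′
       outs≤n   : length outs ≤ n

 record Oracle : Set₁ where
   field exposure : Exposure
   open Exposure exposure public
   field
     go-inv : ∀ d f → go (not d) (go d f) ≡ f
     query : ∀ s x d → Fresh s x d → Query s x d
     fibre : ∀ f → ∃ λ ws → Unique ws × length ws ≡ n × (∀ {w} → w ∈ ws → fib w ≡ f)

 module OracleLemmas (O : Oracle) where
   open Oracle O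

   _∈?_ : (x : X) (xs : List X) → Dec (x ∈ xs)
   _∈?_ = DecMem._∈?_ _≟_

   module _ {s x d} (fr : Fresh s x d) where
     open Query (query s x d fr)

     -- Only vertices in `used` can have lost the opposite half-edge, so all others of the target
     -- fibre are still possible partners.
     n≤outs : ∀ {used} → (∀ z → z ∉ used → ∀ c → Fresh s z c) → n ≤ length outs + length used
     n≤outs {used} fresh with fibre (go d (fib x))
     ... | ws , u , refl , inf = subst (length ws ≤_) (length-++ outs) (Unique⊆⇒length≤ u sub)
       where
       sub : ∀ {z} → z ∈ ws → z ∈ outs ++ used
       sub {z} z∈ with z ∈? used
       ... | yes i = ∈-++⁺ʳ outs i
       ... | no z∉ = ∈-++⁺ˡ (complete (inf z∈) (fresh z z∉ (not d)))

     module _ {b q : ℕ} (p : X → ℕ) where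
       -- Outcomes are equally likely, so pointwise bounds `p w / b` on the conditional probability
       -- average to `q / b`.
       average : (∀ {w s′} → Outcome s x d w s′ → b * cnt s′ ≤ p w * W s′) →
         ∑ outs p ≤ length outs * q → b * cnt s ≤ q * W s
       average h le = begin
         b * cnt s                      ≤⟨ *-monoʳ-≤ b cnt-next ⟩
         b * ∑ outs (cnt ∘ next)        ≡⟨ sym (∑-*ˡ outs b _) ⟩
         ∑ outs (λ w → b * cnt (next w)) ≤⟨ ∑-mono outs (λ {w} i → ≤-trans (h (outcome i)) (≤-reflexive (cong (p w *_) (W-next i)))) ⟩
         ∑ outs (λ w → p w * W′)        ≡⟨ ∑-*ʳ outs W′ p ⟩
         ∑ outs p * W′                  ≤⟨ *-monoˡ-≤ W′ le ⟩
         length outs * q * W′           ≡⟨ cong (_* W′) (*-comm (length outs) q) ⟩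
         q * length outs * W′           ≡⟨ *-assoc q (length outs) W′ ⟩
         q * (length outs * W′)         ≡⟨ cong (q *_) (sym W-split) ⟩
         q * W s                        ∎
         where open ≤-Reasoning

   -- g measures by how much the success probability lowers the bound A/b; q pays for
   -- catastrophic outcomes.
   Gap : (b A : ℕ) → S → (g q : ℕ) → Set
   Gap b A s g q = b * cnt s + g * W s ≤ (A + q) * W s

   gap-weaken : ∀ {b A s g g′ q q′} → g′ ≤ g → q ≤ q′ → Gap b A s g q → Gap b A s g′ q′
   gap-weaken {b} {A} {s} g≤ q≤ h = ≤-trans (+-monoʳ-≤ (b * cnt s) (*-monoˡ-≤ (W s) g≤))
     (≤-trans h (*-monoˡ-≤ (W s) (+-monoʳ-≤ A q≤)))

   -- Outcomes are successes (`sc`), catastrophes (`ct`) or neutral. Successes have probability at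
   -- least `length sc / n` because `outs` has at most `n` elements, catastrophes at most
   -- `2 * length ct / n` because it has at least `n / 2`. A neutral outcome must preserve the bound
   -- `A / b` up to `q`.
   gap-query : ∀ {s x d used sc ct} b A {g g₁ q θ} (fr : Fresh s x d) →
     (∀ z → z ∉ used → ∀ c → Fresh s z c) → 2 * length used ≤ n →
     Unique sc → (∀ {w} → w ∈ sc → fib w ≡ go d (fib x) × Fresh s w (not d)) →
     n * g ≤ length sc * g₁ →
     2 * (length ct * b) ≤ n * θ →
     (∀ {w s′} → Outcome s x d w s′ → w ∈ sc → Gap b A s′ g₁ q) →
     (∀ {w s′} → Outcome s x d w s′ → w ∉ sc → w ∉ ct → Gap b A s′ 0 q) →
     Gap b A s g (q + θ)
   gap-query {s} {x} {d} {used} {sc} {ct} b A {g} {g₁} {q} {θ} fr fresh half usc sc-ok ng cat succ fail = begin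
     b * cnt s + g * W s
       ≤⟨ +-mono-≤ (*-monoʳ-≤ b cnt-next) (≤-trans (≤-reflexive (cong (g *_) W-split)) gain) ⟩
     b * ∑ outs (cnt ∘ next) + ∑ outs gs * W′
       ≡⟨ cong₂ _+_ (sym (∑-*ˡ outs b _)) (sym (∑-*ʳ outs W′ gs)) ⟩
     ∑ outs (λ w → b * cnt (next w)) + ∑ outs (λ w → gs w * W′)
       ≡⟨ sym (∑-+ outs _ _) ⟩
     ∑ outs (λ w → b * cnt (next w) + gs w * W′)
       ≤⟨ ∑-mono outs each ⟩
     ∑ outs (λ w → ((A + q) + b * cs w) * W′)
       ≡⟨ ∑-*ʳ outs W′ _ ⟩
     ∑ outs (λ w → (A + q) + b * cs w) * W′
       ≤⟨ *-monoˡ-≤ W′ loss ⟩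
     length outs * (A + (q + θ)) * W′
       ≡⟨ trans (cong (_* W′) (*-comm (length outs) _)) (trans (*-assoc (A + (q + θ)) _ W′) (cong ((A + (q + θ)) *_) (sym W-split))) ⟩
     (A + (q + θ)) * W s ∎
     where
     open ≤-Reasoning
     open Query (query s x d fr)
     gs cs : X → ℕ
     gs w = ind (w ∈? sc) * g₁
     cs w = ind (w ∈? ct)
     gain : g * (length outs * W′) ≤ ∑ outs gs * W′
     gain = begin
       g * (length outs * W′)   ≡⟨ sym (*-assoc g _ W′) ⟩
       g * length outs * W′     ≤⟨ *-monoˡ-≤ W′ (≤-trans (*-monoʳ-≤ g outs≤n) (≤-reflexive (*-comm g n))) ⟩
       n * g * W′               ≤⟨ *-monoˡ-≤ W′ ng ⟩
       length sc * g₁ * W′      ≤⟨ *-monoˡ-≤ W′ (*-monoˡ-≤ g₁ (≤-trans (Unique⊆⇒length≤ usc sub) (≤-reflexive (sym (∑-ind outs (_∈? sc)))))) ⟩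
       ∑ outs (λ w → ind (w ∈? sc)) * g₁ * W′ ≡⟨ cong (_* W′) (sym (∑-*ʳ outs g₁ _)) ⟩
       ∑ outs gs * W′ ∎
       where
       sub : ∀ {z} → z ∈ sc → z ∈ filter (_∈? sc) outs
       sub z∈ = ∈-filter⁺ (_∈? sc) (let (e , f) = sc-ok z∈ in complete e f) z∈
     each : ∀ {w} → w ∈ outs → b * cnt (next w) + gs w * W′ ≤ ((A + q) + b * cs w) * W′
     each {w} w∈ with w ∈? sc | w ∈? ct
     ... | yes i | _ = begin
       b * cnt (next w) + 1 * g₁ * W′        ≡⟨ cong (λ t → b * cnt (next w) + t) (cong₂ _*_ (*-identityˡ g₁) (sym (W-next w∈))) ⟩
       b * cnt (next w) + g₁ * W (next w)    ≤⟨ succ (outcome w∈) i ⟩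
       (A + q) * W (next w)                  ≡⟨ cong ((A + q) *_) (W-next w∈) ⟩
       (A + q) * W′                          ≤⟨ *-monoˡ-≤ W′ (m≤m+n (A + q) _) ⟩
       _ ∎
     ... | no ∉sc | no ∉ct = begin
       b * cnt (next w) + 0                  ≤⟨ fail (outcome w∈) ∉sc ∉ct ⟩
       (A + q) * W (next w)                  ≡⟨ cong ((A + q) *_) (W-next w∈) ⟩
       (A + q) * W′                          ≤⟨ *-monoˡ-≤ W′ (m≤m+n (A + q) _) ⟩
       _ ∎
     ... | no ∉sc | yes _ = begin
       b * cnt (next w) + 0                  ≡⟨ +-identityʳ _ ⟩
       b * cnt (next w)                      ≤⟨ *-monoʳ-≤ b (cnt≤W (next w)) ⟩
       b * W (next w)                        ≡⟨ cong₂ _*_ (sym (*-identityʳ b)) (W-next w∈) ⟩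
       b * 1 * W′                            ≤⟨ *-monoˡ-≤ W′ (m≤n+m (b * 1) (A + q)) ⟩
       _ ∎
     n≤2r : n ≤ 2 * length outs
     n≤2r = +-cancelʳ-≤ n n (2 * length outs) (begin
       n + n                                       ≤⟨ +-mono-≤ (n≤outs fr fresh) (n≤outs fr fresh) ⟩
       length outs + length used + (length outs + length used)
         ≡⟨ solve 2 (λ a b → a :+ b :+ (a :+ b) := con 2 :* a :+ con 2 :* b) refl (length outs) (length used) ⟩
       2 * length outs + 2 * length used           ≤⟨ +-monoʳ-≤ (2 * length outs) half ⟩
       2 * length outs + n ∎)
       where open +-*-Solver
     cats : length ct * b ≤ length outs * θ
     cats = *-cancelˡ-≤ 2 (≤-trans cat (≤-trans (*-monoˡ-≤ θ n≤2r) (≤-reflexive (*-assoc 2 (length outs) θ))))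
     loss : ∑ outs (λ w → (A + q) + b * cs w) ≤ length outs * (A + (q + θ))
     loss = begin
       ∑ outs (λ w → (A + q) + b * cs w)                ≡⟨ ∑-+ outs _ _ ⟩
       ∑ outs (λ _ → A + q) + ∑ outs (λ w → b * cs w)   ≡⟨ cong₂ _+_ (∑-const outs _) (∑-*ˡ outs b cs) ⟩
       length outs * (A + q) + b * ∑ outs cs            ≤⟨ +-monoʳ-≤ _ (≤-trans (*-monoʳ-≤ b (∑-ind≤ (_∈? ct) unique (λ _ i → i))) (≤-reflexive (*-comm b _))) ⟩
       length outs * (A + q) + length ct * b            ≤⟨ +-monoʳ-≤ _ cats ⟩
       length outs * (A + q) + length outs * θ          ≡⟨ trans (sym (*-distribˡ-+ (length outs) (A + q) θ)) (cong (length outs *_) (+-assoc A q θ)) ⟩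
       length outs * (A + (q + θ)) ∎

-- Pósa rotations and the absorption of cycles.

module PathRotation where

 open ListTools

 ∉-concat-head : {A : Set} {w : A} {r : List A} {rs : List (List A)} → w ∉ concat (r ∷ rs) → w ∉ r
 ∉-concat-head h = h ∘ ∈-++⁺ˡ

 ∉-concat-tail : {A : Set} {w : A} (r : List A) {rs : List (List A)} → w ∉ concat (r ∷ rs) → w ∉ concat rs
 ∉-concat-tail r h = h ∘ ∈-++⁺ʳ r

 concat-mid : {A : Set} (cs : List (List A)) {c : List A} {ds : List (List A)} →
   concat (cs ++ c ∷ ds) ↭ c ++ concat (cs ++ ds)
 concat-mid []       = ↭-refl
 concat-mid (b ∷ cs) {c} = ↭-trans (++⁺ˡ b (concat-mid cs)) (shifts b c)

 module _ {A : Set} where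

   -- Rotations reverse initial segments, so a reserved run is found again only up to direction.
   _⊑±_ : List A → List A → Set
   r ⊑± l = Infix r l ⊎ Infix (reverse r) l

   ⊑±-++ˡ : ∀ z {r l} → r ⊑± l → r ⊑± (z ++ l)
   ⊑±-++ˡ z = Sum.map (infix-++ˡ z) (infix-++ˡ z)

   ⊑±-++ʳ : ∀ z {r l} → r ⊑± l → r ⊑± (l ++ z)
   ⊑±-++ʳ z = Sum.map (infix-++ʳ z) (infix-++ʳ z)

   ⊑±-reverse : ∀ {r l} → r ⊑± l → r ⊑± reverse l
   ⊑±-reverse (inj₁ i) = inj₂ (infix-reverse i)
   ⊑±-reverse {r} {l} (inj₂ i) = inj₁ (subst (λ z → Infix z (reverse l)) (reverse-involutive r) (infix-reverse i))

   ∈-reverse⁻ : ∀ {w} {r : List A} → w ∈ reverse r → w ∈ r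
   ∈-reverse⁻ {r = r} = ∈-resp-↭ (↭-reverse r)

   ⊑±-split : ∀ {w r} us {vs} → w ∉ r → r ⊑± (us ++ w ∷ vs) → r ⊑± us ⊎ r ⊑± vs
   ⊑±-split us w∉ (inj₁ i) = Sum.map inj₁ inj₁ (infix-split us w∉ i)
   ⊑±-split us w∉ (inj₂ i) = Sum.map inj₂ inj₂ (infix-split us (w∉ ∘ ∈-reverse⁻) i)

   ⊑±-∈ : ∀ {r l w} → r ⊑± l → w ∈ r → w ∈ l
   ⊑±-∈ (inj₁ i) w∈ = infix-∈ i w∈
   ⊑±-∈ {r} (inj₂ i) w∈ = infix-∈ i (∈-resp-↭ (↭-sym (↭-reverse r)) w∈)

 -- A spanning path together with the cycles it has not yet absorbed; the path runs from an
 -- active head to the stored end (a half-edge, along which the path is to be closed).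
 record Conf (X : Set) : Set where
   constructor conf
   field
     end  : X × Bool
     path : List X
     cycs : List (List X)
 open Conf public

 module Moves {X : Set} (allX : List X) where

   record Good (K : X → X → Set) (x : X) (Q : Conf X) : Set where
     field
       head   : ∃ λ t → path Q ≡ x ∷ t
       last   : ∃ λ t → path Q ≡ t ++ [ proj₁ (end Q) ]
       chain  : Chain K (path Q)
       cycles : All (Closed K) (cycs Q)
       cover  : path Q ++ concat (cycs Q) ↭ allX
   open Good

   good-map : ∀ {K K′ x Q} → (∀ {y z} → K y z → K′ y z) → Good K x Q → Good K′ x Q
   good-map {Q = Q} h g = record
     { head = head g ; last = last g ; chain = chain-map h (path Q) (chain g)
     ; cycles = All.map (λ {c} → closed-map h c) (cycles g) ; cover = cover g }

   good-reverse : ∀ {K x Q} d → (∀ {y z} → K y z → K z y) → Good K x Q →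
     Good K (proj₁ (end Q)) (conf (x , d) (reverse (path Q)) (cycs Q))
   good-reverse {K} {x} {Q} d sy g with head g | last g
   ... | t , e | t′ , e′ = record
     { head = reverse t′ , trans (cong reverse e′) (reverse-++ t′ [ _ ])
     ; last = reverse t , trans (cong reverse e) (unfold-reverse x t)
     ; chain = chain-reverse sy (path Q) (chain g)
     ; cycles = cycles g
     ; cover = ↭-trans (++⁺ʳ _ (↭-reverse (path Q))) (cover g) }

   module _ {K K′ : X → X → Set} (K⊆ : ∀ {y z} → K y z → K′ y z) (K′-sym : ∀ {y z} → K′ y z → K′ z y) where

     rotated : Conf X → X → List X → X → List X → Conf X
     rotated Q y us w vs = record Q { path = y ∷ reverse us ++ w ∷ vs }

     -- Pósa rotation: the edge `y w` is exchanged for `x w`, the segment before `w` is reversed,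
     -- and the predecessor `y` becomes active. The stored end stays, as it lies at or after `w`.
     moveP : ∀ {x w y Q} us {vs} → Good K x Q → path Q ≡ us ++ y ∷ w ∷ vs → K′ x w →
       Good K′ y (rotated Q y us w vs)
     moveP {x} {w} {y} {Q} us {vs} g eq xw = record
       { head = _ , refl
       ; last = let (t , e) = last g
                    (t′ , e′) = last-suffix us {w = y} {vs = w ∷ vs} (trans (sym eq) e)
                    (t″ , e″) = last-suffix [ y ] {w = w} {vs = vs} {t = t′} e′
                in (y ∷ reverse us) ++ t″ ,
                   trans (cong ((y ∷ reverse us) ++_) e″) (sym (++-assoc (y ∷ reverse us) t″ _))
       ; chain = ch us (proj₂ (head g)) eq
       ; cycles = All.map (λ {c} → closed-map K⊆ c) (cycles g)
       ; cover = ↭-trans (++⁺ʳ (concat (cycs Q)) perm) (cover g) }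
       where
       rev-y : ∀ us → reverse (us ++ [ y ]) ≡ y ∷ reverse us
       rev-y us = reverse-++ us [ y ]
       perm : y ∷ reverse us ++ w ∷ vs ↭ path Q
       perm = begin
         y ∷ reverse us ++ w ∷ vs        ≡⟨ cong (_++ w ∷ vs) (sym (rev-y us)) ⟩
         reverse (us ++ [ y ]) ++ w ∷ vs ↭⟨ ++⁺ʳ (w ∷ vs) (↭-reverse (us ++ [ y ])) ⟩
         (us ++ [ y ]) ++ w ∷ vs         ≡⟨ trans (++-assoc us [ y ] (w ∷ vs)) (sym eq) ⟩
         path Q ∎
         where open PermutationReasoning
       tail-chain : Chain K′ (w ∷ vs)
       tail-chain = chain-map K⊆ (w ∷ vs) (chain-right [ y ] (chain-right us (subst (Chain K) eq (chain g))))
       rev-chain : Chain K′ (y ∷ reverse us)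
       rev-chain = subst (Chain K′) (rev-y us) (chain-reverse K′-sym (us ++ [ y ])
         (chain-map K⊆ (us ++ [ y ]) (chain-left (us ++ [ y ])
           (subst (Chain K) (trans eq (sym (++-assoc us [ y ] (w ∷ vs)))) (chain g)))))
       ch : ∀ us′ {t} → path Q ≡ x ∷ t → path Q ≡ us′ ++ y ∷ w ∷ vs → Chain K′ (y ∷ reverse us ++ w ∷ vs)
       -- With nothing before `y`, the head `x` is `y` itself and the new edge joins the same two
       -- vertices as the dropped one.
       ch [] e e′ with ∷-injective (trans (sym e) eq₀)
         where eq₀ = e′
       ... | refl , _ = subst (λ u → Chain K′ (y ∷ reverse u ++ w ∷ vs)) (sym (us-nil us (trans (sym eq) e′))) (xw , tail-chain)
         where
         us-nil : ∀ us → us ++ y ∷ w ∷ vs ≡ y ∷ w ∷ vs → us ≡ []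
         us-nil [] _ = refl
         us-nil (u ∷ us) q = ⊥-elim (1+n≰n (≤-trans (≤-trans (m≤n+m _ (length us)) (≤-reflexive (sym (length-++ us)))) (≤-reflexive (suc-injective (cong length q)))))
       ch (u ∷ us′) e e′ with ∷-injective (trans (sym e) e′)
       ... | refl , _ = subst (Chain K′) (sym glued) (chain-glue (y ∷ reverse us′) (subst (Chain K′) front rev-chain) (xw , tail-chain))
         where
         cancel : ∀ (as bs : List X) {cs} → as ++ cs ≡ bs ++ cs → as ≡ bs
         cancel as bs {cs} q = Data.List.Properties.++-cancelʳ cs as bs q
         us-eq : us ≡ x ∷ us′
         us-eq = cancel us (x ∷ us′) (trans (sym eq) e′)
         front : y ∷ reverse us ≡ (y ∷ reverse us′) ++ [ x ]
         front = cong (y ∷_) (trans (cong reverse us-eq) (unfold-reverse x us′))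
         glued : y ∷ reverse us ++ w ∷ vs ≡ (y ∷ reverse us′) ++ x ∷ w ∷ vs
         glued = trans (cong (_++ w ∷ vs) front) (++-assoc (y ∷ reverse us′) [ x ] (w ∷ vs))

     absorbed : Conf X → List X → List X → X → List (List X) → Conf X
     absorbed Q us vs w cs = conf (end Q) (vs ++ us ++ w ∷ path Q) cs

     -- The cycle is opened between `w` and its successor `y` and prepended through the edge `w x`.
     -- A cycle consisting of `w` alone has no other vertex to become active; irreflexivity rules it
     -- out.
     moveC : ∀ {x w Q} cs₁ {cs₂} us {vs} → Good K x Q → cycs Q ≡ cs₁ ++ (us ++ w ∷ vs) ∷ cs₂ → K′ x w → ¬ K w w →
       ∃ λ y → K w y × Good K′ y (absorbed Q us vs w (cs₁ ++ cs₂))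
     moveC {x} {w} {Q} cs₁ {cs₂} us {vs} g eq xw irr with vs ++ us in eqv | cyc
       where
       cl : Closed K (us ++ w ∷ vs)
       cl = All.head (AllP.++⁻ʳ cs₁ (subst (All (Closed K)) eq (cycles g)))
       cyc : Chain K (w ∷ (vs ++ us) ++ [ w ])
       cyc = subst (λ l → Chain K (w ∷ l)) (sym (++-assoc vs us [ w ])) (closed-rotate us w vs cl)
     ... | []    | (k , _) = ⊥-elim (irr k)
     ... | y ∷ r | (k , c) = y , k , record
       { head = _ , front
       ; last = let (t , e) = last g in vs ++ us ++ w ∷ t ,
           trans (cong (λ p → vs ++ us ++ w ∷ p) e) (trans (cong (vs ++_) (sym (++-assoc us (w ∷ t) _))) (sym (++-assoc vs (us ++ w ∷ t) _)))
       ; chain = subst (Chain K′) (sym front) (chain-glue (y ∷ r) (chain-map K⊆ (y ∷ r ++ [ w ]) c)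
           (subst (λ p → Chain K′ (w ∷ p)) (sym (proj₂ (head g)))
             (K′-sym xw , subst (Chain K′) (proj₂ (head g)) (chain-map K⊆ (path Q) (chain g)))))
       ; cycles = let a = All.map (λ {c} → closed-map K⊆ c) (subst (All (Closed K)) eq (cycles g))
                  in AllP.++⁺ (AllP.++⁻ˡ cs₁ a) (All.tail (AllP.++⁻ʳ cs₁ a))
       ; cover = ↭-trans perm (cover g) }
       where
       front : vs ++ us ++ w ∷ path Q ≡ y ∷ r ++ w ∷ path Q
       front = trans (sym (++-assoc vs us _)) (cong (_++ w ∷ path Q) eqv)
       perm : (vs ++ us ++ w ∷ path Q) ++ concat (cs₁ ++ cs₂) ↭ path Q ++ concat (cycs Q)
       perm = begin
         (vs ++ us ++ w ∷ path Q) ++ concat (cs₁ ++ cs₂)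
           ≡⟨ cong (_++ concat (cs₁ ++ cs₂)) (trans (cong (vs ++_) (sym (++-assoc us [ w ] (path Q)))) (sym (++-assoc vs (us ++ [ w ]) (path Q)))) ⟩
         ((vs ++ us ++ [ w ]) ++ path Q) ++ concat (cs₁ ++ cs₂)
           ↭⟨ ++⁺ʳ (concat (cs₁ ++ cs₂)) (++-comm (vs ++ us ++ [ w ]) (path Q)) ⟩
         (path Q ++ (vs ++ us ++ [ w ])) ++ concat (cs₁ ++ cs₂)
           ≡⟨ ++-assoc (path Q) _ _ ⟩
         path Q ++ (vs ++ us ++ [ w ]) ++ concat (cs₁ ++ cs₂)
           ↭⟨ ++⁺ˡ (path Q) (++⁺ʳ (concat (cs₁ ++ cs₂)) (↭-trans (++-comm vs (us ++ [ w ])) (↭-reflexive (++-assoc us [ w ] vs)))) ⟩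
         path Q ++ (us ++ w ∷ vs) ++ concat (cs₁ ++ cs₂)
           ↭⟨ ++⁺ˡ (path Q) (↭-sym (concat-mid cs₁)) ⟩
         path Q ++ concat (cs₁ ++ (us ++ w ∷ vs) ∷ cs₂)
           ≡⟨ cong (λ c → path Q ++ concat c) (sym eq) ⟩
         path Q ++ concat (cycs Q) ∎
         where open PermutationReasoning

-- Invariants of one phase, and the effect of one exposure on a path.

module RotationSetting where

 open ListTools
 open ExposureOracle
 open PathRotation

 -- The lift of the first Hamilton cycle is already known (the permutation ρ true, with inverse
 -- ρ false); the lift of the second one is still to be exposed.
 record Setting : Set₁ where
   field oracle : Oracle
   open Oracle oracle public
   field
     go₁    : Bool → F → F
     ρ      : Bool → X → X
     ρ-inv  : ∀ d x → ρ (not d) (ρ d x) ≡ x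
     ρ-≢    : ∀ d x → ρ d x ≢ x
     ρ-≢²   : ∀ x → ρ true x ≢ ρ false x
     fib-ρ  : ∀ d x → fib (ρ d x) ≡ go₁ d (fib x)
     allX   : List X
     all-unique   : Unique allX
     all-complete : ∀ x → x ∈ allX
     finished : ∀ s c → Closed (Ad s) c → c ↭ allX → cnt s ≡ 0

 -- `Ex₀` holds the vertices touched before this phase, `CutL` the reserved ends of the small cycles
 -- still to be merged, `E₀` the half-edges along which a path may be closed.
 module Phase (St : Setting) (Ex₀ CutL : List (Setting.X St)) (E₀ : List (Setting.X St × Bool)) where

   open Setting St

   open OracleLemmas oracle public
   open Moves allX public
   open Good public

   Ex : List X → List X
   Ex Nw = Nw ++ Ex₀

   -- Outside `nb l` both ρ-neighbours of a vertex avoid `l` too. A hit outside `nb (Ex Nw)`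
   -- therefore makes an untouched vertex active, whichever side is taken.
   nb : List X → List X
   nb l = l ++ map (ρ true) l ++ map (ρ false) l

   length-nb : ∀ l → length (nb l) ≡ 3 * length l
   length-nb l = trans (length-++ l) (cong (length l +_) (trans (length-++ (map (ρ true) l))
     (cong₂ _+_ (length-map (ρ true) l) (trans (length-map (ρ false) l) (sym (+-identityʳ _))))))

   ∈-nb : ∀ {l} d {w} → ρ d w ∈ l → w ∈ nb l
   ∈-nb {l} true {w} i = ∈-++⁺ʳ l (∈-++⁺ʳ (map (ρ true) l) (subst (_∈ map (ρ false) l) (ρ-inv true w) (∈-map⁺ (ρ false) i)))
   ∈-nb {l} false {w} i = ∈-++⁺ʳ l (∈-++⁺ˡ (subst (_∈ map (ρ true) l) (ρ-inv false w) (∈-map⁺ (ρ true) i)))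

   ∉-nb : ∀ {l w} → w ∉ nb l → w ∉ l
   ∉-nb h = h ∘ ∈-++⁺ˡ

   -- Nw collects the vertices touched in the current phase.  The source x is recorded once more, so
   -- that a stored end that loses its freshness is always found in Nw.
   grow : X → X → List X → List X
   grow x w Nw = x ∷ w ∷ ρ true w ∷ ρ false w ∷ Nw

   ρ∈grow : ∀ d {x w Nw} → ρ d w ∈ grow x w Nw
   ρ∈grow true  = there (there (here refl))
   ρ∈grow false = there (there (there (here refl)))

   ⊆grow : ∀ {x w Nw z} → z ∈ Ex Nw → z ∈ Ex (grow x w Nw)
   ⊆grow = there ∘ there ∘ there ∘ there

   -- The second component makes every known edge at an untouched vertex an edge of the first lift.
   -- Hence the neighbour of an untouched `w` that becomes active is `ρ d w` for some `d`, whatever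
   -- the history of the path.
   K : S → List X → X → X → Set
   K s Nw y z = Ad s y z × ((∃ λ d → z ≡ ρ d y) ⊎ (y ∈ Ex Nw × z ∈ Ex Nw))

   flip-ρ : ∀ {d y z} → z ≡ ρ d y → y ≡ ρ (not d) z
   flip-ρ {d} {y} refl = sym (ρ-inv d y)

   K-sym : ∀ {s Nw y z} → K s Nw y z → K s Nw z y
   K-sym (a , inj₁ (d , e)) = Ad-sym a , inj₁ (not d , flip-ρ e)
   K-sym (a , inj₂ (i , j)) = Ad-sym a , inj₂ (j , i)

   K-fresh : ∀ {s Nw y w} → w ∉ Ex Nw → K s Nw y w → ∃ λ d → y ≡ ρ d w
   K-fresh w∉ (a , inj₁ (d , e)) = not d , flip-ρ e
   K-fresh w∉ (a , inj₂ (_ , j)) = ⊥-elim (w∉ j)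

   K-irrefl : ∀ {s Nw w} → w ∉ Ex Nw → ¬ K s Nw w w
   K-irrefl w∉ k = let (d , e) = K-fresh w∉ k in ρ-≢ d _ (sym e)

   K-mono : ∀ {s x d w s′ Nw y z} → Outcome s x d w s′ → K s Nw y z → K s′ (grow x w Nw) y z
   K-mono {Nw = Nw} o (a , inj₁ p)       = Outcome.Ad-mono o a , inj₁ p
   K-mono {Nw = Nw} o (a , inj₂ (i , j)) = Outcome.Ad-mono o a , inj₂ (⊆grow {Nw = Nw} i , ⊆grow {Nw = Nw} j)

   K-new : ∀ {s x d w s′ Nw} → Outcome s x d w s′ → K s′ (grow x w Nw) x w
   K-new o = Outcome.adjacent o , inj₂ (here refl , there (here refl))

   -- `Pd` has to stay fresh throughout, since a later exposure starts there. A half-edge in `E₀`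
   -- may be lost, provided that its vertex is recorded in `Nw`, where the losses can be counted.
   record Inv (s : S) (Nw : List X) (Pd : List (X × Bool)) : Set where
     field
       fresh : ∀ z → z ∉ Ex Nw → ∀ c → Fresh s z c
       kept  : ∀ {a c} → (a , c) ∈ E₀ → Fresh s a c ⊎ a ∈ Nw
       cut   : ∀ {z} → z ∈ CutL → z ∉ Ex Nw
       prot  : ∀ {z c} → (z , c) ∈ Pd → z ∈ Ex Nw × Fresh s z c
   open Inv public

   transfer-≢ : ∀ {s x d w s′} → Outcome s x d w s′ → ∀ {z c} → (z , c) ≢ (x , d) → (z , c) ≢ (w , not d) →
     Fresh s z c → Fresh s′ z c
   transfer-≢ o ne ne′ f = Outcome.transfer o f (λ { (refl , refl) → ne refl }) (λ { (refl , refl) → ne′ refl })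

   inv-next : ∀ {s x d w s′ Nw Pd} → Inv s Nw Pd → x ∈ Ex Nw → (x , d) ∉ Pd → Outcome s x d w s′ →
     w ∉ nb CutL → w ∉ map proj₁ Pd → Inv s′ (grow x w Nw) Pd
   inv-next {s} {x} {d} {w} {s′} {Nw} {Pd} inv x∈ xd∉ o w∉C w∉P = record
     { fresh = λ z z∉ c → transfer-≢ o (λ { refl → z∉ (here refl) }) (λ { refl → z∉ (there (here refl)) })
         (fresh inv z (z∉ ∘ ⊆grow {Nw = Nw}) c)
     ; kept = kept′
     ; cut = λ z∈ → λ
         { (here refl) → cut inv z∈ x∈
         ; (there (here refl)) → ∉-nb w∉C z∈
         ; (there (there (here refl))) → w∉C (∈-nb true z∈)
         ; (there (there (there (here refl)))) → w∉C (∈-nb false z∈)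
         ; (there (there (there (there i)))) → cut inv z∈ i }
     ; prot = λ {z} {c} zc∈ → let (i , f) = prot inv zc∈ in ⊆grow {Nw = Nw} i ,
         transfer-≢ o (λ { refl → xd∉ zc∈ }) (λ { refl → w∉P (∈-map⁺ proj₁ zc∈) }) f }
     where
     kept′ : ∀ {a c} → (a , c) ∈ E₀ → Fresh s′ a c ⊎ a ∈ grow x w Nw
     kept′ {a} {c} i with kept inv i
     ... | inj₂ a∈ = inj₂ (there (there (there (there a∈))))
     ... | inj₁ f with a ≟ x | a ≟ w
     ...   | yes refl | _        = inj₂ (here refl)
     ...   | no _     | yes refl = inj₂ (there (here refl))
     ...   | no a≢x   | no a≢w   = inj₁ (transfer-≢ o (λ { refl → a≢x refl }) (λ { refl → a≢w refl }) f)

   -- Dropping the closing edge turns such a cycle into a path with two reserved, still untouched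
   -- ends: one to grow from, one to keep.
   CutIn : List X → Set
   CutIn c = ∃ λ x → ∃ λ mid → ∃ λ b → c ≡ x ∷ mid ++ [ b ] × x ∈ CutL × b ∈ CutL

   Absorbed : List (List X) → ℕ → Conf X → Set
   Absorbed Rs k Q = All (_⊑± path Q) Rs × All CutIn (cycs Q) × length (cycs Q) < k

   -- The big cycle carrying the reserved runs Rs, if not yet absorbed, comes first.
   Waiting : List (List X) → ℕ → Conf X → Set
   Waiting Rs k Q = ∃ λ c → ∃ λ rest → cycs Q ≡ c ∷ rest × All (_⊑± c) Rs × All CutIn rest × length rest < k

   Located : List (List X) → ℕ → Conf X → Set
   Located Rs k Q = Absorbed Rs k Q ⊎ Waiting Rs k Q

   module _ {s x d w s′ Nw} (o : Outcome s x d w s′) (x∈ : x ∈ Ex Nw) (w∉ : w ∉ Ex Nw) where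

     private
       K₀ = K s Nw
       K₁ = K s′ (grow x w Nw)

     Moved : (Conf X → Set) → Conf X → Set
     Moved P Q = ∃ λ c → ∃ λ Q′ → end Q′ ≡ end Q × Good K₁ (ρ c w) Q′ × P Q′

     find-path : ∀ {Q} → Good K₀ x Q → w ∈ path Q → ∃ λ us → ∃ λ y → ∃ λ vs → path Q ≡ us ++ y ∷ w ∷ vs
     find-path {Q} g i with ∈-∃++ i
     ... | [] , vs , eq = ⊥-elim (w∉ (subst (_∈ Ex Nw) (proj₁ (∷-injective (trans (sym (proj₂ (head g))) eq))) x∈))
     ... | a ∷ as , vs , eq with snoc-view a as
     ...   | m , y , e = m , y , vs , trans eq (trans (cong (_++ w ∷ vs) e) (++-assoc m [ y ] (w ∷ vs)))

     step-path : ∀ {Q} us {y vs} → Good K₀ x Q → path Q ≡ us ++ y ∷ w ∷ vs →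
       K₀ y w × Good K₁ y (record Q { path = y ∷ reverse us ++ w ∷ vs })
     step-path us g eq = chain-mid us (subst (Chain K₀) eq (chain g)) ,
       moveP (K-mono {Nw = Nw} o) K-sym us g eq (K-new {Nw = Nw} o)

     runs-path : ∀ {r} us {y vs} → w ∉ r → r ⊑± (us ++ y ∷ w ∷ vs) → r ⊑± (y ∷ reverse us ++ w ∷ vs)
     runs-path {r} us {y} {vs} w∉r i with ⊑±-split (us ++ [ y ]) w∉r (subst (r ⊑±_) (sym (++-assoc us [ y ] (w ∷ vs))) i)
     ... | inj₁ j = ⊑±-++ʳ (w ∷ vs) (subst (r ⊑±_) (Data.List.Properties.reverse-++ us [ y ]) (⊑±-reverse j))
     ... | inj₂ j = subst (r ⊑±_) (++-assoc (y ∷ reverse us) [ w ] vs) (⊑±-++ˡ (y ∷ reverse us ++ [ w ]) {l = vs} j)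

     runs-cycle : ∀ {r} us {vs} p → w ∉ r → r ⊑± (us ++ w ∷ vs) → r ⊑± (vs ++ us ++ w ∷ p)
     runs-cycle us {vs} p w∉r i with ⊑±-split us w∉r i
     ... | inj₁ j = ⊑±-++ˡ vs (⊑±-++ʳ (w ∷ p) j)
     ... | inj₂ j = ⊑±-++ʳ (us ++ w ∷ p) j

     map-runs : ∀ {l l′} (Rs : List (List X)) → w ∉ concat Rs →
       (∀ {r} → w ∉ r → r ⊑± l → r ⊑± l′) → All (_⊑± l) Rs → All (_⊑± l′) Rs
     map-runs [] _ f [] = []
     map-runs (r ∷ Rs) h f (i ∷ is) = f (∉-concat-head {rs = Rs} h) i ∷ map-runs Rs (∉-concat-tail r {Rs} h) f is

     step-abs : ∀ {Rs k Q} → Good K₀ x Q → w ∉ concat Rs → Absorbed Rs k Q → Moved (Absorbed Rs k) Q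
     step-abs {Rs} {k} {Q} g w∉R (runs , cuts , lt) with ∈-++⁻ (path Q) (∈-resp-↭ (↭-sym (cover g)) (all-complete w))
     ... | inj₁ i with find-path g i
     ...   | us , y , vs , eq with step-path us g eq
     ...     | kyw , g′ with K-fresh {Nw = Nw} w∉ kyw
     ...       | c , refl = c , _ , refl , g′ , map-runs Rs w∉R (λ {r} h j → runs-path us h (subst (r ⊑±_) eq j)) runs , cuts , lt
     step-abs {Rs} {k} {Q} g w∉R (runs , cuts , lt) | inj₂ i with ∈-concat⁻′ (cycs Q) i
     ... | c , w∈c , c∈ with ∈-∃++ c∈ | ∈-∃++ w∈c
     ...   | cs₁ , cs₂ , eq | us , vs , refl with moveC (K-mono {Nw = Nw} o) K-sym cs₁ us g eq (K-new {Nw = Nw} o) (K-irrefl {Nw = Nw} w∉)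
     ...     | y , kwy , g′ with K-fresh {Nw = Nw} w∉ (K-sym kwy)
     ...       | c , refl = c , _ , refl , g′ ,
                   map-runs Rs w∉R (λ _ → ⊑±-++ˡ vs ∘ ⊑±-++ˡ us ∘ ⊑±-++ˡ [ w ]) runs ,
                   AllP.++⁺ (AllP.++⁻ˡ cs₁ cuts′) (All.tail (AllP.++⁻ʳ cs₁ cuts′)) ,
                   ≤-<-trans (subst₂ _≤_ (sym (length-++ cs₁)) (sym (trans (cong length eq) (length-++ cs₁))) (+-monoʳ-≤ (length cs₁) (n≤1+n _))) lt
       where cuts′ = subst (All CutIn) eq cuts

     step-big : ∀ {Rs k Q big rest} → Good K₀ x Q → w ∉ concat Rs → cycs Q ≡ big ∷ rest →
       All (_⊑± big) Rs → All CutIn rest → length rest < k → w ∈ big → Moved (Absorbed Rs k) Q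
     step-big {Rs} {k} {Q} g w∉R eq runs cuts lt w∈ with ∈-∃++ w∈
     ... | us , vs , refl with moveC (K-mono {Nw = Nw} o) K-sym [] us g eq (K-new {Nw = Nw} o) (K-irrefl {Nw = Nw} w∉)
     ...   | y , kwy , g′ with K-fresh {Nw = Nw} w∉ (K-sym kwy)
     ...     | c , refl = c , _ , refl , g′ , map-runs Rs w∉R (λ h j → runs-cycle us (path Q) h j) runs , cuts , lt

     step : ∀ {Rs k Q} → Good K₀ x Q → w ∉ concat Rs → Located Rs k Q → Moved (Located Rs k) Q
     step g w∉R (inj₁ a) = let (c , Q′ , e , g′ , l) = step-abs g w∉R a in c , Q′ , e , g′ , inj₁ l
     step {Rs} {k} {Q} g w∉R (inj₂ (big , rest , eq , runs , cuts , lt)) with w ∈? big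
     ... | yes i = let (c , Q′ , e , g′ , l) = step-big g w∉R eq runs cuts lt i in c , Q′ , e , g′ , inj₁ l
     ... | no ∉big with ∈-++⁻ (path Q) (∈-resp-↭ (↭-sym (cover g)) (all-complete w))
     ...   | inj₁ i with find-path g i
     ...     | us , y , vs , eq′ with step-path us g eq′
     ...       | kyw , g′ with K-fresh {Nw = Nw} w∉ kyw
     ...         | c , refl = c , _ , refl , g′ , inj₂ (big , rest , eq , runs , cuts , lt)
     step {Rs} {k} {Q} g w∉R (inj₂ (big , rest , eq , runs , cuts , lt)) | no ∉big | inj₂ i with ∈-concat⁻′ (cycs Q) i
     ... | c , w∈c , c∈ with subst (c ∈_) eq c∈
     ...   | here refl = ⊥-elim (∉big w∈c)
     ...   | there c∈′ with ∈-∃++ c∈′ | ∈-∃++ w∈c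
     ...     | cs₁ , cs₂ , refl | us , vs , refl with moveC (K-mono {Nw = Nw} o) K-sym (big ∷ cs₁) us g eq (K-new {Nw = Nw} o) (K-irrefl {Nw = Nw} w∉)
     ...       | y , kwy , g′ with K-fresh {Nw = Nw} w∉ (K-sym kwy)
     ...         | c , refl = c , _ , refl , g′ , inj₂ (big , cs₁ ++ cs₂ , refl , runs ,
                     AllP.++⁺ (AllP.++⁻ˡ cs₁ cuts) (All.tail (AllP.++⁻ʳ cs₁ cuts)) ,
                     ≤-<-trans (subst₂ _≤_ (sym (length-++ cs₁)) (sym (length-++ cs₁)) (+-monoʳ-≤ (length cs₁) (n≤1+n _))) lt)

     -- The runs lie on the big cycle, so a hit inside a run absorbs that cycle if it was still
     -- waiting. The run that was hit may be broken and is dropped from the list.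
     step-run : ∀ {R Rs k Q} → Good K₀ x Q → w ∈ R → w ∉ concat Rs → Located (R ∷ Rs) k Q → Moved (Absorbed Rs k) Q
     step-run g w∈ w∉R (inj₁ (_ ∷ runs , cuts , lt)) = step-abs g w∉R (runs , cuts , lt)
     step-run g w∈ w∉R (inj₂ (big , rest , eq , r ∷ runs , cuts , lt)) = step-big g w∉R eq runs cuts lt (⊑±-∈ r w∈)

-- Growing a tree of active ends that carry families of paths.

module TreeExploration where

 open ListTools
 open ExposureOracle
 open PathRotation
 open RotationSetting

 ∑-filter-≤ : ∀ {A : Set} {P : A → Set} (P? : ∀ x → Dec (P x)) xs f → ∑ (filter P? xs) f ≤ ∑ xs f
 ∑-filter-≤ P? xs f = ≤-trans (m≤m+n _ _) (≤-reflexive (sym (∑-split xs P? f)))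

 ∑-ind-* : ∀ {A : Set} {P : A → Set} (P? : ∀ x → Dec (P x)) xs f → ∑ xs (λ x → ind (P? x) * f x) ≡ ∑ (filter P? xs) f
 ∑-ind-* P? [] f = refl
 ∑-ind-* P? (x ∷ xs) f with P? x
 ... | yes _ = cong₂ _+_ (*-identityˡ (f x)) (∑-ind-* P? xs f)
 ... | no  _ = ∑-ind-* P? xs f

 unique-map-filter : ∀ {A B : Set} {P : A → Set} (P? : ∀ x → Dec (P x)) (f : A → B) xs →
   Unique (map f xs) → Unique (map f (filter P? xs))
 unique-map-filter P? f [] u = u
 unique-map-filter P? f (x ∷ xs) u with P? x
 ... | no  _ = unique-map-filter P? f xs (unique-tail u)
 ... | yes _ = unique-∷ (λ i → let (y , y∈ , e) = ∈-map⁻ f i in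
                  unique-head u (subst (_∈ map f xs) (sym e) (∈-map⁺ f (proj₁ (∈-filter⁻ P? {xs = xs} y∈)))))
                (unique-map-filter P? f xs (unique-tail u))

 -- A pending half-edge of the tree, still to be grown for depth generations, with the paths that
 -- currently end there.  Its mass is what its subtree will contribute if nothing goes wrong: every
 -- successful exposure doubles the number of (node, path) pairs.
 record Item (X : Set) : Set where
   constructor item
   field
     hed   : X × Bool
     depth : ℕ
     confs : List (Conf X)
 open Item public

 mass depthMass : ∀ {X} → Item X → ℕ
 mass it = length (confs it) * 2 ^ depth it
 depthMass it = depth it * mass it

 module _ (St : Setting) (Ex₀ CutL : List (Setting.X St)) (E₀ : List (Setting.X St × Bool)) where
   open Setting St
   open Phase St Ex₀ CutL E₀

   module SplitConfs {s x d w s′ Nw} (o : Outcome s x d w s′) (x∈ : x ∈ Ex Nw) (w∉ : w ∉ Ex Nw)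
     {P P′ : Conf X → Set} (move : ∀ {Q} → Good (K s Nw) x Q → P Q → Moved {Nw = Nw} o x∈ w∉ P′ Q) where

     record Side (Qs : List (Conf X)) (c : Bool) : Set where
       field
         side   : List (Conf X)
         good   : All (λ Q → Good (K s′ (grow x w Nw)) (ρ c w) Q × P′ Q) side
         unique : Unique (map end side)
         ⊆ends  : ∀ {e} → e ∈ map end side → e ∈ map end Qs
     open Side public

     SplitResult : List (Conf X) → Set
     SplitResult Qs = Σ (∀ c → Side Qs c) λ sd → length (side (sd true)) + length (side (sd false)) ≡ length Qs

     split : ∀ Qs → All (λ Q → Good (K s Nw) x Q × P Q) Qs → Unique (map end Qs) → SplitResult Qs
     split [] [] u = (λ c → record { side = [] ; good = [] ; unique = [] ; ⊆ends = λ () }) , refl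
     split (Q ∷ Qs) ((g , p) ∷ gs) u with split Qs gs (unique-tail u) | move g p
     ... | sd , len | c₀ , Q′ , e , g′ , p′ = sd′ c₀ (g′ , p′) , len′ c₀ (g′ , p′)
       where
       skip : ∀ c → Side (Q ∷ Qs) c
       skip c = record { side = side (sd c) ; good = good (sd c) ; unique = unique (sd c) ; ⊆ends = there ∘ ⊆ends (sd c) }
       add : ∀ c → Good (K s′ (grow x w Nw)) (ρ c w) Q′ × P′ Q′ → Side (Q ∷ Qs) c
       add c gp = record
         { side = Q′ ∷ side (sd c) ; good = gp ∷ good (sd c)
         ; unique = unique-∷ (λ i → unique-head u (subst (_∈ map end Qs) e (⊆ends (sd c) i))) (unique (sd c))
         ; ⊆ends = λ { (here q) → here (trans q e) ; (there i) → there (⊆ends (sd c) i) } }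
       sd′ : ∀ c₀ → Good (K s′ (grow x w Nw)) (ρ c₀ w) Q′ × P′ Q′ → ∀ c → Side (Q ∷ Qs) c
       sd′ true  gp true  = add true gp
       sd′ true  gp false = skip false
       sd′ false gp true  = skip true
       sd′ false gp false = add false gp
       len′ : ∀ c₀ gp → length (side (sd′ c₀ gp true)) + length (side (sd′ c₀ gp false)) ≡ suc (length Qs)
       len′ true  gp = cong suc len
       len′ false gp = trans (+-suc _ _) (cong suc len)

   _≟H_ : (h k : X × Bool) → Dec (h ≡ k)
   _≟H_ = ≡-dec _≟_ Bool._≟_

   module Tree (Rs : List (List X)) (kk : ℕ) (Pd : List (X × Bool)) where

     record ItemOK (s : S) (Nw : List X) (it : Item X) : Set where
       field
         hed∈   : proj₁ (hed it) ∈ Ex Nw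
         hed-fr : Fresh s (proj₁ (hed it)) (proj₂ (hed it))
         hed∉   : hed it ∉ Pd
         good   : All (λ Q → Good (K s Nw) (proj₁ (hed it)) Q × Located Rs kk Q) (confs it)
         ends   : ∀ {e} → e ∈ map end (confs it) → e ∈ E₀
         uends  : Unique (map end (confs it))
     open ItemOK public

     item-next : ∀ {s x d w s′ Nw it} → Outcome s x d w s′ → hed it ≢ (x , d) → hed it ≢ (w , not d) →
       ItemOK s Nw it → ItemOK s′ (grow x w Nw) it
     item-next {Nw = Nw} o ne ne′ ok = record
       { hed∈ = ⊆grow {Nw = Nw} (hed∈ ok) ; hed-fr = transfer-≢ o ne ne′ (hed-fr ok) ; hed∉ = hed∉ ok
       ; good = All.map (λ (g , l) → good-map (K-mono {Nw = Nw} o) g , l) (good ok)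
       ; ends = ends ok ; uends = uends ok }

     record State (s : S) (Nw : List X) (WL lv : List (Item X)) : Set where
       field
         inv   : Inv s Nw Pd
         okW   : All (ItemOK s Nw) WL
         okL   : All (ItemOK s Nw) lv
         uniq  : Unique (map hed (WL ++ lv))
         busy  : All (λ it → 1 ≤ length (confs it)) WL
         flat  : All (λ it → depth it ≡ 0) lv
     open State public

     -- `cost M k` bounds the exposures below an item: one now, then two half-edges on each of the
     -- two sides. `Ct` collects the vertices whose hit ends the argument; by `b≤`, declaring all
     -- mass dead makes the bound trivial there.
     record LoopData : Set where
       field
         cost      : ℕ → ℕ → ℕ
         cost-0    : ∀ k → cost 0 k ≡ 0
         cost-pos  : ∀ M k → 1 ≤ cost (suc M) k
         cost-step : ∀ M₁ M₂ k → 1 ≤ M₁ + M₂ → 1 + (2 * cost M₁ k + 2 * cost M₂ k) ≤ cost (M₁ + M₂) (suc k)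
         Ct        : List X
         nb⊆Ct     : ∀ {w} → w ∈ nb CutL → w ∈ Ct
         Pd⊆Ct     : ∀ {w} → w ∈ map proj₁ Pd → w ∈ Ct
         cap mass₀ b α β β′ β″ : ℕ
         few-bad   : 2 * (β * (3 * (cap + length Ex₀) + length (concat Rs))) ≤ n * β′
         half      : 2 * (cap + length Ex₀) ≤ n
         few-cat   : 2 * (β * (mass₀ * (1 + length Ct))) ≤ n * β″
         b≤        : b ≤ β * mass₀

     module Loop (LD : LoopData) where
       open LoopData LD

       cst : Item X → ℕ
       cst it = cost (length (confs it)) (depth it)

       cost≥1 : ∀ M k → 1 ≤ M → 1 ≤ cost M k
       cost≥1 (suc M) k _ = cost-pos M k

       Bound : S → ℕ → Set
       Bound s q = b * cnt s ≤ q * W s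

       module _ (final : ∀ {s Nw lv dead} → State s Nw [] lv → length Nw + 4 * length lv ≤ cap →
                         ∑ lv mass + dead ≡ mass₀ → Bound s (α + β * dead)) where

         -- dead is the mass lost so far.  An exposure loses the mass of its item with probability
         -- O(|bad| / n), which β′ pays for; it may also hit another pending half-edge, whose mass is
         -- then lost too, or a vertex of Ct, where we give up, and β″ pays for both.
         potential : ℕ → List (Item X) → ℕ
         potential dead WL = α + β * dead + β′ * ∑ WL depthMass + β″ * ∑ WL cst

         -- Induction on the number of exposures still allowed. Waiting, finished and dead mass
         -- always add up to `mass₀`. Four places of `cap` are kept for each future exposure because
         -- `grow` adds four vertices.
         loop : ∀ fuel {s Nw} WL {lv dead} → ∑ WL cst ≤ fuel → State s Nw WL lv →
           length Nw + 4 * (∑ WL cst + length lv) ≤ cap →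
           ∑ WL mass + ∑ lv mass + dead ≡ mass₀ → Bound s (potential dead WL)
         loop fuel {s} [] {lv} {dead} le st small total =
           ≤-trans (final st small total) (*-monoˡ-≤ (W s) (≤-trans (m≤m+n (α + β * dead) _) (m≤m+n (α + β * dead + β′ * 0) _)))
         loop zero (it ∷ WL) le st small total =
           ⊥-elim (1+n≰n (≤-trans (≤-trans (cost≥1 (length (confs it)) (depth it) (All.head (busy st))) (m≤m+n _ _)) le))
         loop (suc fuel) {s} {Nw} (item h zero Qs ∷ WL) {lv} {dead} le st small total =
           ≤-trans (loop fuel WL {it ∷ lv} (s≤s⁻¹ (≤-trans (+-monoˡ-≤ _ c≥1) le)) st′ small′ total′) (*-monoˡ-≤ (W s) lower)
           where
           it = item h zero Qs
           c≥1 : 1 ≤ cst it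
           c≥1 = cost≥1 (length Qs) 0 (All.head (busy st))
           st′ : State s Nw WL (it ∷ lv)
           st′ = record { inv = inv st ; okW = All.tail (okW st) ; okL = All.head (okW st) ∷ okL st
             ; uniq = unique-↭ (Perm.map⁺ hed (↭-sym (Perm.shift it WL lv))) (uniq st)
             ; busy = All.tail (busy st) ; flat = refl ∷ flat st }
           small′ : length Nw + 4 * (∑ WL cst + suc (length lv)) ≤ cap
           small′ = ≤-trans (+-monoʳ-≤ (length Nw) (*-monoʳ-≤ 4 (≤-trans (≤-reflexive (+-suc (∑ WL cst) (length lv)))
             (+-monoˡ-≤ (length lv) (+-monoˡ-≤ (∑ WL cst) c≥1))))) small
           total′ : ∑ WL mass + (mass it + ∑ lv mass) + dead ≡ mass₀
           total′ = trans (eqn (∑ WL mass) (mass it) (∑ lv mass) dead) total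
             where
             eqn : ∀ a m l d → a + (m + l) + d ≡ m + a + l + d
             eqn = solve-∀
           lower : potential dead WL ≤ potential dead (it ∷ WL)
           lower = +-mono-≤ (+-monoʳ-≤ (α + β * dead) (*-monoʳ-≤ β′ (m≤n+m (∑ WL depthMass) (depthMass it)))) (*-monoʳ-≤ β″ (m≤n+m (∑ WL cst) (cst it)))
         loop (suc fuel) {s} {Nw} (item (x , d) (suc k) Qs ∷ WL) {lv} {dead} le st small total =
           average fr {b} p each sum-le
           where
           it = item (x , d) (suc k) Qs
           ok = All.head (okW st)
           fr = hed-fr ok
           x∈ = hed∈ ok
           μ = mass it
           rest = WL ++ lv
           Qs>0 : 1 ≤ length Qs
           Qs>0 = All.head (busy st)
           open Query (query s x d fr) using (outs; unique)
           c≥1 : 1 ≤ cst it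
           c≥1 = cost≥1 (length Qs) (suc k) Qs>0
           c₀ = cst it ∸ 1
           c₀-eq : suc c₀ ≡ cst it
           c₀-eq = m+[n∸m]≡n c≥1
           stale : ∀ w it′ → Dec (hed it′ ≡ (w , not d))
           stale w it′ = hed it′ ≟H (w , not d)
           massAt : X → ℕ
           massAt w = ∑ rest (λ it′ → ind (stale w it′) * mass it′)
           bad : List X
           bad = nb (Ex Nw) ++ concat Rs
           base : ℕ
           base = α + β * dead + β′ * (k * μ + ∑ WL depthMass) + β″ * (c₀ + ∑ WL cst)
           -- The charge for outcome `w`: the item's own mass if `w` is bad, the mass of the pending
           -- half-edge that it hits, if any, and everything if `w` is in `Ct`.
           p : X → ℕ
           p w = base + β * (ind (w ∈? bad) * μ) + β * massAt w + ind (w ∈? Ct) * (β * mass₀)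
           total-rest : μ + ∑ rest mass + dead ≡ mass₀
           total-rest = trans (cong (_+ dead) (trans (cong (μ +_) (∑-++ WL lv mass)) (sym (+-assoc μ (∑ WL mass) (∑ lv mass))))) total

           Nw≤cap : length Nw ≤ cap
           Nw≤cap = ≤-trans (m≤m+n (length Nw) _) small
           ex≤ : length (Ex Nw) ≤ cap + length Ex₀
           ex≤ = ≤-trans (≤-reflexive (length-++ Nw)) (+-monoˡ-≤ (length Ex₀) Nw≤cap)
           bad≤ : length bad ≤ 3 * (cap + length Ex₀) + length (concat Rs)
           bad≤ = ≤-trans (≤-reflexive (trans (length-++ (nb (Ex Nw))) (cong (_+ length (concat Rs)) (length-nb (Ex Nw)))))
             (+-monoˡ-≤ _ (*-monoʳ-≤ 3 ex≤))
           r = length outs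
           n≤2r : n ≤ 2 * r
           n≤2r = +-cancelʳ-≤ n n (2 * r) (≤-trans (+-mono-≤ (n≤outs fr (fresh (inv st))) (n≤outs fr (fresh (inv st))))
             (≤-trans (≤-reflexive (eqn r (length (Ex Nw)))) (+-monoʳ-≤ (2 * r) (≤-trans (*-monoʳ-≤ 2 ex≤) half))))
             where
             eqn : ∀ r e → r + e + (r + e) ≡ 2 * r + 2 * e
             eqn = solve-∀
           halve : ∀ {a c} → 2 * a ≤ n * c → a ≤ r * c
           halve {a} {c} h = *-cancelˡ-≤ 2 (≤-trans h (≤-trans (*-monoˡ-≤ c n≤2r) (≤-reflexive (*-assoc 2 r c))))

           -- A pending half-edge is hit by one outcome at most, so over all outcomes each mass is
           -- charged at most once.
           massAt-sum : ∑ outs massAt ≤ ∑ rest mass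
           massAt-sum = begin
             ∑ outs massAt                                                       ≡⟨ ∑-swap outs rest _ ⟩
             ∑ rest (λ it′ → ∑ outs (λ w → ind (stale w it′) * mass it′))        ≤⟨ ∑-mono rest (λ {it′} _ → single it′) ⟩
             ∑ rest mass                                                         ∎
             where
             open ≤-Reasoning
             single : ∀ it′ → ∑ outs (λ w → ind (stale w it′) * mass it′) ≤ mass it′
             single it′ = begin
               ∑ outs (λ w → ind (stale w it′) * mass it′)   ≡⟨ ∑-*ʳ outs (mass it′) _ ⟩
               ∑ outs (λ w → ind (stale w it′)) * mass it′   ≤⟨ *-monoˡ-≤ (mass it′) (∑-ind≤ (λ w → stale w it′) {[ proj₁ (hed it′) ]} unique
                                                                 (λ _ e → here (sym (,-injectiveˡ e)))) ⟩
               1 * mass it′                                  ≡⟨ *-identityˡ _ ⟩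
               mass it′ ∎

           sum-le : ∑ outs p ≤ r * potential dead (it ∷ WL)
           sum-le = begin
             ∑ outs p
               ≡⟨ trans (∑-+ outs _ _) (cong (_+ ∑ outs (λ w → ind (w ∈? Ct) * (β * mass₀))) (trans (∑-+ outs _ _) (cong (_+ ∑ outs (λ w → β * massAt w)) (∑-+ outs _ _)))) ⟩
             ∑ outs (λ _ → base) + ∑ outs (λ w → β * (ind (w ∈? bad) * μ)) + ∑ outs (λ w → β * massAt w) + ∑ outs (λ w → ind (w ∈? Ct) * (β * mass₀))
               ≤⟨ +-mono-≤ (+-mono-≤ (+-mono-≤ (≤-reflexive (∑-const outs base)) bad-le) at-le) ct-le ⟩
             r * base + β * (B * μ) + β * mass₀ + length Ct * (β * mass₀)
               ≡⟨ e₁ (r * base) β B μ mass₀ (length Ct) ⟩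
             r * base + (β * B) * μ + β * (mass₀ * (1 + length Ct))
               ≤⟨ +-mono-≤ (+-monoʳ-≤ (r * base) (*-monoˡ-≤ μ (halve {β * B} few-bad))) (halve {β * (mass₀ * (1 + length Ct))} few-cat) ⟩
             r * base + r * β′ * μ + r * β″
               ≡⟨ e₂ r base β′ μ β″ ⟩
             r * (base + β′ * μ + β″)
               ≡⟨ cong (r *_) (trans (e₃ (α + β * dead) β′ k μ (∑ WL depthMass) β″ c₀ (∑ WL cst)) (cong (λ c → α + β * dead + β′ * (depthMass it + ∑ WL depthMass) + β″ * (c + ∑ WL cst)) c₀-eq)) ⟩
             r * potential dead (it ∷ WL) ∎
             where
             open ≤-Reasoning
             B = 3 * (cap + length Ex₀) + length (concat Rs)
             bad-le : ∑ outs (λ w → β * (ind (w ∈? bad) * μ)) ≤ β * (B * μ)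
             bad-le = ≤-trans (≤-reflexive (trans (∑-*ˡ outs β _) (cong (β *_) (∑-*ʳ outs μ _))))
               (*-monoʳ-≤ β (*-monoˡ-≤ μ (≤-trans (∑-ind≤ (_∈? bad) unique (λ _ i → i)) bad≤)))
             at-le : ∑ outs (λ w → β * massAt w) ≤ β * mass₀
             at-le = ≤-trans (≤-reflexive (∑-*ˡ outs β massAt)) (*-monoʳ-≤ β (≤-trans massAt-sum
               (≤-trans (≤-trans (m≤n+m (∑ rest mass) μ) (m≤m+n _ dead)) (≤-reflexive total-rest))))
             ct-le : ∑ outs (λ w → ind (w ∈? Ct) * (β * mass₀)) ≤ length Ct * (β * mass₀)
             ct-le = ≤-trans (≤-reflexive (∑-*ʳ outs (β * mass₀) _)) (*-monoˡ-≤ (β * mass₀) (∑-ind≤ (_∈? Ct) unique (λ _ i → i)))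
             e₁ : ∀ t β B μ M c → t + β * (B * μ) + β * M + c * (β * M) ≡ t + (β * B) * μ + β * (M * (1 + c))
             e₁ = solve-∀
             e₂ : ∀ r t β μ γ → r * t + r * β * μ + r * γ ≡ r * (t + β * μ + γ)
             e₂ = solve-∀
             e₃ : ∀ t β k μ D γ c C → t + β * (k * μ + D) + γ * (c + C) + β * μ + γ ≡ t + β * (suc k * μ + D) + γ * (suc c + C)
             e₃ = solve-∀

           hed≢ : ∀ {it′} → it′ ∈ rest → hed it′ ≢ (x , d)
           hed≢ i e = unique-head (uniq st) (subst (_∈ map hed rest) e (∈-map⁺ hed i))

           rest-ok : All (ItemOK s Nw) rest
           rest-ok = AllP.++⁺ (All.tail (okW st)) (okL st)

           ok-cost : length Nw + 4 + 4 * (c₀ + ∑ WL cst + length lv) ≤ cap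
           ok-cost = ≤-trans (≤-reflexive (trans (e (length Nw) c₀ (∑ WL cst) (length lv)) (cong (λ c → length Nw + 4 * (c + ∑ WL cst + length lv)) c₀-eq))) small
             where
             e : ∀ N c C l → N + 4 + 4 * (c + C + l) ≡ N + 4 * (suc c + C + l)
             e = solve-∀

           each : ∀ {w s′} → Outcome s x d w s′ → b * cnt s′ ≤ p w * W s′
           each {w} {s′} o with w ∈? Ct
           ... | yes _ = ≤-trans (*-mono-≤ b≤ (cnt≤W s′)) (*-monoˡ-≤ (W s′) (≤-trans (≤-reflexive (sym (*-identityˡ (β * mass₀)))) (m≤n+m (1 * (β * mass₀)) (base + β * (ind (w ∈? bad) * μ) + β * massAt w))))
           ... | no w∉Ct with w ∈? bad
           -- A bad hit: the item is given up without children, together with a pending half-edge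
           -- that was just used.
           ...   | yes _ = ≤-trans (loop fuel WL′ {lv′} {dead + μ + massAt w}
                             (≤-trans C≤ (s≤s⁻¹ (≤-trans (+-monoˡ-≤ _ c≥1) le))) st′ small′ total′) (*-monoˡ-≤ (W s′) pot≤)
             where
             keep : ∀ it′ → Dec (¬ hed it′ ≡ (w , not d))
             keep it′ = ¬? (stale w it′)
             WL′ = filter keep WL
             lv′ = filter keep lv
             C≤ : ∑ WL′ cst ≤ ∑ WL cst
             C≤ = ∑-filter-≤ keep WL cst
             lift : ∀ {its} → (∀ {i} → i ∈ its → i ∈ rest) → All (ItemOK s Nw) its → All (ItemOK s′ (grow x w Nw)) (filter keep its)
             lift {its} sub oks = All.tabulate (λ i∈ → let (j , k) = ∈-filter⁻ keep {xs = its} i∈ in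
               item-next o (hed≢ (sub j)) k (All.lookup oks j))
             st′ : State s′ (grow x w Nw) WL′ lv′
             st′ = record
               { inv = inv-next (inv st) x∈ (hed∉ ok) o (w∉Ct ∘ nb⊆Ct) (w∉Ct ∘ Pd⊆Ct)
               ; okW = lift ∈-++⁺ˡ (All.tail (okW st)) ; okL = lift (∈-++⁺ʳ WL) (okL st)
               ; uniq = subst (Unique ∘ map hed) (filter-++ keep WL lv) (unique-map-filter keep hed rest (unique-tail (uniq st)))
               ; busy = AllP.filter⁺ keep (All.tail (busy st)) ; flat = AllP.filter⁺ keep (flat st) }
             small′ : 4 + length Nw + 4 * (∑ WL′ cst + length lv′) ≤ cap
             small′ = ≤-trans (+-mono-≤ (≤-reflexive (+-comm 4 (length Nw))) (*-monoʳ-≤ 4 (+-mono-≤ (≤-trans C≤ (m≤n+m _ c₀)) (length-filter keep lv)))) ok-cost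
             total′ : ∑ WL′ mass + ∑ lv′ mass + (dead + μ + massAt w) ≡ mass₀
             total′ = trans (cong₂ _+_ (trans (sym (∑-++ WL′ lv′ mass)) (cong (λ z → ∑ z mass) (sym (filter-++ keep WL lv))))
                 (cong (dead + μ +_) (∑-ind-* (stale w) rest mass)))
               (trans (e (∑ (filter keep rest) mass) dead μ (∑ (filter (stale w) rest) mass)) (trans (cong (λ z → μ + z + dead) (sym (∑-split rest (stale w) mass))) total-rest))
               where
               e : ∀ a d μ c → a + (d + μ + c) ≡ μ + (c + a) + d
               e = solve-∀
             pot≤ : potential (dead + μ + massAt w) WL′ ≤ base + β * (1 * μ) + β * massAt w + 0
             pot≤ = begin
               α + β * (dead + μ + massAt w) + β′ * ∑ WL′ depthMass + β″ * ∑ WL′ cst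
                 ≤⟨ +-mono-≤ (+-monoʳ-≤ (α + β * (dead + μ + massAt w)) (*-monoʳ-≤ β′ (≤-trans (∑-filter-≤ keep WL depthMass) (m≤n+m _ (k * μ))))) (*-monoʳ-≤ β″ (≤-trans C≤ (m≤n+m _ c₀))) ⟩
               α + β * (dead + μ + massAt w) + β′ * (k * μ + ∑ WL depthMass) + β″ * (c₀ + ∑ WL cst)
                 ≡⟨ e α β dead μ (massAt w) (β′ * (k * μ + ∑ WL depthMass)) (β″ * (c₀ + ∑ WL cst)) ⟩
               base + β * (1 * μ) + β * massAt w + 0 ∎
               where
               open ≤-Reasoning
               e : ∀ α β d μ a P C → α + β * (d + μ + a) + P + C ≡ α + β * d + P + C + β * (1 * μ) + β * a + 0
               e = solve-∀
           -- A good hit: `w` is untouched whereas pending half-edges sit at touched vertices, so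
           -- none of them is used up and no mass dies.
           ...   | no w∉bad = ≤-trans (loop fuel WL′ {lv} {dead}
                             (≤-trans C≤ (s≤s⁻¹ (≤-trans (≤-reflexive (cong (_+ ∑ WL cst) c₀-eq)) le))) st′ small′ total′) (*-monoˡ-≤ (W s′) pot≤)
             where
             w∉nb : w ∉ nb (Ex Nw)
             w∉nb = w∉bad ∘ ∈-++⁺ˡ
             w∉ : w ∉ Ex Nw
             w∉ = ∉-nb w∉nb
             ρw∉ : ∀ c → ρ c w ∉ Ex Nw
             ρw∉ c = w∉nb ∘ ∈-nb c
             open SplitConfs {Nw = Nw} o x∈ w∉ {Located Rs kk} {Located Rs kk}
               (λ g l → step {Nw = Nw} o x∈ w∉ g (w∉bad ∘ ∈-++⁺ʳ (nb (Ex Nw))) l)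
               using (side; split; ⊆ends) renaming (good to side-good; unique to side-unique; Side to SideOf)
             sp = split Qs (good ok) (uends ok)
             sd = proj₁ sp
             M : Bool → ℕ
             M c = length (side (sd c))
             M-eq : M true + M false ≡ length Qs
             M-eq = proj₂ sp
             -- An empty side gets no items, so that `busy` persists; a nonempty one gets both
             -- half-edges, which compensates the generation used up.
             push : Bool → List (Item X)
             push c with side (sd c)
             ... | [] = []
             ... | Qs′@(_ ∷ _) = item (ρ c w , true) k Qs′ ∷ item (ρ c w , false) k Qs′ ∷ []
             WL′ = push true ++ push false ++ WL
             new-hed : ∀ c {it′} → it′ ∈ push c → ∃ λ e → it′ ≡ item (ρ c w , e) k (side (sd c))
             new-hed c i with side (sd c)
             new-hed c (here refl)         | _ ∷ _ = true , refl
             new-hed c (there (here refl)) | _ ∷ _ = false , refl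
             push-∑ : ∀ c (f : Item X → ℕ) (g : ℕ → ℕ) → g 0 ≡ 0 → (∀ e Qs′ → f (item (ρ c w , e) k Qs′) ≡ g (length Qs′)) →
               ∑ (push c) f ≡ 2 * g (M c)
             push-∑ c f g g0 h with side (sd c)
             ... | [] = sym (cong (2 *_) g0)
             ... | Qs′@(_ ∷ _) = cong₂ (λ a b → a + (b + 0)) (h true Qs′) (h false Qs′)
             all-∑ : (f : Item X → ℕ) (g : ℕ → ℕ) → g 0 ≡ 0 → (∀ c e Qs′ → f (item (ρ c w , e) k Qs′) ≡ g (length Qs′)) →
               ∑ WL′ f ≡ 2 * g (M true) + 2 * g (M false) + ∑ WL f
             all-∑ f g g0 h = trans (∑-++ (push true) _ f) (trans (cong₂ _+_ (push-∑ true f g g0 (h true))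
               (trans (∑-++ (push false) WL f) (cong (_+ ∑ WL f) (push-∑ false f g g0 (h false))))) (sym (+-assoc (2 * g (M true)) _ _)))
             C≤ : ∑ WL′ cst ≤ c₀ + ∑ WL cst
             C≤ = ≤-trans (≤-reflexive (all-∑ cst (λ M → cost M k) (cost-0 k) (λ _ _ _ → refl)))
               (+-monoˡ-≤ (∑ WL cst) (s≤s⁻¹ (≤-trans (cost-step (M true) (M false) k (subst (1 ≤_) (sym M-eq) Qs>0))
                 (≤-reflexive (trans (cong (λ z → cost z (suc k)) M-eq) (sym c₀-eq))))))
             mass-eq : ∑ WL′ mass ≡ μ + ∑ WL mass
             mass-eq = trans (all-∑ mass (λ M → M * 2 ^ k) refl (λ _ _ _ → refl)) (cong (_+ ∑ WL mass)
               (trans (e (M true) (M false) (2 ^ k)) (cong (_* (2 * 2 ^ k)) M-eq)))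
               where
               e : ∀ a b t → 2 * (a * t) + 2 * (b * t) ≡ (a + b) * (2 * t)
               e = solve-∀
             dm-eq : ∑ WL′ depthMass ≡ k * μ + ∑ WL depthMass
             dm-eq = trans (all-∑ depthMass (λ M → k * (M * 2 ^ k)) (*-zeroʳ k) (λ _ _ _ → refl)) (cong (_+ ∑ WL depthMass)
               (trans (e k (M true) (M false) (2 ^ k)) (cong (λ z → k * (z * (2 * 2 ^ k))) M-eq)))
               where
               e : ∀ k a b t → 2 * (k * (a * t)) + 2 * (k * (b * t)) ≡ k * ((a + b) * (2 * t))
               e = solve-∀
             push-ok : ∀ c → All (ItemOK s′ (grow x w Nw)) (push c)
             push-ok c = All.tabulate λ i → let (e , eq) = new-hed c i in subst (ItemOK s′ (grow x w Nw)) (sym eq) (record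
               { hed∈ = ∈-++⁺ˡ (ρ∈grow c {x} {w} {Nw})
               ; hed-fr = transfer-≢ o (λ { q → ρw∉ c (subst (_∈ Ex Nw) (sym (,-injectiveˡ q)) x∈) }) (λ q → ρ-≢ c w (,-injectiveˡ q)) (fresh (inv st) (ρ c w) (ρw∉ c) e)
               ; hed∉ = λ q → ρw∉ c (proj₁ (prot (inv st) q))
               ; good = side-good (sd c)
               ; ends = λ q → ends ok (⊆ends (sd c) q)
               ; uends = side-unique (sd c) })
             push-unique : ∀ c → Unique (map hed (push c))
             push-unique c with side (sd c)
             ... | [] = []
             ... | _ ∷ _ = unique-∷ (λ { (here ()) }) (unique-∷ (λ ()) [])
             hed-push : ∀ c {h} → h ∈ map hed (push c) → proj₁ h ≡ ρ c w
             hed-push c i with ∈-map⁻ hed i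
             ... | it′ , i′ , refl = cong (proj₁ ∘ hed) (proj₂ (new-hed c i′))
             old-hed : ∀ {h} → h ∈ map hed rest → proj₁ h ∈ Ex Nw
             old-hed i with ∈-map⁻ hed i
             ... | it′ , i′ , refl = hed∈ (All.lookup rest-ok i′)
             old-ok : ∀ {its} → (∀ {i} → i ∈ its → i ∈ rest) → All (ItemOK s Nw) its → All (ItemOK s′ (grow x w Nw)) its
             old-ok sub oks = All.tabulate (λ i → item-next o (hed≢ (sub i)) (λ e → w∉ (subst (_∈ Ex Nw) (cong proj₁ e) (hed∈ (All.lookup oks i)))) (All.lookup oks i))
             uniq′ : Unique (map hed (WL′ ++ lv))
             uniq′ = subst Unique (sym eq) (unique-++⁺ (push-unique true) (unique-++⁺ (push-unique false) (unique-tail (uniq st))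
                 (λ i j → ρw∉ false (subst (_∈ Ex Nw) (hed-push false i) (old-hed j))))
                 (λ i j → case (∈-++⁻ (map hed (push false)) j) (hed-push true i)))
               where
               eq : map hed (WL′ ++ lv) ≡ map hed (push true) ++ map hed (push false) ++ map hed rest
               eq = trans (cong (map hed) (trans (Data.List.Properties.++-assoc (push true) _ lv) (cong (push true ++_) (Data.List.Properties.++-assoc (push false) WL lv))))
                 (trans (map-++ hed (push true) _) (cong (map hed (push true) ++_) (map-++ hed (push false) rest)))
               case : ∀ {h} → h ∈ map hed (push false) ⊎ h ∈ map hed rest → proj₁ h ≡ ρ true w → ⊥
               case (inj₁ j) e = ρ-≢² w (trans (sym e) (hed-push false j))
               case (inj₂ j) e = ρw∉ true (subst (_∈ Ex Nw) e (old-hed j))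
             push-busy : ∀ c → All (λ it′ → 1 ≤ length (confs it′)) (push c)
             push-busy c with side (sd c)
             ... | [] = []
             ... | _ ∷ _ = s≤s z≤n ∷ s≤s z≤n ∷ []
             st′ : State s′ (grow x w Nw) WL′ lv
             st′ = record
               { inv = inv-next (inv st) x∈ (hed∉ ok) o (w∉Ct ∘ nb⊆Ct) (w∉Ct ∘ Pd⊆Ct)
               ; okW = AllP.++⁺ (push-ok true) (AllP.++⁺ (push-ok false) (old-ok ∈-++⁺ˡ (All.tail (okW st))))
               ; okL = old-ok (∈-++⁺ʳ WL) (okL st)
               ; uniq = uniq′
               ; busy = AllP.++⁺ (push-busy true) (AllP.++⁺ (push-busy false) (All.tail (busy st)))
               ; flat = flat st }
             small′ : 4 + length Nw + 4 * (∑ WL′ cst + length lv) ≤ cap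
             small′ = ≤-trans (+-mono-≤ (≤-reflexive (+-comm 4 (length Nw))) (*-monoʳ-≤ 4 (+-monoˡ-≤ (length lv) C≤))) ok-cost
             total′ : ∑ WL′ mass + ∑ lv mass + dead ≡ mass₀
             total′ = trans (cong (λ z → z + ∑ lv mass + dead) mass-eq) total
             pot≤ : potential dead WL′ ≤ base + β * 0 + β * massAt w + 0
             pot≤ = ≤-trans (+-mono-≤ (≤-reflexive (cong (λ z → α + β * dead + β′ * z) dm-eq)) (*-monoʳ-≤ β″ C≤))
               (≤-trans (m≤m+n base (β * 0 + β * massAt w + 0)) (≤-reflexive (e base (β * 0) (β * massAt w))))
               where
               e : ∀ a b c → a + (b + c + 0) ≡ a + b + c + 0
               e = solve-∀

-- One closing trial per leaf, and the failure bound for all of them.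

module ClosingTrials where

 open ListTools
 open ExposureOracle
 open PathRotation
 open RotationSetting
 open TreeExploration

 iter : {A : Set} → (A → A) → ℕ → A → A
 iter f zero    x = x
 iter f (suc i) x = iter f i (f x)

 module _ (St : Setting) where
   open Setting St

   -- `ρ η b` is the vertex before `b`. All paths traversing an intact run in this direction get the
   -- same new active end when `b` is hit.
   RunOf : Bool → List X → Set
   RunOf η = Chain (λ a b → a ≡ ρ η b)

   run-reverse : ∀ {η} l → RunOf η l → RunOf (not η) (reverse l)
   run-reverse {η} l = chain-reverse (λ { {x} {y} refl → sym (ρ-inv η y) }) l

   module Blocks (_≟F_ : (f g : F) → Dec (f ≡ g)) (h : ℕ)
     (orbit : ∀ d f g → ∃ λ i → i < h × iter (go₁ d) (suc i) f ≡ g) where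

     run-elem : ∀ {η} i r l → i < length l → RunOf η (r ∷ l) →
       ∃ λ as → ∃ λ w → ∃ λ bs → l ≡ as ++ w ∷ bs × length as ≡ i × fib w ≡ iter (go₁ (not η)) (suc i) (fib r) × RunOf η (w ∷ bs)
     run-elem {η} i r [] () c
     run-elem {η} zero r (w ∷ l) lt (e , c) = [] , w , l , refl , refl , fw , c
       where
       fw : fib w ≡ go₁ (not η) (fib r)
       fw = trans (cong fib (trans (sym (ρ-inv η w)) (cong (ρ (not η)) (sym e)))) (fib-ρ (not η) r)
     run-elem {η} (suc i) r (w ∷ l) (s≤s lt) (e , c) with run-elem i w l lt c
     ... | as , w′ , bs , eq , len , fw′ , c′ = w ∷ as , w′ , bs , cong (w ∷_) eq , cong suc len ,
       trans fw′ (cong (iter (go₁ (not η)) (suc i)) (trans (cong fib (trans (sym (ρ-inv η w)) (cong (ρ (not η)) (sym e)))) (fib-ρ (not η) r))) , c′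

     inFib : F → List X → List X
     inFib f = filter (λ w → fib w ≟F f)

     -- The fibres along a run follow the first Hamilton cycle, so any `h` consecutive vertices
     -- visit fibre `f`, and `L` such windows fit.
     block-count : ∀ L {η} r l f → RunOf η (r ∷ l) → L * h ≤ length l → L ≤ length (inFib f l)
     block-count zero r l f c le = z≤n
     block-count (suc L) {η} r l f c le with orbit (not η) (fib r) f
     ... | i , i<h , e with run-elem i r l (<-≤-trans i<h (≤-trans (m≤m+n h (L * h)) le)) c
     ...   | as , w , bs , refl , refl , fw , c′ = begin
       suc L                                                      ≤⟨ s≤s (block-count L w bs f c′ rest) ⟩
       suc (length (inFib f bs))                                  ≡⟨ cong length (sym hit) ⟩
       length (inFib f (w ∷ bs))                                  ≤⟨ m≤n+m _ (length (inFib f as)) ⟩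
       length (inFib f as) + length (inFib f (w ∷ bs))            ≡⟨ sym (length-++ (inFib f as)) ⟩
       length (inFib f as ++ inFib f (w ∷ bs))                    ≡⟨ cong length (sym (filter-++ _ as (w ∷ bs))) ⟩
       length (inFib f (as ++ w ∷ bs))                            ∎
       where
       open ≤-Reasoning
       rest : L * h ≤ length bs
       rest = +-cancelˡ-≤ h _ _ (≤-trans le (≤-trans (≤-reflexive (trans (length-++ as) (+-suc (length as) (length bs)))) (+-monoˡ-≤ (length bs) i<h)))
       hit : inFib f (w ∷ bs) ≡ w ∷ inFib f bs
       hit = Data.List.Properties.filter-accept (λ w → fib w ≟F f) (trans fw e)

   -- The fibres visited when the active end is moved along a run with predecessor map ρ η.
   walk : Bool → F → List Bool → F
   walk η f []       = f
   walk η f (d ∷ ds) = walk η (go₁ η (go d f)) ds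

   module _ (Ex₀ CutL : List X) (E₀ : List (X × Bool)) (Rs : List (List X)) (kk : ℕ) where
     open Phase St Ex₀ CutL E₀
     open Tree St Ex₀ CutL E₀

     -- A block of `L * h` vertices meets each fibre `L` times, and `Lh` of these stay usable;
     -- `n≤GL` gives a hit among them probability at least `1 / G`. `capE` bounds the stored ends
     -- that become unusable, and `closing` is the induction hypothesis for the remaining merges.
     record TrialData : Set where
       field
         _≟F_  : (f g : F) → Dec (f ≡ g)
         h     : ℕ
         orbit : ∀ d f g → ∃ λ i → i < h × iter (go₁ d) (suc i) f ≡ g
         kmax  : ℕ
         reach : ∀ η f g → ∃ λ word → length word ≤ kmax × walk η f word ≡ g
         R₀ Rm : List X
         runs-unique : Unique (R₀ ++ Rm ++ concat Rs)
         R₀-run : RunOf false R₀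
         Rm-run : RunOf false Rm
         L Lh G capT capE D p : ℕ
         capE-ok : capT + 3 * length CutL ≤ capE
         R₀-len : 1 + L * h ≤ length R₀
         Rm-len : kmax * (1 + L * h) ≤ length Rm
         L-big : Lh + 3 * (capT + length Ex₀ + length CutL) ≤ L
         n≤GL : n ≤ G * Lh
         1≤G : 1 ≤ G
         half : 2 * (capT + length Ex₀) ≤ n
         dA : Bool
         u : F
         E₀-class : ∀ {e} → e ∈ E₀ → proj₂ e ≡ dA × fib (proj₁ e) ≡ u × proj₁ e ∈ Ex₀
         closing : ∀ {s Nw big cs} → Inv s Nw [] → length Nw ≤ capT → Closed (K s Nw) big → All (Closed (K s Nw)) cs →
           big ++ concat cs ↭ allX → All (_⊑± big) Rs → All CutIn cs → length cs < kk → D * cnt s ≤ p * W s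

     module Trials (TD : TrialData) where
       open TrialData TD

       open Blocks _≟F_ h orbit

       runs : List (List X)
       runs = R₀ ∷ Rm ∷ Rs

       LeafOK : S → List X → Item X → Set
       LeafOK = ItemOK runs kk []

       Tst : S → List X → List (Item X) → Set
       Tst s Nw lv = Inv s Nw [] × All (LeafOK s Nw) lv

       -- A hit here could spoil a reserved vertex or a leaf still to be tried; these are the
       -- catastrophes of `gap-query` during the trials.
       pend : List (Item X) → List X
       pend lv = nb CutL ++ map (proj₁ ∘ hed) lv

       tst-next : ∀ {s x d w s′ Nw lv} → Tst s Nw lv → x ∈ Ex Nw → (∀ {it} → it ∈ lv → hed it ≢ (x , d)) →
         Outcome s x d w s′ → w ∉ pend lv → Tst s′ (grow x w Nw) lv
       tst-next {w = w} {Nw = Nw} {lv} (inv , oks) x∈ ne o w∉ =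
         inv-next inv x∈ (λ ()) o (w∉ ∘ ∈-++⁺ˡ) (λ ()) ,
         All.tabulate (λ i → item-next runs kk [] o (ne i) (λ e → w∉ (∈-++⁺ʳ (nb CutL) (subst (_∈ map (proj₁ ∘ hed) lv) (cong proj₁ e) (∈-map⁺ (proj₁ ∘ hed) i)))) (All.lookup oks i))

       pend-∉ : ∀ {s Nw lv w} → Tst s Nw lv → w ∉ nb CutL → w ∉ Ex Nw → w ∉ pend lv
       pend-∉ {Nw = Nw} (inv , oks) w∉C w∉E i with ∈-++⁻ (nb CutL) i
       ... | inj₁ j = w∉C j
       ... | inj₂ j with ∈-map⁻ (proj₁ ∘ hed) j
       ...   | it , it∈ , e = w∉E (subst (_∈ Ex Nw) (sym e) (hed∈ (All.lookup oks it∈)))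

       avoid : List X → List X
       avoid Nw = nb (Ex Nw) ++ nb CutL

       targets : List X → F → List X → List X
       targets Nw f l = filter (λ w → ¬? (w ∈? avoid Nw)) (inFib f l)

       targets-∈ : ∀ {Nw f l w} → w ∈ targets Nw f l → w ∈ l × fib w ≡ f × w ∉ nb (Ex Nw) × w ∉ nb CutL
       targets-∈ {Nw} {f} {l} i =
         let (j , a) = ∈-filter⁻ (λ w → ¬? (w ∈? avoid Nw)) {xs = inFib f l} i
             (k , e) = ∈-filter⁻ (λ w → fib w ≟F f) {xs = l} j
         in k , e , a ∘ ∈-++⁺ˡ , a ∘ ∈-++⁺ʳ (nb (Ex Nw))

       targets-unique : ∀ {Nw f l} → Unique l → Unique (targets Nw f l)
       targets-unique uq = Uniq.filter⁺ _ (Uniq.filter⁺ _ uq)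

       targets-many : ∀ {η Nw r l} f → RunOf η (r ∷ l) → Unique l → L * h ≤ length l → length Nw ≤ capT →
         Lh ≤ length (targets Nw f l)
       targets-many {η} {Nw} {r} {l} f c uq le small = +-cancelʳ-≤ av Lh _ (begin
         Lh + av                              ≤⟨ +-monoʳ-≤ Lh av≤ ⟩
         Lh + 3 * (capT + length Ex₀ + length CutL) ≤⟨ L-big ⟩
         L                                    ≤⟨ block-count L r l f c le ⟩
         length (inFib f l)                   ≤⟨ length-filter-∖ (λ w → fib w ≟F f) (λ w → ¬? (w ∈? avoid Nw)) uq (λ {w} _ _ nn → decidable-stable (w ∈? avoid Nw) nn) ⟩
         length (targets Nw f l) + av         ∎)
         where
         open ≤-Reasoning
         av = length (avoid Nw)
         av≤ : av ≤ 3 * (capT + length Ex₀ + length CutL)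
         av≤ = begin
           av                                            ≡⟨ trans (length-++ (nb (Ex Nw))) (cong₂ _+_ (length-nb (Ex Nw)) (length-nb CutL)) ⟩
           3 * length (Ex Nw) + 3 * length CutL          ≡⟨ sym (*-distribˡ-+ 3 (length (Ex Nw)) (length CutL)) ⟩
           3 * (length (Ex Nw) + length CutL)            ≤⟨ *-monoʳ-≤ 3 (+-monoˡ-≤ (length CutL) (≤-trans (≤-reflexive (length-++ Nw)) (+-monoˡ-≤ (length Ex₀) small))) ⟩
           3 * (capT + length Ex₀ + length CutL)         ∎

       gain : ∀ {Nw f l} γ → Lh ≤ length (targets Nw f l) → n * γ ≤ length (targets Nw f l) * (G * γ)
       gain {Nw} {f} {l} γ le = begin
         n * γ                                   ≤⟨ *-monoˡ-≤ γ (≤-trans n≤GL (*-monoʳ-≤ G le)) ⟩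
         G * length (targets Nw f l) * γ         ≡⟨ e G (length (targets Nw f l)) γ ⟩
         length (targets Nw f l) * (G * γ)       ∎
         where
         open ≤-Reasoning
         e : ∀ g t c → g * t * c ≡ t * (g * c)
         e = solve-∀

       half-ex : ∀ {Nw} → length Nw ≤ capT → 2 * length (Ex Nw) ≤ n
       half-ex {Nw} small = ≤-trans (*-monoʳ-≤ 2 (≤-trans (≤-reflexive (length-++ Nw)) (+-monoˡ-≤ (length Ex₀) small))) half

       InPath : List X → Conf X → Set
       InPath R Q = Infix R (path Q)

       -- The bound `A / b` equals `p / D + S₀ / (S₀ + Y)`: failure of later merges plus the chance
       -- that no leaf in `lv` closes a path. `ih` applies once the current leaf has failed, and `q`
       -- pays for catastrophes at the later ones.
       record LeafData : Set where
         field
           lv : List (Item X)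
           S₀ Y q θ : ℕ
         b : ℕ
         b = (S₀ + Y) * (D * n)
         A : ℕ
         A = (p * (S₀ + Y) + S₀ * D) * n
         field
           θ-big : 2 * (length (pend lv) * b) ≤ n * θ
           ih : ∀ {s Nw} → Tst s Nw lv → length Nw + 4 * (kmax + 2) * length lv ≤ capT → b * cnt s ≤ (A + q) * W s

       module Leaf (LD : LeafData) where
         open LeafData LD

         GapL : S → ℕ → ℕ → Set
         GapL = Gap b A

         room : ℕ
         room = 4 * (kmax + 2) * length lv

         failing : ∀ {s Nw t} → Tst s Nw lv → length Nw + room ≤ capT → GapL s 0 (q + t)
         failing {s} {Nw} {t} st small = gap-weaken {b} {A} {s} {0} {0} {q} z≤n (m≤m+n q t) (≤-trans (≤-reflexive (+-identityʳ _)) (ih st small))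

         record Active (s : S) (Nw : List X) (x : X) : Set where
           field
             st    : Tst s Nw lv
             x∈    : x ∈ Ex Nw
             x-fr  : ∀ c → Fresh s x c
             x∉lv  : ∀ {c it} → it ∈ lv → hed it ≢ (x , c)
         open Active

         active-next : ∀ {s x d w s′ Nw} → Tst s Nw lv → x ∈ Ex Nw → (∀ {it} → it ∈ lv → hed it ≢ (x , d)) → Outcome s x d w s′ →
           w ∉ nb (Ex Nw) → w ∉ nb CutL → ∀ c → Active s′ (grow x w Nw) (ρ c w)
         active-next {x = x} {w = w} {Nw = Nw} t x∈ ne o w∉E w∉C c = record
           { st = tst-next t x∈ ne o (pend-∉ t w∉C (∉-nb w∉E))
           ; x∈ = ∈-++⁺ˡ (ρ∈grow c {x} {w} {Nw})
           ; x-fr = λ e → transfer-≢ o (λ r → w∉E (∈-nb c (subst (_∈ Ex Nw) (sym (cong proj₁ r)) x∈))) (λ r → ρ-≢ c w (cong proj₁ r)) (fresh (proj₁ t) (ρ c w) (w∉E ∘ ∈-nb c) e)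
           ; x∉lv = λ {e} {it} i r → w∉E (∈-nb c (subst (_∈ Ex Nw) (cong proj₁ r) (hed∈ (All.lookup (proj₂ t) i)))) }

         Word : Bool → List X → S → List X → X → Conf X → Set
         Word η R s Nw x Q = Good (K s Nw) x Q × Absorbed Rs kk Q × InPath R Q

         -- The run around `w` is intact in every path, so the predecessor of `w` is `ρ η w` for all
         -- of them and the family is not split. What follows the block of `w` remains an intact run
         -- for the next letter.
         word-move : ∀ {η r b₁ w b₂ R s x d s′ Nw} (o : Outcome s x d w s′) → x ∈ Ex Nw → w ∉ Ex Nw → w ∉ concat Rs →
           RunOf η (r ∷ b₁ ++ w ∷ b₂ ++ R) → ∀ {Q} → Word η (r ∷ b₁ ++ w ∷ b₂ ++ R) s Nw x Q →
           ∃ λ Q′ → end Q′ ≡ end Q × Word η R s′ (grow x w Nw) (ρ η w) Q′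
         word-move {η} {r} {b₁} {w} {b₂} {R} {Nw = Nw} o x∈ w∉ w∉R run {Q} (g , (rs , cuts , lt) , xs , ys , eq) with snoc-view r b₁
         ... | m , y , e = _ , refl , subst (λ z → Good _ z _) y-eq (proj₂ (step-path {Nw = Nw} o x∈ w∉ (xs ++ m) g eq₁)) ,
               (map-runs {Nw = Nw} o x∈ w∉ Rs w∉R (λ {r′} w∉r j → runs-path {Nw = Nw} o x∈ w∉ (xs ++ m) w∉r (subst (r′ ⊑±_) eq₁ j)) rs , cuts , lt) ,
               y ∷ reverse (xs ++ m) ++ w ∷ b₂ , ys , cong (y ∷_) (trans (cong (λ z → reverse (xs ++ m) ++ w ∷ z) (++-assoc b₂ R ys)) (sym (++-assoc (reverse (xs ++ m)) (w ∷ b₂) (R ++ ys))))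
           where
           eq₁ : path Q ≡ (xs ++ m) ++ y ∷ w ∷ (b₂ ++ R) ++ ys
           eq₁ = trans eq (trans (cong (xs ++_) (trans (cong (_++ ys) (trans (sym (++-assoc (r ∷ b₁) (w ∷ b₂) R)) (trans (cong (λ z → (z ++ w ∷ b₂) ++ R) e) (trans (++-assoc (m ++ [ y ]) (w ∷ b₂) R) (++-assoc m [ y ] _))))) (++-assoc m _ ys))) (sym (++-assoc xs m _)))
           y-eq : y ≡ ρ η w
           y-eq = chain-mid m (subst (RunOf η) (trans (cong (_++ w ∷ b₂ ++ R) e) (++-assoc m [ y ] _)) run)

         moveAll : ∀ {P P′ : Conf X → Set} (f : ∀ {Q} → P Q → ∃ λ Q′ → end Q′ ≡ end Q × P′ Q′) Qs → All P Qs →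
           ∃ λ Qs′ → All P′ Qs′ × map end Qs′ ≡ map end Qs
         moveAll f [] [] = [] , [] , refl
         moveAll f (Q ∷ Qs) (a ∷ as) =
           let (Q′ , e , a′) = f a ; (Qs′ , as′ , es) = moveAll f Qs as in Q′ ∷ Qs′ , a′ ∷ as′ , cong₂ _∷_ e es

         -- The exposed partner is the stored end of this very path, so the path closes up into the
         -- next big cycle.
         close : ∀ {s Nw x Q s′} → Good (K s Nw) x Q → Absorbed Rs kk Q → Tst s Nw lv → x ∈ Ex Nw → proj₁ (end Q) ∈ Ex₀ →
           Outcome s x (not dA) (proj₁ (end Q)) s′ → proj₁ (end Q) ∉ nb CutL → 4 + length Nw ≤ capT → D * cnt s′ ≤ p * W s′
         close {s} {Nw} {x} {Q} {s′} g (rs , cuts , lt) t x∈ a∈ o a∉C small =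
           closing (inv-next (proj₁ t) x∈ (λ ()) o a∉C (λ ())) small closed
             (All.map (λ {c} → closed-map (K-mono {Nw = Nw} o) c) (cycles g)) (cover g) rs cuts lt
           where
           a = proj₁ (end Q)
           K′ = K s′ (grow x a Nw)
           closed : Closed K′ (path Q)
           closed with head g | last g
           ... | t , e | t′ , e′ = subst (Closed K′) (sym e) (subst (Chain K′) (trans (sym (++-assoc t′ [ a ] [ x ])) (cong (_++ [ x ]) (trans (sym e′) e)))
             (chain-glue t′ (subst (Chain K′) e′ (chain-map (K-mono {Nw = Nw} o) (path Q) (chain g))) (K-sym (K-new {Nw = Nw} o) , _)))

         -- Induction on the word: each letter is realised by a hit in its own block of the run and
         -- costs a factor `G`. At the end the active fibre is `go dA u`, so half-edge `not dA`
         -- leads to fibre `u`, where all stored ends lie; any of them that is still usable closes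
         -- its path.
         word-stage : ∀ word {η R s Nw x Qs γ} → Active s Nw x → All (Word η R s Nw x) Qs → Unique (map end Qs) →
           (∀ {e} → e ∈ map end Qs → e ∈ E₀) → RunOf η R → Unique R → (∀ {w} → w ∈ R → w ∉ concat Rs) →
           length word * (1 + L * h) ≤ length R → walk η (fib x) word ≡ go dA u →
           length Nw + 4 * (length word + 1) + room ≤ capT →
           n * (G ^ length word * γ) ≤ (length Qs ∸ capE) * (S₀ * (D * n)) →
           GapL s γ (q + θ * (length word + 1))
         word-stage [] {η} {R} {s} {Nw} {x} {Qs} {γ} ac ws uq ⊆E run uR dis len fx small gp =
           gap-weaken {b} {A} {s} {γ} {γ} {q + θ * 0 + θ} ≤-refl (≤-reflexive (e q θ))
             (gap-query {s} {x} {not dA} {Ex Nw} {sc} {pend lv} b A {γ} {S₀ * (D * n)} {q + θ * 0} {θ}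
               (x-fr ac (not dA)) (fresh (proj₁ (st ac))) (half-ex {Nw} Nw≤)
               (Uniq.filter⁺ _ utips) sc-ok many θ-big succeed fail)
           where
           e : ∀ q θ → q + θ * 0 + θ ≡ q + θ * 1
           e = solve-∀
           Nw≤ : length Nw ≤ capT
           Nw≤ = ≤-trans (m≤m+n (length Nw) _) (≤-trans (m≤m+n (length Nw + 4) room) small)
           tips = map (proj₁ ∘ end) Qs
           out = Nw ++ nb CutL
           sc = filter (λ a → ¬? (a ∈? out)) tips
           end-of : ∀ {a} → a ∈ tips → (a , dA) ∈ E₀ × fib a ≡ u × a ∈ Ex₀
           end-of i with ∈-map⁻ (proj₁ ∘ end) i
           ... | Q , Q∈ , refl with ⊆E (∈-map⁺ end Q∈)
           ...   | j with E₀-class j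
           ...     | refl , fu , a∈ = j , fu , a∈
           tips-map : tips ≡ map proj₁ (map end Qs)
           tips-map = Data.List.Properties.map-∘ Qs
           utips : Unique tips
           utips = subst Unique (sym tips-map) (unique-map (λ i j e → cong₂ _,_ e (trans (proj₁ (E₀-class (⊆E i))) (sym (proj₁ (E₀-class (⊆E j)))))) uq)
           sc-ok : ∀ {w} → w ∈ sc → fib w ≡ go (not dA) (fib x) × Fresh s w (not (not dA))
           sc-ok {w} i = let (j , a∉) = ∈-filter⁻ (λ a → ¬? (a ∈? out)) {xs = tips} i ; (k , fu , _) = end-of j in
             trans fu (trans (sym (go-inv dA u)) (cong (go (not dA)) (sym fx))) ,
             subst (Fresh s w) (sym (not-involutive dA)) (Sum.[ (λ f → f) , (λ bad → ⊥-elim (a∉ (∈-++⁺ˡ bad))) ]′ (kept (proj₁ (st ac)) k))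
           many : n * γ ≤ length sc * (S₀ * (D * n))
           many = begin
             n * γ                              ≡⟨ cong (n *_) (sym (*-identityˡ γ)) ⟩
             n * (1 * γ)                        ≤⟨ gp ⟩
             (length Qs ∸ capE) * (S₀ * (D * n)) ≤⟨ *-monoˡ-≤ (S₀ * (D * n)) (m≤n+o⇒m∸n≤o (length Qs) capE all≤) ⟩
             length sc * (S₀ * (D * n))         ∎
             where
             open ≤-Reasoning
             sub : ∀ {z} → z ∈ tips → z ∈ out ++ sc
             sub {z} i with z ∈? out
             ... | yes j = ∈-++⁺ˡ j
             ... | no z∉ = ∈-++⁺ʳ out (∈-filter⁺ (λ a → ¬? (a ∈? out)) i z∉)
             all≤ : length Qs ≤ capE + length sc
             all≤ = begin
               length Qs                       ≡⟨ sym (length-map (proj₁ ∘ end) Qs) ⟩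
               length tips                     ≤⟨ Unique⊆⇒length≤ utips sub ⟩
               length (out ++ sc)              ≡⟨ length-++ out ⟩
               length out + length sc          ≡⟨ cong (_+ length sc) (trans (length-++ Nw) (cong (length Nw +_) (length-nb CutL))) ⟩
               length Nw + 3 * length CutL + length sc ≤⟨ +-monoˡ-≤ (length sc) (≤-trans (+-monoˡ-≤ (3 * length CutL) Nw≤) capE-ok) ⟩
               capE + length sc                ∎
           small′ : 4 + length Nw + room ≤ capT
           small′ = ≤-trans (≤-reflexive (cong (_+ room) (+-comm 4 (length Nw)))) small
           -- Once the path is closed, only later merges can fail, with bound `p / D`; its
           -- difference to `A / b`, scaled by `b`, is exactly `S₀ * (D * n)`.
           succeed : ∀ {w s′} → Outcome s x (not dA) w s′ → w ∈ sc → GapL s′ (S₀ * (D * n)) (q + θ * 0)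
           succeed {w} {s′} o i with ∈-filter⁻ (λ a → ¬? (a ∈? out)) {xs = tips} i
           ... | i′ , w∉out with ∈-map⁻ (proj₁ ∘ end) i′
           ... | Q , Q∈ , refl with All.lookup ws Q∈
           ...   | g , ab , _ = begin
             (S₀ + Y) * (D * n) * cnt s′ + S₀ * (D * n) * W s′
               ≡⟨ cong (_+ S₀ * (D * n) * W s′) (e₁ (S₀ + Y) D n (cnt s′)) ⟩
             (S₀ + Y) * n * (D * cnt s′) + S₀ * (D * n) * W s′
               ≤⟨ +-monoˡ-≤ _ (*-monoʳ-≤ ((S₀ + Y) * n) (close {Nw = Nw} g ab (st ac) (x∈ ac) a∈ o a∉C (≤-trans (m≤m+n _ room) small′))) ⟩
             (S₀ + Y) * n * (p * W s′) + S₀ * (D * n) * W s′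
               ≡⟨ e₂ S₀ Y n p (W s′) D ⟩
             A * W s′
               ≤⟨ *-monoˡ-≤ (W s′) (m≤m+n A (q + θ * 0)) ⟩
             (A + (q + θ * 0)) * W s′ ∎
             where
             open ≤-Reasoning
             a∈ : proj₁ (end Q) ∈ Ex₀
             a∈ = proj₂ (proj₂ (E₀-class (⊆E (∈-map⁺ end Q∈))))
             a∉C : proj₁ (end Q) ∉ nb CutL
             a∉C = w∉out ∘ ∈-++⁺ʳ Nw
             e₁ : ∀ t D n c → t * (D * n) * c ≡ t * n * (D * c)
             e₁ = solve-∀
             e₂ : ∀ S Y n p w D → (S + Y) * n * (p * w) + S * (D * n) * w ≡ (p * (S + Y) + S * D) * n * w
             e₂ = solve-∀
           fail : ∀ {w s′} → Outcome s x (not dA) w s′ → w ∉ sc → w ∉ pend lv → GapL s′ 0 (q + θ * 0)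
           fail o _ w∉ = failing (tst-next (st ac) (x∈ ac) (x∉lv ac) o w∉) small′

         word-stage (d ∷ ds) {η} {[]} ac ws uq ⊆E run uR dis () fx small gp
         word-stage (d ∷ ds) {η} {r ∷ R} {s} {Nw} {x} {Qs} {γ} ac ws uq ⊆E run uR dis len fx small gp =
           gap-weaken {b} {A} {s} {γ} {γ} {q + θ * (length ds + 1) + θ} ≤-refl (≤-reflexive (e q θ (length ds)))
             (gap-query {s} {x} {d} {Ex Nw} {sc} {pend lv} b A {γ} {G * γ} {q + θ * (length ds + 1)} {θ}
               (x-fr ac d) (fresh (proj₁ (st ac))) (half-ex {Nw} Nw≤)
               (targets-unique {Nw} {f} {B} uB) sc-ok
               (gain {Nw} {f} {B} γ (targets-many {η} {Nw} {r} {B} f run-B uB (≤-reflexive (sym len-B)) Nw≤)) θ-big succeed fail)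
           where
           e : ∀ q θ l → q + θ * (l + 1) + θ ≡ q + θ * (suc l + 1)
           e = solve-∀
           Nw≤ : length Nw ≤ capT
           Nw≤ = ≤-trans (m≤m+n (length Nw) _) (≤-trans (m≤m+n (length Nw + _) room) small)
           f = go d (fib x)
           B = take (L * h) R
           R′ = drop (L * h) R
           BR : R ≡ B ++ R′
           BR = sym (take++drop≡id (L * h) R)
           len-R : L * h + length ds * (1 + L * h) ≤ length R
           len-R = s≤s⁻¹ len
           len-B : length B ≡ L * h
           len-B = trans (length-take (L * h) R) (m≤n⇒m⊓n≡m (≤-trans (m≤m+n (L * h) _) len-R))
           len-R′ : length ds * (1 + L * h) ≤ length R′
           len-R′ = subst (length ds * (1 + L * h) ≤_) (sym (length-drop (L * h) R)) (m+n≤o⇒m≤o∸n _ (≤-trans (≤-reflexive (+-comm _ (L * h))) len-R))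
           run′ : RunOf η (r ∷ B ++ R′)
           run′ = subst (λ z → RunOf η (r ∷ z)) BR run
           run-B : RunOf η (r ∷ B)
           run-B = chain-left (r ∷ B) run′
           uBR : Unique (B ++ R′)
           uBR = subst Unique BR (unique-tail uR)
           uB : Unique B
           uB = unique-++ˡ B uBR
           sc = targets Nw f B
           sc-ok : ∀ {w} → w ∈ sc → fib w ≡ f × Fresh s w (not d)
           sc-ok {w} i = let (_ , fw , w∉E , _) = targets-∈ {Nw} {f} {B} i in fw , fresh (proj₁ (st ac)) w (∉-nb w∉E) (not d)
           next-small : 4 + length Nw + 4 * (length ds + 1) + room ≤ capT
           next-small = ≤-trans (≤-reflexive (cong (_+ room) (e′ (length Nw) (length ds)))) small
             where
             e′ : ∀ N l → 4 + N + 4 * (l + 1) ≡ N + 4 * (suc l + 1)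
             e′ = solve-∀
           small′ : 4 + length Nw + room ≤ capT
           small′ = ≤-trans (+-monoˡ-≤ room (m≤m+n (4 + length Nw) _)) next-small
           fail : ∀ {w s′} → Outcome s x d w s′ → w ∉ sc → w ∉ pend lv → GapL s′ 0 (q + θ * (length ds + 1))
           fail o _ w∉ = failing (tst-next (st ac) (x∈ ac) (x∉lv ac) o w∉) small′
           succeed : ∀ {w s′} → Outcome s x d w s′ → w ∈ sc → GapL s′ (G * γ) (q + θ * (length ds + 1))
           succeed {w} {s′} o i with targets-∈ {Nw} {f} {B} i
           ... | w∈B , fw , w∉E , w∉C with ∈-∃++ w∈B
           ...   | b₁ , b₂ , eqB = word-stage ds {Qs = proj₁ moved}
                   (active-next (st ac) (x∈ ac) (x∉lv ac) o w∉E w∉C η) (proj₁ (proj₂ moved))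
                   (subst Unique (sym (proj₂ (proj₂ moved))) uq) (λ {e} j → ⊆E (subst (e ∈_) (proj₂ (proj₂ moved)) j))
                   (chain-right (r ∷ B) run′) (unique-++ʳ B uBR)
                   (λ j → dis (there (subst (_ ∈_) (sym BR) (∈-++⁺ʳ B j)))) len-R′
                   (trans (cong (λ z → walk η z ds) (trans (fib-ρ η w) (cong (go₁ η) fw))) fx) next-small
                   (subst₂ (λ a c → n * a ≤ (c ∸ capE) * (S₀ * (D * n))) (e″ G (G ^ length ds) γ) len-eq gp)
             where
             e″ : ∀ g t c → g * t * c ≡ t * (g * c)
             e″ = solve-∀
             R-eq : r ∷ R ≡ r ∷ b₁ ++ w ∷ b₂ ++ R′
             R-eq = cong (r ∷_) (trans BR (trans (cong (_++ R′) eqB) (++-assoc b₁ (w ∷ b₂) R′)))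
             moved = moveAll (λ {Q} a → word-move {η} {r} {b₁} {w} {b₂} {R′} {Nw = Nw} o (x∈ ac) (∉-nb w∉E)
               (dis (there (subst (w ∈_) (sym BR) (∈-++⁺ˡ w∈B)))) (subst (RunOf η) R-eq run) {Q} (subst (λ z → Word η z s Nw x Q) R-eq a)) Qs ws
             len-eq : length Qs ≡ length (proj₁ moved)
             len-eq = trans (sym (length-map end Qs)) (trans (cong length (sym (proj₂ (proj₂ moved)))) (length-map end (proj₁ moved)))

         -- Paths traversing `Rm` in opposite directions would move to different ends, so only the
         -- more frequent direction is kept.
         majority : ∀ {P Q : Conf X → Set} cs → All (λ c → P c ⊎ Q c) cs → Unique (map end cs) →
           ∃ λ cs′ → (All P cs′ ⊎ All Q cs′) × length cs ≤ 2 * length cs′ × Unique (map end cs′) × (∀ {e} → e ∈ map end cs′ → e ∈ map end cs)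
         majority {P} {Q} cs as uq with parts cs as uq
           where
           Sub : (Conf X → Set) → List (Conf X) → Set
           Sub P cs = ∃ λ cs′ → All P cs′ × Unique (map end cs′) × (∀ {e} → e ∈ map end cs′ → e ∈ map end cs)
           parts : ∀ cs → All (λ c → P c ⊎ Q c) cs → Unique (map end cs) →
             Σ (Sub P cs × Sub Q cs) λ (a , b) → length (proj₁ a) + length (proj₁ b) ≡ length cs
           parts [] [] uq = (([] , [] , [] , λ ()) , ([] , [] , [] , λ ())) , refl
           parts (c ∷ cs) (a ∷ as) uq with parts cs as (unique-tail uq) | a
           ... | ((ps , pa , pu , p⊆) , (qs , qa , qu , q⊆)) , len | inj₁ p =
             ((c ∷ ps , p ∷ pa , unique-∷ (unique-head uq ∘ p⊆) pu , λ { (here e) → here e ; (there i) → there (p⊆ i) }) , (qs , qa , qu , there ∘ q⊆)) , cong suc len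
           ... | ((ps , pa , pu , p⊆) , (qs , qa , qu , q⊆)) , len | inj₂ q =
             ((ps , pa , pu , there ∘ p⊆) , (c ∷ qs , q ∷ qa , unique-∷ (unique-head uq ∘ q⊆) qu , λ { (here e) → here e ; (there i) → there (q⊆ i) })) , trans (+-suc _ _) (cong suc len)
         ... | ((ps , pa , pu , p⊆) , (qs , qa , qu , q⊆)) , len with ≤-total (length qs) (length ps)
         ...   | inj₁ le = ps , inj₁ pa , ≤-trans (≤-reflexive (sym len)) (+-monoʳ-≤ (length ps) (≤-trans le (≤-reflexive (sym (+-identityʳ _))))) , pu , p⊆
         ...   | inj₂ le = qs , inj₂ qa , ≤-trans (≤-reflexive (sym len)) (≤-trans (+-monoˡ-≤ (length qs) le) (+-monoʳ-≤ (length qs) (≤-reflexive (sym (+-identityʳ _))))) , qu , q⊆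

         Rm-dis : ∀ {z} → z ∈ Rm → z ∉ concat Rs
         Rm-dis = unique-disj Rm (unique-++ʳ R₀ runs-unique)

         Rm-unique : Unique Rm
         Rm-unique = unique-++ˡ Rm (unique-++ʳ R₀ runs-unique)

         -- The factor 4 pays for two halvings of the family, by the side at the hit of `R₀` and by
         -- the direction of `Rm`. Words shorter than `kmax` are charged the full power of `G`.
         scale : ∀ {k γ M M′} → k ≤ kmax → M ≤ 4 * M′ → n * (G ^ (kmax + 1) * γ * 4) ≤ (M ∸ 4 * capE) * (S₀ * (D * n)) →
           n * (G ^ k * (G * γ)) ≤ (M′ ∸ capE) * (S₀ * (D * n))
         scale {k} {γ} {M} {M′} k≤ many gp = *-cancelʳ-≤ _ _ 4 (begin
           n * (G ^ k * (G * γ)) * 4                 ≡⟨ e₁ n (G ^ k) G γ ⟩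
           n * ((G * G ^ k) * γ * 4)                 ≤⟨ *-monoʳ-≤ n (*-monoˡ-≤ 4 (*-monoˡ-≤ γ pow)) ⟩
           n * (G ^ (kmax + 1) * γ * 4)              ≤⟨ gp ⟩
           (M ∸ 4 * capE) * (S₀ * (D * n))           ≤⟨ *-monoˡ-≤ (S₀ * (D * n)) (≤-trans (∸-monoˡ-≤ (4 * capE) many) (≤-reflexive (sym (*-distribˡ-∸ 4 M′ capE)))) ⟩
           4 * (M′ ∸ capE) * (S₀ * (D * n))          ≡⟨ e₂ (M′ ∸ capE) (S₀ * (D * n)) ⟩
           (M′ ∸ capE) * (S₀ * (D * n)) * 4          ∎)
           where
           open ≤-Reasoning
           e₁ : ∀ n t g c → n * (t * (g * c)) * 4 ≡ n * ((g * t) * c * 4)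
           e₁ = solve-∀
           e₂ : ∀ a c → 4 * a * c ≡ a * c * 4
           e₂ = solve-∀
           pow : G * G ^ k ≤ G ^ (kmax + 1)
           pow = ^-monoʳ-≤ G {{>-nonZero 1≤G}} (≤-trans (s≤s k≤) (≤-reflexive (+-comm 1 kmax)))

         go-word : ∀ {η R s Nw x Qs M γ} → Active s Nw x → All (Word η R s Nw x) Qs → Unique (map end Qs) →
           (∀ {e} → e ∈ map end Qs → e ∈ E₀) → RunOf η R → Unique R → (∀ {w} → w ∈ R → w ∉ concat Rs) →
           kmax * (1 + L * h) ≤ length R → length Nw + 4 * (kmax + 1) + room ≤ capT → M ≤ 4 * length Qs →
           n * (G ^ (kmax + 1) * γ * 4) ≤ (M ∸ 4 * capE) * (S₀ * (D * n)) → GapL s (G * γ) (q + θ * (kmax + 1))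
         go-word {η} {R} {s} {Nw} {x} {Qs} {M} {γ} ac ws uq ⊆E run uR dis len small many gp with reach η (fib x) (go dA u)
         ... | word , wl , wk = gap-weaken {b} {A} {s} {G * γ} {G * γ} {q + θ * (length word + 1)} ≤-refl
           (+-monoʳ-≤ q (*-monoʳ-≤ θ (+-monoˡ-≤ 1 wl)))
           (word-stage word {Qs = Qs} ac ws uq ⊆E run uR dis (≤-trans (*-monoˡ-≤ (1 + L * h) wl) len) wk
             (≤-trans (+-monoˡ-≤ room (+-monoʳ-≤ (length Nw) (*-monoʳ-≤ 4 (+-monoˡ-≤ 1 wl)))) small) (scale {length word} {γ} {M} wl many gp))

         after-hit : ∀ {s Nw x Qs M γ} → Active s Nw x → All (λ Q → Good (K s Nw) x Q × Absorbed (Rm ∷ Rs) kk Q) Qs → Unique (map end Qs) →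
           (∀ {e} → e ∈ map end Qs → e ∈ E₀) → length Nw + 4 * (kmax + 1) + room ≤ capT → M ≤ 2 * length Qs →
           n * (G ^ (kmax + 1) * γ * 4) ≤ (M ∸ 4 * capE) * (S₀ * (D * n)) → GapL s (G * γ) (q + θ * (kmax + 1))
         after-hit {s} {Nw} {x} {Qs} {M} {γ} ac gs uq ⊆E small big gp
           with majority {Word false Rm s Nw x} {Word true (reverse Rm) s Nw x} Qs
             (All.map (λ { (g , (inj₁ i ∷ rs , rest)) → inj₁ (g , (rs , rest) , i) ; (g , (inj₂ i ∷ rs , rest)) → inj₂ (g , (rs , rest) , i) }) gs) uq
         ... | Qs′ , ors , most , uq′ , ⊆Qs = [ fwd , bwd ]′ ors
           where
           many : M ≤ 4 * length Qs′
           many = ≤-trans big (≤-trans (*-monoʳ-≤ 2 most) (≤-reflexive (sym (*-assoc 2 2 (length Qs′)))))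
           fwd : All (Word false Rm s Nw x) Qs′ → GapL s (G * γ) (q + θ * (kmax + 1))
           fwd ws = go-word {Qs = Qs′} {M} {γ} ac ws uq′ (⊆E ∘ ⊆Qs) Rm-run Rm-unique Rm-dis Rm-len small many gp
           bwd : All (Word true (reverse Rm) s Nw x) Qs′ → GapL s (G * γ) (q + θ * (kmax + 1))
           bwd ws = go-word {Qs = Qs′} {M} {γ} ac ws uq′ (⊆E ∘ ⊆Qs) (run-reverse Rm Rm-run)
             (unique-↭ (↭-sym (↭-reverse Rm)) Rm-unique) (Rm-dis ∘ ∈-reverse⁻) (subst (kmax * (1 + L * h) ≤_) (sym (length-reverse Rm)) Rm-len) small many gp

         -- A hit in `R₀` guarantees that the big cycle, and with it `Rm`, is on every path. The
         -- side still varies, so the larger side is kept.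
         hit : ∀ {s Nw x d Qs w s′ γ} → Tst s Nw lv → LeafOK s Nw (item (x , d) 0 Qs) → (∀ {it} → it ∈ lv → hed it ≢ (x , d)) →
           Outcome s x d w s′ → w ∈ R₀ → w ∉ nb (Ex Nw) → w ∉ nb CutL → 4 + length Nw + 4 * (kmax + 1) + room ≤ capT →
           n * (G ^ (kmax + 1) * γ * 4) ≤ (length Qs ∸ 4 * capE) * (S₀ * (D * n)) → GapL s′ (G * γ) (q + θ * (kmax + 1))
         hit {s} {Nw} {x} {d} {Qs} {w} {s′} {γ} t ok ne o w∈R₀ w∉E w∉C small gp = choose (split Qs (good ok) (uends ok))
           where
           open SplitConfs St Ex₀ CutL E₀ {Nw = Nw} o (hed∈ ok) (∉-nb w∉E) {Located runs kk} {Absorbed (Rm ∷ Rs) kk}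
             (λ g l → step-run {Nw = Nw} o (hed∈ ok) (∉-nb w∉E) g w∈R₀ (unique-disj R₀ runs-unique w∈R₀) l)
             using (side; split; ⊆ends; SplitResult) renaming (good to side-good; unique to side-unique)
           via : ∀ c (sd : SplitResult Qs) → length Qs ≤ 2 * length (side (proj₁ sd c)) → GapL s′ (G * γ) (q + θ * (kmax + 1))
           via c (sd , _) big = after-hit {Qs = side (sd c)} {length Qs} {γ} (active-next t (hed∈ ok) ne o w∉E w∉C c)
             (side-good (sd c)) (side-unique (sd c)) (λ j → ItemOK.ends ok (⊆ends (sd c) j)) small big gp
           choose : SplitResult Qs → GapL s′ (G * γ) (q + θ * (kmax + 1))
           choose r@(sd , e) with ≤-total (length (side (sd true))) (length (side (sd false)))
           ... | inj₁ le = via false r (≤-trans (≤-reflexive (sym e)) (≤-trans (+-monoˡ-≤ _ le) (+-monoʳ-≤ (length (side (sd false))) (≤-reflexive (sym (+-identityʳ _))))))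
           ... | inj₂ le = via true r (≤-trans (≤-reflexive (sym e)) (+-monoʳ-≤ (length (side (sd true))) (≤-trans le (≤-reflexive (sym (+-identityʳ _))))))

         R₀-cons : ∃ λ r → ∃ λ R → R₀ ≡ r ∷ R × L * h ≤ length R
         R₀-cons = view R₀ R₀-len
           where
           view : ∀ l → 1 + L * h ≤ length l → ∃ λ r → ∃ λ R → l ≡ r ∷ R × L * h ≤ length R
           view (r ∷ R) (s≤s le) = r , R , refl , le

         -- One trial takes at most `kmax + 2` exposures: a hit in `R₀`, one per letter of the word,
         -- and the closing one.
         leaf-stage : ∀ {s Nw x d Qs} γ → Tst s Nw lv → LeafOK s Nw (item (x , d) 0 Qs) → (∀ {it} → it ∈ lv → hed it ≢ (x , d)) →
           length Nw + 4 * (kmax + 2) + room ≤ capT →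
           n * (G ^ (kmax + 1) * γ * 4) ≤ (length Qs ∸ 4 * capE) * (S₀ * (D * n)) →
           GapL s γ (q + θ * (kmax + 2))
         leaf-stage {s} {Nw} {x} {d} {Qs} γ t ok ne small gp =
           gap-weaken {b} {A} {s} {γ} {γ} {q + θ * (kmax + 1) + θ} ≤-refl (≤-reflexive (e q θ kmax))
             (gap-query {s} {x} {d} {Ex Nw} {sc} {pend lv} b A {γ} {G * γ} {q + θ * (kmax + 1)} {θ}
               (hed-fr ok) (fresh (proj₁ t)) (half-ex {Nw} Nw≤) (targets-unique {Nw} {f} {R} uR) sc-ok
               (gain {Nw} {f} {R} γ (targets-many {false} {Nw} {r} {R} f run uR len Nw≤)) θ-big succeed fail)
           where
           e : ∀ q θ l → q + θ * (l + 1) + θ ≡ q + θ * (l + 2)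
           e = solve-∀
           Nw≤ : length Nw ≤ capT
           Nw≤ = ≤-trans (m≤m+n (length Nw) _) (≤-trans (m≤m+n (length Nw + _) room) small)
           f = go d (fib x)
           r = proj₁ R₀-cons
           R = proj₁ (proj₂ R₀-cons)
           R₀≡ : R₀ ≡ r ∷ R
           R₀≡ = proj₁ (proj₂ (proj₂ R₀-cons))
           len : L * h ≤ length R
           len = proj₂ (proj₂ (proj₂ R₀-cons))
           run : RunOf false (r ∷ R)
           run = subst (RunOf false) R₀≡ R₀-run
           uR : Unique R
           uR = unique-tail (subst Unique R₀≡ (unique-++ˡ R₀ runs-unique))
           sc = targets Nw f R
           sc-ok : ∀ {w} → w ∈ sc → fib w ≡ f × Fresh s w (not d)
           sc-ok {w} i = let (_ , fw , w∉E , _) = targets-∈ {Nw} {f} {R} i in fw , fresh (proj₁ t) w (∉-nb w∉E) (not d)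
           next-small : 4 + length Nw + 4 * (kmax + 1) + room ≤ capT
           next-small = ≤-trans (≤-reflexive (cong (_+ room) (e′ (length Nw) kmax))) small
             where
             e′ : ∀ N l → 4 + N + 4 * (l + 1) ≡ N + 4 * (l + 2)
             e′ = solve-∀
           fail : ∀ {w s′} → Outcome s x d w s′ → w ∉ sc → w ∉ pend lv → GapL s′ 0 (q + θ * (kmax + 1))
           fail o _ w∉ = failing (tst-next t (hed∈ ok) ne o w∉) (≤-trans (+-monoˡ-≤ room (m≤m+n (4 + length Nw) _)) next-small)
           succeed : ∀ {w s′} → Outcome s x d w s′ → w ∈ sc → GapL s′ (G * γ) (q + θ * (kmax + 1))
           succeed {w} {s′} o i = let (w∈R , fw , w∉E , w∉C) = targets-∈ {Nw} {f} {R} i in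
             hit t ok ne o (subst (w ∈_) (sym R₀≡) (there w∈R)) w∉E w∉C next-small gp

       -- At most `capE` ends are unusable, but the family may be quartered before the closing
       -- exposure, hence the deduction of `4 * capE`.
       eff : Item X → ℕ
       eff it = length (confs it) ∸ 4 * capE

       -- The probability that all leaves fail is at most S₀ / (S₀ + Y), as
       -- (1 − x) / (1 + Y) ≤ 1 / (1 + x + Y); θ pays for hitting a pending leaf.
       trials : ∀ S₀ θ Λ Y → 4 * n * G ^ (kmax + 1) ≤ S₀ → 2 * (Λ * ((S₀ + Y) * D)) ≤ θ →
         ∀ lv {s Nw} → ∑ lv eff ≤ Y → 3 * length CutL + length lv ≤ Λ → Tst s Nw lv → Unique (map hed lv) → All (λ it → depth it ≡ 0) lv →
         length Nw + 4 * (kmax + 2) * length lv ≤ capT →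
         (S₀ + ∑ lv eff) * (D * n) * cnt s ≤ ((p * (S₀ + ∑ lv eff) + S₀ * D) * n + θ * ((kmax + 2) * length lv)) * W s
       trials S₀ θ Λ Y S₀-big θ-big [] {s} _ _ _ _ _ _ = begin
         (S₀ + 0) * (D * n) * cnt s                    ≤⟨ *-monoʳ-≤ ((S₀ + 0) * (D * n)) (cnt≤W s) ⟩
         (S₀ + 0) * (D * n) * W s                      ≤⟨ *-monoˡ-≤ (W s) (≤-trans (≤-reflexive (e S₀ D n)) (≤-trans (*-monoˡ-≤ n (m≤n+m (S₀ * D) (p * (S₀ + 0)))) (m≤m+n _ _))) ⟩
         ((p * (S₀ + 0) + S₀ * D) * n + θ * ((kmax + 2) * 0)) * W s ∎
         where
         open ≤-Reasoning
         e : ∀ S D n → (S + 0) * (D * n) ≡ S * D * n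
         e = solve-∀
       trials S₀ θ Λ Y S₀-big θ-big (item (x , d) .0 Qs ∷ lv) {s} {Nw} Y≤ Λ≤ (inv , ok ∷ oks) uq (refl ∷ flat) small =
         conclude (leaf-stage γ (inv , oks) ok (λ i e → unique-head uq (subst (_∈ map hed lv) e (∈-map⁺ hed i)))
           (≤-trans (≤-reflexive (e₀ (length Nw) (4 * (kmax + 2)) (length lv))) small) gp)
         where
         open ≤-Reasoning
         M = length Qs ∸ 4 * capE
         Y′ = ∑ lv eff
         γ = M * (D * n)
         e₀ : ∀ N k l → N + k + k * l ≡ N + k * suc l
         e₀ = solve-∀
         e₁ : ∀ l t D n → 2 * (l * (t * (D * n))) ≡ n * (2 * (l * (t * D)))
         e₁ = solve-∀
         pend≤ : length (pend lv) ≤ Λ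
         pend≤ = ≤-trans (≤-reflexive (trans (length-++ (nb CutL)) (cong₂ _+_ (length-nb CutL) (length-map (proj₁ ∘ hed) lv))))
           (≤-trans (+-monoʳ-≤ (3 * length CutL) (n≤1+n (length lv))) Λ≤)
         leafData : LeafData
         leafData = record { lv = lv ; S₀ = S₀ ; Y = Y′ ; q = θ * ((kmax + 2) * length lv) ; θ = θ
           ; θ-big = begin
             2 * (length (pend lv) * ((S₀ + Y′) * (D * n)))  ≡⟨ e₁ (length (pend lv)) (S₀ + Y′) D n ⟩
             n * (2 * (length (pend lv) * ((S₀ + Y′) * D)))  ≤⟨ *-monoʳ-≤ n (≤-trans (*-monoʳ-≤ 2 (*-mono-≤ pend≤ (*-monoˡ-≤ D (+-monoʳ-≤ S₀ (≤-trans (m≤n+m Y′ M) Y≤))))) θ-big) ⟩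
             n * θ                                           ∎
           ; ih = λ {s} {Nw} t small′ → trials S₀ θ Λ Y S₀-big θ-big lv {s} {Nw} (≤-trans (m≤n+m Y′ M) Y≤)
             (≤-trans (+-monoʳ-≤ (3 * length CutL) (n≤1+n (length lv))) Λ≤) t (unique-tail uq) flat small′ }
         open Leaf leafData
         gp : n * (G ^ (kmax + 1) * γ * 4) ≤ M * (S₀ * (D * n))
         gp = begin
           n * (G ^ (kmax + 1) * (M * (D * n)) * 4)      ≡⟨ e₂ n (G ^ (kmax + 1)) M D ⟩
           M * (4 * n * G ^ (kmax + 1) * (D * n))        ≤⟨ *-monoʳ-≤ M (*-monoˡ-≤ (D * n) S₀-big) ⟩
           M * (S₀ * (D * n))                            ∎
           where
           e₂ : ∀ n g M D → n * (g * (M * (D * n)) * 4) ≡ M * (4 * n * g * (D * n))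
           e₂ = solve-∀
         conclude : GapL s γ (θ * ((kmax + 2) * length lv) + θ * (kmax + 2)) →
           (S₀ + (M + Y′)) * (D * n) * cnt s ≤ ((p * (S₀ + (M + Y′)) + S₀ * D) * n + θ * ((kmax + 2) * suc (length lv))) * W s
         conclude gap = begin
           (S₀ + (M + Y′)) * (D * n) * cnt s               ≡⟨ e₃ S₀ M Y′ (D * n) (cnt s) ⟩
           -- Bounding the surplus `γ * cnt s` by `γ * W s` is what brings this leaf into the
           -- denominator.
           (S₀ + Y′) * (D * n) * cnt s + γ * cnt s         ≤⟨ +-monoʳ-≤ _ (*-monoʳ-≤ γ (cnt≤W s)) ⟩
           (S₀ + Y′) * (D * n) * cnt s + γ * W s           ≤⟨ gap ⟩
           ((p * (S₀ + Y′) + S₀ * D) * n + (θ * ((kmax + 2) * length lv) + θ * (kmax + 2))) * W s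
             ≤⟨ *-monoˡ-≤ (W s) (+-mono-≤ (*-monoˡ-≤ n (+-monoˡ-≤ (S₀ * D) (*-monoʳ-≤ p (+-monoʳ-≤ S₀ (m≤n+m Y′ M))))) (≤-reflexive (e₄ θ (kmax + 2) (length lv)))) ⟩
           ((p * (S₀ + (M + Y′)) + S₀ * D) * n + θ * ((kmax + 2) * suc (length lv))) * W s ∎
           where
           e₃ : ∀ S M Y t c → (S + (M + Y)) * t * c ≡ (S + Y) * t * c + M * t * c
           e₃ = solve-∀
           e₄ : ∀ θ k l → θ * (k * l) + θ * k ≡ θ * (k * suc l)
           e₄ = solve-∀

-- Exploration from a single root: costs and Markov's inequality.

module RootedExploration where

 open ListTools
 open ExposureOracle
 open PathRotation
 open RotationSetting
 open TreeExploration

 2^≥1 : ∀ k → 1 ≤ 2 ^ k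
 2^≥1 k = ^-monoʳ-≤ 2 {0} {k} z≤n

 -- Two bounds on the number of exposures made below a node of depth k with M configurations: byMass
 -- for the first tree (one configuration per node), byDepth for the second (many, but few nodes).
 pathCost treeCost : ℕ → ℕ
 pathCost zero    = 1
 pathCost (suc k) = 1 + 2 * pathCost k
 treeCost zero    = 1
 treeCost (suc k) = 1 + 4 * treeCost k

 byMass byDepth : ℕ → ℕ → ℕ
 byMass M k = M * pathCost k
 byDepth zero    k = 0
 byDepth (suc _) k = treeCost k

 pathCost≤ : ∀ k → pathCost k + 1 ≤ 2 * 2 ^ k
 pathCost≤ zero    = ≤-refl
 pathCost≤ (suc k) = ≤-trans (≤-reflexive (e (pathCost k))) (*-monoʳ-≤ 2 (pathCost≤ k))
   where
   e : ∀ c → 1 + 2 * c + 1 ≡ 2 * (c + 1)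
   e = solve-∀

 treeCost≤ : ∀ k → treeCost k + 1 ≤ 2 * (2 ^ k * 2 ^ k)
 treeCost≤ zero    = ≤-refl
 treeCost≤ (suc k) = ≤-trans (≤-trans (+-monoʳ-≤ (1 + 4 * treeCost k) (s≤s (z≤n {2}))) (≤-reflexive (e (treeCost k))))
   (≤-trans (*-monoʳ-≤ 4 (treeCost≤ k)) (≤-reflexive (e′ (2 ^ k))))
   where
   e : ∀ c → 1 + 4 * c + 3 ≡ 4 * (c + 1)
   e = solve-∀
   e′ : ∀ t → 4 * (2 * (t * t)) ≡ 2 * (2 * t * (2 * t))
   e′ = solve-∀

 1≤pathCost : ∀ k → 1 ≤ pathCost k
 1≤pathCost zero    = ≤-refl
 1≤pathCost (suc k) = s≤s z≤n

 1≤treeCost : ∀ k → 1 ≤ treeCost k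
 1≤treeCost zero    = ≤-refl
 1≤treeCost (suc k) = s≤s z≤n

 byMass-step : ∀ M₁ M₂ k → 1 ≤ M₁ + M₂ → 1 + (2 * byMass M₁ k + 2 * byMass M₂ k) ≤ byMass (M₁ + M₂) (suc k)
 byMass-step M₁ M₂ k pos = ≤-trans (+-monoˡ-≤ _ pos) (≤-reflexive (e M₁ M₂ (pathCost k)))
   where
   e : ∀ a b c → a + b + (2 * (a * c) + 2 * (b * c)) ≡ (a + b) * (1 + 2 * c)
   e = solve-∀

 byDepth-step : ∀ M₁ M₂ k → 1 ≤ M₁ + M₂ → 1 + (2 * byDepth M₁ k + 2 * byDepth M₂ k) ≤ byDepth (M₁ + M₂) (suc k)
 byDepth-step M₁ M₂ k pos = ≤-trans (s≤s (+-mono-≤ (*-monoʳ-≤ 2 (le M₁)) (*-monoʳ-≤ 2 (le M₂)))) (top M₁ M₂ pos)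
   where
   le : ∀ M → byDepth M k ≤ treeCost k
   le zero    = z≤n
   le (suc M) = ≤-refl
   e : ∀ c → 1 + (2 * c + 2 * c) ≡ 1 + 4 * c
   e = solve-∀
   top : ∀ M₁ M₂ → 1 ≤ M₁ + M₂ → 1 + (2 * treeCost k + 2 * treeCost k) ≤ byDepth (M₁ + M₂) (suc k)
   top (suc M₁) M₂       _ = ≤-reflexive (e (treeCost k))
   top zero     (suc M₂) _ = ≤-reflexive (e (treeCost k))

 module _ (St : Setting) (Ex₀ CutL : List (Setting.X St)) (E₀ : List (Setting.X St × Bool)) (Rs : List (List (Setting.X St))) (kk : ℕ)
   (Pd : List (Setting.X St × Bool)) where
   open Setting St
   open Phase St Ex₀ CutL E₀

   record ExploreData : Set where
     field
       cost      : ℕ → ℕ → ℕ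
       cost-0    : ∀ k → cost 0 k ≡ 0
       cost-pos  : ∀ M k → 1 ≤ cost (suc M) k
       cost-step : ∀ M₁ M₂ k → 1 ≤ M₁ + M₂ → 1 + (2 * cost M₁ k + 2 * cost M₂ k) ≤ cost (M₁ + M₂) (suc k)
       D cap k p : ℕ
       Qs        : List (Conf X)
       hd        : X × Bool
       1≤Qs      : 1 ≤ length Qs
       1≤n       : 1 ≤ n
       few-bad   : 2 * (D * (3 * (cap + length Ex₀) + length (concat Rs))) ≤ n
       half      : 2 * (cap + length Ex₀) ≤ n
       few-cat   : 4 * (D * ((1 + length (nb CutL ++ map proj₁ Pd)) * cost (length Qs) k)) ≤ n
       cap-ok    : 4 * cost (length Qs) k ≤ cap

   module Explored (ED : ExploreData) where
     open ExploreData ED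

     Ct : List X
     Ct = nb CutL ++ map proj₁ Pd
     mass₀ Λ : ℕ
     mass₀ = length Qs * 2 ^ k
     Λ = 1 + length Ct

     open Tree St Ex₀ CutL E₀ Rs kk Pd

     private
       e₁ : ∀ D n B → 2 * (2 * D * n * B) ≡ 2 * n * (2 * (D * B))
       e₁ = solve-∀
       e₁′ : ∀ n → 2 * n * n ≡ n * (2 * n)
       e₁′ = solve-∀
       e₂ : ∀ D n m c → 2 * (2 * D * n * (m * c)) ≡ n * (4 * D * (m * c))
       e₂ = solve-∀
       e₃ : ∀ D n m → 2 * D * n * m ≡ D * m * n + D * m * n
       e₃ = solve-∀

     loopData : LoopData
     loopData = record
       { cost = cost ; cost-0 = cost-0 ; cost-pos = cost-pos ; cost-step = cost-step
       ; Ct = Ct ; nb⊆Ct = ∈-++⁺ˡ ; Pd⊆Ct = ∈-++⁺ʳ (nb CutL) ; cap = cap ; mass₀ = mass₀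
       ; b = D * mass₀ * n ; α = p * mass₀ * n ; β = 2 * D * n ; β′ = 2 * n ; β″ = 4 * D * (mass₀ * Λ)
       ; few-bad = ≤-trans (≤-reflexive (e₁ D n _)) (≤-trans (*-monoʳ-≤ (2 * n) few-bad) (≤-reflexive (e₁′ n)))
       ; half = half ; few-cat = ≤-reflexive (e₂ D n mass₀ Λ)
       ; b≤ = ≤-trans (m≤m+n (D * mass₀ * n) (D * mass₀ * n)) (≤-reflexive (sym (e₃ D n mass₀))) }

     module Lp = Loop loopData

     -- Markov's inequality: since `β = 2 * D * n`, a state with half the mass dead has a trivial
     -- bound. The root potential charges `2 * k / D` for bad hits over `k` generations and `1 / D`
     -- for catastrophes and hits on pending half-edges.
     explore : ∀ {s} → State s [] (item hd k Qs ∷ []) [] →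
       (∀ {s Nw lv} → State s Nw [] lv → length Nw + 4 * length lv ≤ cap → mass₀ ≤ 2 * ∑ lv mass → D * cnt s ≤ p * W s) →
       D * cnt s ≤ (p + (2 * k + 1)) * W s
     explore {s} st final = *-cancelˡ-≤ (mass₀ * n) {{>-nonZero (*-mono-≤ (*-mono-≤ 1≤Qs (2^≥1 k)) 1≤n)}} (begin
       mass₀ * n * (D * cnt s)                  ≡⟨ e₄ mass₀ n D (cnt s) ⟩
       D * mass₀ * n * cnt s                    ≤⟨ Lp.loop fin (∑ (root ∷ []) Lp.cst) (root ∷ []) ≤-refl st small total ⟩
       Lp.potential fin 0 (root ∷ []) * W s   ≤⟨ *-monoˡ-≤ (W s) pot ⟩
       mass₀ * n * (p + (2 * k + 1)) * W s      ≡⟨ *-assoc (mass₀ * n) _ (W s) ⟩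
       mass₀ * n * ((p + (2 * k + 1)) * W s)    ∎)
       where
       open ≤-Reasoning
       root = item hd k Qs
       c = cost (length Qs) k
       e₄ : ∀ m n D c → m * n * (D * c) ≡ D * m * n * c
       e₄ = solve-∀
       small : 0 + 4 * (c + 0 + 0) ≤ cap
       small = ≤-trans (≤-reflexive (cong (4 *_) (trans (+-identityʳ (c + 0)) (+-identityʳ c)))) cap-ok
       total : mass₀ + 0 + 0 + 0 ≡ mass₀
       total = trans (+-identityʳ _) (trans (+-identityʳ _) (+-identityʳ _))
       fin : ∀ {s Nw lv dead} → State s Nw [] lv → length Nw + 4 * length lv ≤ cap → ∑ lv mass + dead ≡ mass₀ →
         D * mass₀ * n * cnt s ≤ (p * mass₀ * n + 2 * D * n * dead) * W s
       fin {s} {Nw} {lv} {dead} st small eq with mass₀ ≤? 2 * ∑ lv mass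
       ... | yes le = begin
         D * mass₀ * n * cnt s                        ≡⟨ sym (e₄ mass₀ n D (cnt s)) ⟩
         mass₀ * n * (D * cnt s)                      ≤⟨ *-monoʳ-≤ (mass₀ * n) (final st small le) ⟩
         mass₀ * n * (p * W s)                        ≡⟨ e₄ mass₀ n p (W s) ⟩
         p * mass₀ * n * W s                          ≤⟨ *-monoˡ-≤ (W s) (m≤m+n (p * mass₀ * n) _) ⟩
         (p * mass₀ * n + 2 * D * n * dead) * W s     ∎
       ... | no ¬le = begin
         D * mass₀ * n * cnt s                        ≤⟨ *-monoʳ-≤ (D * mass₀ * n) (cnt≤W s) ⟩
         D * mass₀ * n * W s                          ≤⟨ *-monoˡ-≤ (W s) (≤-trans (≤-trans (≤-reflexive (e₅ D mass₀ n)) (≤-trans (*-monoʳ-≤ (D * n) dead-big) (≤-reflexive (e₆ D n dead)))) (m≤n+m _ (p * mass₀ * n))) ⟩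
         (p * mass₀ * n + 2 * D * n * dead) * W s     ∎
         where
         e₅ : ∀ D m n → D * m * n ≡ D * n * m
         e₅ = solve-∀
         e₆ : ∀ D n d → D * n * (2 * d) ≡ 2 * D * n * d
         e₆ = solve-∀
         dead-big : mass₀ ≤ 2 * dead
         dead-big = +-cancelˡ-≤ (2 * ∑ lv mass) mass₀ (2 * dead) (≤-trans (+-monoˡ-≤ mass₀ (<⇒≤ (≰⇒> ¬le)))
           (≤-reflexive (trans (cong (λ z → z + z) (sym eq)) (e₇ (∑ lv mass) dead))))
           where
           e₇ : ∀ a d → a + d + (a + d) ≡ 2 * a + 2 * d
           e₇ = solve-∀
       pot : Lp.potential fin 0 (root ∷ []) ≤ mass₀ * n * (p + (2 * k + 1))
       pot = begin
         p * mass₀ * n + 2 * D * n * 0 + 2 * n * (k * mass₀ + 0) + 4 * D * (mass₀ * Λ) * (c + 0)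
           ≡⟨ e₈ p mass₀ n D k Λ c ⟩
         mass₀ * n * (p + 2 * k) + mass₀ * (4 * (D * (Λ * c)))
           ≤⟨ +-monoʳ-≤ (mass₀ * n * (p + 2 * k)) (*-monoʳ-≤ mass₀ few-cat) ⟩
         mass₀ * n * (p + 2 * k) + mass₀ * n
           ≡⟨ e₉ (mass₀ * n) p k ⟩
         mass₀ * n * (p + (2 * k + 1)) ∎
         where
         e₈ : ∀ p m n D k Λ c → p * m * n + 2 * D * n * 0 + 2 * n * (k * m + 0) + 4 * D * (m * Λ) * (c + 0) ≡ m * n * (p + 2 * k) + m * (4 * (D * (Λ * c)))
         e₈ = solve-∀
         e₉ : ∀ t p k → t * (p + 2 * k) + t ≡ t * (p + (2 * k + 1))
         e₉ = solve-∀

-- Merging the small cycles into the big one.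

module CycleMerging where

 open ListTools
 open ExposureOracle
 open PathRotation
 open RotationSetting
 open TreeExploration
 open ClosingTrials
 open RootedExploration

 module _ (St : Setting) where
   open Setting St

   module _ {Ex₀ CutL : List X} {E₀ : List (X × Bool)} {Rs : List (List X)} {kk : ℕ}
     (TD : TrialData St Ex₀ CutL E₀ Rs kk) where
     open TrialData TD
     open Trials St Ex₀ CutL E₀ Rs kk TD

     -- With `S₀ = 4 * n * G ^ (kmax + 1)` and total `Y ≥ S₀ * D`, all trials fail with probability
     -- at most `S₀ / (S₀ + Y) ≤ 1 / D`; catastrophes cost another `1 / D`, hence `p + 2`.
     finish : ∀ {lv s Nw} Λ → 1 ≤ n → 4 * n * G ^ (kmax + 1) * D ≤ ∑ lv eff → 3 * length CutL + length lv ≤ Λ →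
       2 * (Λ * D) * ((kmax + 2) * length lv) ≤ n → Tst s Nw lv → Unique (map hed lv) → All (λ it → depth it ≡ 0) lv →
       length Nw + 4 * (kmax + 2) * length lv ≤ capT → D * cnt s ≤ (p + 2) * W s
     finish {lv} {s} {Nw} Λ 1≤n big Λ≤ θ≤ t uq flat small =
       *-cancelˡ-≤ (Z * n) {{>-nonZero (*-mono-≤ 1≤Z 1≤n)}} (begin
         Z * n * (D * cnt s)                     ≡⟨ e₁ Z n D (cnt s) ⟩
         Z * (D * n) * cnt s                     ≤⟨ trials S₀ θ Λ Y ≤-refl ≤-refl lv ≤-refl Λ≤ t uq flat small ⟩
         ((p * Z + S₀ * D) * n + θ * ((kmax + 2) * length lv)) * W s
           ≤⟨ *-monoˡ-≤ (W s) (+-mono-≤ (*-monoˡ-≤ n (+-monoʳ-≤ (p * Z) (≤-trans big (m≤n+m Y S₀)))) θ-le) ⟩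
         ((p * Z + Z) * n + Z * n) * W s         ≡⟨ e₂ p Z n (W s) ⟩
         Z * n * ((p + 2) * W s)                 ∎)
       where
       open ≤-Reasoning
       Y = ∑ lv eff
       S₀ = 4 * n * G ^ (kmax + 1)
       Z = S₀ + Y
       θ = 2 * (Λ * (Z * D))
       1≤Z : 1 ≤ Z
       1≤Z = ≤-trans (*-mono-≤ (≤-trans 1≤n (m≤m+n n _)) (m^n>0 G {{>-nonZero 1≤G}} (kmax + 1))) (m≤m+n S₀ Y)
       e₁ : ∀ Z n D c → Z * n * (D * c) ≡ Z * (D * n) * c
       e₁ = solve-∀
       e₂ : ∀ p Z n w → ((p * Z + Z) * n + Z * n) * w ≡ Z * n * ((p + 2) * w)
       e₂ = solve-∀
       e₃ : ∀ l Z D k → 2 * (l * (Z * D)) * k ≡ Z * (2 * (l * D) * k)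
       e₃ = solve-∀
       θ-le : θ * ((kmax + 2) * length lv) ≤ Z * n
       θ-le = ≤-trans (≤-reflexive (e₃ Λ Z D _)) (*-monoʳ-≤ Z θ≤)

   -- `growth` bounds the vertices newly touched by one merge, the 2 being the ends of the cut
   -- cycle. `loss / D` is the failure bound of one merge, added up from the trials and the two
   -- trees.
   record MergeData : Set where
     field
       _≟F_  : (f g : F) → Dec (f ≡ g)
       h     : ℕ
       orbit : ∀ d f g → ∃ λ i → i < h × iter (go₁ d) (suc i) f ≡ g
       kmax  : ℕ
       reach : ∀ η f g → ∃ λ word → length word ≤ kmax × walk St η f word ≡ g
       fibs  : List F
       fibs-complete : ∀ f → f ∈ fibs
       D L Lh G dA dB cutN runN capX : ℕ
     capA : ℕ
     capA = 4 * pathCost dA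
     capB : ℕ
     capB = 4 * treeCost dB
     capT : ℕ
     capT = capB * (kmax + 3)
     capE : ℕ
     capE = capT + 3 * cutN
     growth : ℕ
     growth = capT + capA + 2
     loss : ℕ
     loss = 2 + (2 * dB + 1) + (2 * dA + 1)
     field
       1≤n      : 1 ≤ n
       1≤D      : 1 ≤ D
       1≤G      : 1 ≤ G
       bad-ok   : 2 * (D * (3 * (capA + capT + capX) + runN)) ≤ n
       cat-ok   : 4 * (D * ((3 * cutN + 2) * (pathCost dA + treeCost dB))) ≤ n
       L-big    : Lh + 3 * (capT + capX + cutN) ≤ L
       n≤GL     : n ≤ G * Lh
       trial-ok : 2 * ((3 * cutN + capB) * D) * ((kmax + 2) * capB) ≤ n
       mass-ok  : 2 * (4 * n * G ^ (kmax + 1) * D + 4 * capE * capB) * (2 * length (cartesianProduct fibs (true ∷ false ∷ []))) ≤ 2 ^ dA * 2 ^ dB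

   module WithData (MD : MergeData) where
     open MergeData MD

     classes : List (F × Bool)
     classes = cartesianProduct fibs (true ∷ false ∷ [])

     ∈-classes : ∀ f c → (f , c) ∈ classes
     ∈-classes f true  = ∈-cartesianProduct⁺ (fibs-complete f) (here refl)
     ∈-classes f false = ∈-cartesianProduct⁺ (fibs-complete f) (there (here refl))

     bad-le : ∀ {cap e r} → cap ≤ capA + capT → e ≤ capX → r ≤ runN → 2 * (D * (3 * (cap + e) + r)) ≤ n
     bad-le a b c = ≤-trans (*-monoʳ-≤ 2 (*-monoʳ-≤ D (+-mono-≤ (*-monoʳ-≤ 3 (+-mono-≤ a b)) c))) bad-ok

     half-le : ∀ {cap e} → cap ≤ capA + capT → e ≤ capX → 2 * (cap + e) ≤ n
     half-le {cap} {e} a b = ≤-trans (*-monoʳ-≤ 2 (≤-trans (m≤m+n (cap + e) _) (≤-trans (m≤m+n (3 * (cap + e)) 0)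
       (≤-trans (≤-reflexive (sym (*-identityˡ _))) (*-monoˡ-≤ _ 1≤D))))) (bad-le {cap} {e} {0} a b z≤n)

     capB≤capT : capB ≤ capT
     capB≤capT = ≤-trans (≤-reflexive (sym (*-identityʳ capB))) (*-monoʳ-≤ capB (≤-trans (s≤s z≤n) (m≤n+m 3 kmax)))

     cat-le : ∀ {l c} → l ≤ 3 * cutN + 1 → c ≤ pathCost dA + treeCost dB → 4 * (D * ((1 + l) * c)) ≤ n
     cat-le a b = ≤-trans (*-monoʳ-≤ 4 (*-monoʳ-≤ D (*-mono-≤ (≤-trans (s≤s a) (≤-reflexive (e cutN))) b))) cat-ok
       where
       e : ∀ c → 1 + (3 * c + 1) ≡ 3 * c + 2
       e = solve-∀

     -- Each merge consumes one run R₀ that brings in the big cycle and one run Rm that corrects the fibre.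
     data Runs : ℕ → List (List X) → Set where
       none : ∀ {Rs} → Runs 0 Rs
       more : ∀ {j R₀ Rm Rs} → RunOf St false R₀ → RunOf St false Rm → 1 + L * h ≤ length R₀ → kmax * (1 + L * h) ≤ length Rm →
         Runs j Rs → Runs (suc j) (R₀ ∷ Rm ∷ Rs)

     -- The start of the second tree: all paths have head `b`, and their distinct stored ends share
     -- fibre and direction, so that one word and one closing exposure serve a whole family.
     record Second (s : S) (Ex₀ CutL : List X) (R₀ Rm : List X) (Rs : List (List X)) (kk p : ℕ) (Qs : List (Conf X)) (b : X) : Set where
       open Phase St Ex₀ CutL (map end Qs)
       field
         inv     : Inv s [] []
         b∈      : b ∈ Ex₀
         b-fr    : Fresh s b true
         good    : All (λ Q → Good (K s []) b Q × Located (R₀ ∷ Rm ∷ Rs) kk Q) Qs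
         uends   : Unique (map end Qs)
         dir     : Bool
         fibre₀  : F
         class   : ∀ {e} → e ∈ map end Qs → proj₂ e ≡ dir × fib (proj₁ e) ≡ fibre₀ × proj₁ e ∈ Ex₀
         many    : 2 ^ dA ≤ 2 * (length classes * length Qs)
         runs-unique : Unique (R₀ ++ Rm ++ concat Rs)
         R₀-run  : RunOf St false R₀
         Rm-run  : RunOf St false Rm
         R₀-len  : 1 + L * h ≤ length R₀
         Rm-len  : kmax * (1 + L * h) ≤ length Rm
         Ex-small  : length Ex₀ ≤ capX
         Cut-small : length CutL ≤ cutN
         runs-small : length (concat (R₀ ∷ Rm ∷ Rs)) ≤ runN
         closing : ∀ {s Nw big cs} → Inv s Nw [] → length Nw ≤ capT → Closed (K s Nw) big → All (Closed (K s Nw)) cs →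
           big ++ concat cs ↭ allX → All (_⊑± big) Rs → All CutIn cs → length cs < kk → D * cnt s ≤ p * W s

     module SecondPhase {s Ex₀ CutL R₀ Rm Rs kk p Qs b} (sec : Second s Ex₀ CutL R₀ Rm Rs kk p Qs b) where
       open Second sec
       E₀ = map end Qs
       open Phase St Ex₀ CutL E₀ using (nb; length-nb)
       open Tree St Ex₀ CutL E₀ (R₀ ∷ Rm ∷ Rs) kk [] using (State)

       1≤Qs : 1 ≤ length Qs
       1≤Qs = pos (length Qs) many
         where
         pos : ∀ q → 2 ^ dA ≤ 2 * (length classes * q) → 1 ≤ q
         pos zero le = ⊥-elim (1+n≰n (≤-trans (2^≥1 dA) (≤-trans le (≤-reflexive (cong (2 *_) (*-zeroʳ (length classes)))))))
         pos (suc q) _ = s≤s z≤n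

       cost≡ : byDepth (length Qs) dB ≡ treeCost dB
       cost≡ = h′ (length Qs) 1≤Qs
         where
         h′ : ∀ M → 1 ≤ M → byDepth M dB ≡ treeCost dB
         h′ (suc M) _ = refl

       exploreData : ExploreData St Ex₀ CutL E₀ (R₀ ∷ Rm ∷ Rs) kk []
       exploreData = record
         { cost = byDepth ; cost-0 = λ _ → refl ; cost-pos = λ _ k → 1≤treeCost k ; cost-step = byDepth-step
         ; D = D ; cap = capB ; k = dB ; p = p + 2 ; Qs = Qs ; hd = b , true ; 1≤Qs = 1≤Qs ; 1≤n = 1≤n
         ; few-bad = bad-le (≤-trans capB≤capT (m≤n+m capT capA)) Ex-small runs-small
         ; half = half-le (≤-trans capB≤capT (m≤n+m capT capA)) Ex-small
         ; few-cat = cat-le (≤-trans (≤-reflexive (trans (length-++ (nb CutL)) (trans (+-identityʳ _) (length-nb CutL))))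
             (≤-trans (*-monoʳ-≤ 3 Cut-small) (m≤m+n (3 * cutN) 1))) (≤-trans (≤-reflexive cost≡) (m≤n+m (treeCost dB) (pathCost dA)))
         ; cap-ok = ≤-reflexive (cong (4 *_) cost≡) }

       trialData : TrialData St Ex₀ CutL E₀ Rs kk
       trialData = record
         { _≟F_ = _≟F_ ; h = h ; orbit = orbit ; kmax = kmax ; reach = reach ; R₀ = R₀ ; Rm = Rm
         ; runs-unique = runs-unique ; R₀-run = R₀-run ; Rm-run = Rm-run ; L = L ; Lh = Lh ; G = G
         ; capT = capT ; capE = capE ; D = D ; p = p ; capE-ok = +-monoʳ-≤ capT (*-monoʳ-≤ 3 Cut-small)
         ; R₀-len = R₀-len ; Rm-len = Rm-len
         ; L-big = ≤-trans (+-monoʳ-≤ Lh (*-monoʳ-≤ 3 (+-mono-≤ (+-monoʳ-≤ capT Ex-small) Cut-small))) L-big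
         ; n≤GL = n≤GL ; 1≤G = 1≤G ; half = half-le (m≤n+m capT capA) Ex-small
         ; dA = dir ; u = fibre₀ ; E₀-class = class ; closing = closing }

       open Trials St Ex₀ CutL E₀ Rs kk trialData using (eff)

       eff-sum : ∀ lv → All (λ it → depth it ≡ 0) lv → ∑ lv mass ≤ ∑ lv eff + length lv * (4 * capE)
       eff-sum [] [] = z≤n
       eff-sum (item _ .0 cs ∷ lv) (refl ∷ fl) = ≤-trans (+-mono-≤ (≤-trans (≤-reflexive (*-identityʳ (length cs))) (m≤n+m∸n (length cs) (4 * capE))) (eff-sum lv fl))
         (≤-reflexive (e (4 * capE) (length cs ∸ 4 * capE) (∑ lv eff) (length lv)))
         where
         e : ∀ c a t l → c + a + (t + l * c) ≡ a + t + (1 + l) * c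
         e = solve-∀

       -- At most `capB` leaves lose `4 * capE` each, and at least half of the mass survives;
       -- `mass-ok` leaves enough of it for `finish`.
       done : ∀ {s Nw lv} → State s Nw [] lv → length Nw + 4 * length lv ≤ capB → length Qs * 2 ^ dB ≤ 2 * ∑ lv mass →
         D * cnt s ≤ (p + 2) * W s
       done {s} {Nw} {lv} st small heavy = finish trialData {lv} {s} {Nw} (3 * cutN + capB) 1≤n
         big (+-mono-≤ (*-monoʳ-≤ 3 Cut-small) lv≤) (≤-trans (*-monoʳ-≤ (2 * ((3 * cutN + capB) * D)) (*-monoʳ-≤ (kmax + 2) lv≤)) trial-ok)
         (State.inv st , State.okL st) (State.uniq st) (State.flat st) room
         where
         open ≤-Reasoning
         lv≤ : length lv ≤ capB
         lv≤ = ≤-trans (m≤m+n (length lv) _) (≤-trans (m≤n+m (4 * length lv) (length Nw)) small)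
         room : length Nw + 4 * (kmax + 2) * length lv ≤ capT
         room = begin
           length Nw + 4 * (kmax + 2) * length lv         ≡⟨ cong (length Nw +_) (e₁ kmax (length lv)) ⟩
           length Nw + 4 * length lv * (kmax + 2)         ≤⟨ +-mono-≤ (≤-trans (m≤m+n (length Nw) _) small) (*-monoˡ-≤ (kmax + 2) (≤-trans (m≤n+m (4 * length lv) (length Nw)) small)) ⟩
           capB + capB * (kmax + 2)                       ≡⟨ e₂ capB kmax ⟩
           capB * (kmax + 3) ∎
           where
           e₁ : ∀ k l → 4 * (k + 2) * l ≡ 4 * l * (k + 2)
           e₁ = solve-∀
           e₂ : ∀ c k → c + c * (k + 2) ≡ c * (k + 3)
           e₂ = solve-∀
         T : ℕ
         T = 4 * n * G ^ (kmax + 1) * D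
         C : ℕ
         C = length classes
         1≤C : 1 ≤ C
         1≤C = ∈-length (∈-classes fibre₀ true)
         big : T ≤ ∑ lv eff
         big = +-cancelʳ-≤ (4 * capE * capB) T (∑ lv eff) (*-cancelˡ-≤ (4 * C) {{>-nonZero (*-mono-≤ (s≤s (z≤n {3})) 1≤C)}} (begin
           4 * C * (T + 4 * capE * capB)                 ≡⟨ e₁ C (T + 4 * capE * capB) ⟩
           2 * (T + 4 * capE * capB) * (2 * C)           ≤⟨ mass-ok ⟩
           2 ^ dA * 2 ^ dB                               ≤⟨ *-monoˡ-≤ (2 ^ dB) many ⟩
           2 * (C * length Qs) * 2 ^ dB                  ≡⟨ e₂ C (length Qs) (2 ^ dB) ⟩
           2 * C * (length Qs * 2 ^ dB)                  ≤⟨ *-monoʳ-≤ (2 * C) heavy ⟩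
           2 * C * (2 * ∑ lv mass)                       ≡⟨ e₃ C (∑ lv mass) ⟩
           4 * C * ∑ lv mass                             ≤⟨ *-monoʳ-≤ (4 * C) (≤-trans (eff-sum lv (State.flat st)) (+-monoʳ-≤ (∑ lv eff) (≤-trans (*-monoˡ-≤ (4 * capE) lv≤) (≤-reflexive (*-comm capB (4 * capE)))))) ⟩
           4 * C * (∑ lv eff + 4 * capE * capB) ∎))
           where
           e₁ : ∀ c t → 4 * c * t ≡ 2 * t * (2 * c)
           e₁ = solve-∀
           e₂ : ∀ c q t → 2 * (c * q) * t ≡ 2 * c * (q * t)
           e₂ = solve-∀
           e₃ : ∀ c t → 2 * c * (2 * t) ≡ 4 * c * t
           e₃ = solve-∀

       secondPhase : D * cnt s ≤ (p + 2 + (2 * dB + 1)) * W s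
       secondPhase = Explored.explore St Ex₀ CutL E₀ (R₀ ∷ Rm ∷ Rs) kk [] exploreData root done
         where
         root : State s [] (item (b , true) dB Qs ∷ []) []
         root = record
           { inv = inv
           ; okW = record { hed∈ = b∈ ; hed-fr = b-fr ; hed∉ = λ () ; good = good ; ends = λ i → i ; uends = uends } ∷ []
           ; okL = [] ; uniq = unique-∷ (λ ()) [] ; busy = 1≤Qs ∷ [] ; flat = [] }

     -- `K` depends on the phase only through the excluded vertices, so this form carries known
     -- edges from one phase to the next.
     Kx : S → List X → X → X → Set
     Kx s Ex = Phase.K St Ex [] [] s []

     Cutting : List X → List X → Set
     Cutting CutL = Phase.CutIn St [] CutL []

     -- There is a pair of runs for each merge that may remain (`few`), and `capX` still has room
     -- for the vertices that these merges will touch.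
     record Merging (j : ℕ) (s : S) (Ex CutL : List X) (Rs : List (List X)) (big : List X) (cs : List (List X)) : Set where
       field
         fresh  : ∀ z → z ∉ Ex → ∀ c → Fresh s z c
         cut    : ∀ {z} → z ∈ CutL → z ∉ Ex
         big-closed : Closed (Kx s Ex) big
         cs-closed  : All (Closed (Kx s Ex)) cs
         cover  : big ++ concat cs ↭ allX
         runs   : Runs j Rs
         runs-unique : Unique (concat Rs)
         in-big : All (_⊑± big) Rs
         cuts   : All (Cutting CutL) cs
         few    : length cs ≤ j
         Ex-small   : length Ex + j * growth ≤ capX
         Cut-small  : length CutL ≤ cutN
         runs-small : length (concat Rs) ≤ runN

     module FirstPhase {j s Used CutL R₀ Rm Rs big rest x mid b}
       (mg : Merging (suc j) s Used CutL (R₀ ∷ Rm ∷ Rs) big ((x ∷ mid ++ [ b ]) ∷ rest)) (x∈C : x ∈ CutL) (b∈C : b ∈ CutL) {p : ℕ}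
       (ih : ∀ {s Used CutL big cs} → Merging j s Used CutL Rs big cs → D * cnt s ≤ p * W s) where
       open Merging mg renaming (cover to cover₀; fresh to fresh₀; cut to cut₀)
       C : List X
       C = x ∷ mid ++ [ b ]
       Ex₁ : List X
       Ex₁ = x ∷ b ∷ Used
       -- The half-edge from which the second tree will grow. It serves both as the stored end and
       -- as the protected set, so that it is still fresh when the first tree is complete.
       E₁ : List (X × Bool)
       E₁ = (b , true) ∷ []
       allRuns : List (List X)
       allRuns = R₀ ∷ Rm ∷ Rs
       _∈X?_ : (z : X) (l : List X) → Dec (z ∈ l)
       _∈X?_ = OracleLemmas._∈?_ oracle
       keep : ∀ z → Dec (z ∉ x ∷ b ∷ [])
       keep z = ¬? (z ∈X? (x ∷ b ∷ []))
       CutL₁ : List X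
       CutL₁ = filter keep CutL
       open Phase St Ex₁ CutL₁ E₁
       open Tree St Ex₁ CutL₁ E₁ allRuns (suc j) E₁ using (State; ItemOK)

       all-uniq : Unique (big ++ C ++ concat rest)
       all-uniq = unique-↭ (↭-sym cover₀) all-unique

       x∈Cyc : ∀ {z} → z ∈ x ∷ b ∷ [] → z ∈ C
       x∈Cyc (here refl) = here refl
       x∈Cyc (there (here refl)) = there (∈-++⁺ʳ mid (here refl))

       -- The cycles are disjoint, so giving up `x` and `b` takes no reserved end from another
       -- cycle.
       kept-cut : ∀ {c z} → c ∈ rest → z ∈ c → z ∈ CutL → z ∈ CutL₁
       kept-cut c∈ z∈c z∈ = ∈-filter⁺ keep z∈ (λ i → unique-disj C (unique-++ʳ big all-uniq) (x∈Cyc i) (∈-concat⁺′ z∈c c∈))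

       rest-cuts : All CutIn rest
       rest-cuts = All.tabulate (λ {c} c∈ → recut c∈ (All.lookup (All.tail cuts) c∈))
         where
         recut : ∀ {c} → c ∈ rest → Cutting CutL c → CutIn c
         recut c∈ (x′ , mid′ , b′ , refl , i , i′) = x′ , mid′ , b′ , refl , kept-cut c∈ (here refl) i , kept-cut c∈ (there (∈-++⁺ʳ mid′ (here refl))) i′

       K-up : ∀ {y z} → Kx s Used y z → K s [] y z
       K-up (a , inj₁ d) = a , inj₁ d
       K-up (a , inj₂ (i , i′)) = a , inj₂ (there (there i) , there (there i′))

       Q₀ : Conf X
       Q₀ = conf (b , true) C (big ∷ rest)

       Q₀-good : Good (K s []) x Q₀
       Q₀-good = record
         { head = _ , refl ; last = x ∷ mid , refl
         ; chain = chain-left C {[ x ]} (chain-map K-up (C ++ [ x ]) (All.head cs-closed))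
         ; cycles = closed-map K-up big big-closed ∷ All.map (λ {c} → closed-map K-up c) (All.tail cs-closed)
         ; cover = ↭-trans (shifts C big) cover₀ }

       Q₀-located : Located allRuns (suc j) Q₀
       Q₀-located = inj₂ (big , rest , refl , in-big , rest-cuts , few)

       CutL₁-∉ : ∀ {z} → z ∈ CutL₁ → z ∉ Ex₁
       CutL₁-∉ z∈ (here refl) = proj₂ (∈-filter⁻ keep {xs = CutL} z∈) (here refl)
       CutL₁-∉ z∈ (there (here refl)) = proj₂ (∈-filter⁻ keep {xs = CutL} z∈) (there (here refl))
       CutL₁-∉ z∈ (there (there i)) = cut₀ (proj₁ (∈-filter⁻ keep {xs = CutL} z∈)) i

       b-fresh : Fresh s b true
       b-fresh = fresh₀ b (cut₀ b∈C) true

       inv₀ : Inv s [] E₁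
       inv₀ = record
         { fresh = λ z z∉ c → fresh₀ z (z∉ ∘ there ∘ there) c
         ; kept = λ { (here refl) → inj₁ b-fresh }
         ; cut = CutL₁-∉
         ; prot = λ { (here refl) → there (here refl) , b-fresh } }

       x≢b : x ≢ b
       x≢b refl = unique-head (unique-++ˡ C (unique-++ʳ big all-uniq)) (∈-++⁺ʳ mid (here refl))

       root : State s [] (item (x , true) dA (Q₀ ∷ []) ∷ []) []
       root = record
         { inv = inv₀
         ; okW = record { hed∈ = here refl ; hed-fr = fresh₀ x (cut₀ x∈C) true ; hed∉ = λ { (here e) → x≢b (,-injectiveˡ e) }
                        ; good = (Q₀-good , Q₀-located) ∷ [] ; ends = λ { (here e) → here e } ; uends = unique-∷ (λ ()) [] } ∷ []
         ; okL = [] ; uniq = unique-∷ (λ ()) [] ; busy = s≤s z≤n ∷ [] ; flat = [] }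

       Cut₁-small : length CutL₁ ≤ cutN
       Cut₁-small = ≤-trans (length-filter keep CutL) Cut-small

       Ex-room : length Used + 2 + capA + capT + j * growth ≤ capX
       Ex-room = ≤-trans (≤-reflexive (e (length Used) capA capT (j * growth))) Ex-small
         where
         e : ∀ x a t g → x + 2 + a + t + g ≡ x + (t + a + 2 + g)
         e = solve-∀

       Ex₁-small : length Ex₁ ≤ capX
       Ex₁-small = ≤-trans (≤-reflexive (+-comm 2 (length Used))) (≤-trans (m≤m+n (length Used + 2) _) (≤-trans (≤-reflexive (e (length Used) capA capT (j * growth))) Ex-room))
         where
         e : ∀ x a t g → x + 2 + (a + t + g) ≡ x + 2 + a + t + g
         e = solve-∀

       exploreData : ExploreData St Ex₁ CutL₁ E₁ allRuns (suc j) E₁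
       exploreData = record
         { cost = byMass ; cost-0 = λ _ → refl ; cost-pos = λ M k → ≤-trans (1≤pathCost k) (m≤m+n (pathCost k) (M * pathCost k)) ; cost-step = byMass-step
         ; D = D ; cap = capA ; k = dA ; p = p + 2 + (2 * dB + 1) ; Qs = Q₀ ∷ [] ; hd = x , true ; 1≤Qs = s≤s z≤n ; 1≤n = 1≤n
         ; few-bad = bad-le (m≤m+n capA capT) Ex₁-small runs-small
         ; half = half-le (m≤m+n capA capT) Ex₁-small
         ; few-cat = cat-le (≤-trans (≤-reflexive (trans (length-++ (nb CutL₁)) (cong (_+ 1) (length-nb CutL₁)))) (+-monoˡ-≤ 1 (*-monoʳ-≤ 3 Cut₁-small)))
             (≤-trans (≤-reflexive (*-identityˡ (pathCost dA))) (m≤m+n (pathCost dA) (treeCost dB)))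
         ; cap-ok = ≤-reflexive (cong (4 *_) (*-identityˡ (pathCost dA))) }

       -- After the first tree the free end becomes the stored end and b the active head.
       turn : Item X → Conf X → Conf X
       turn it Q = conf (hed it) (reverse (path Q)) (cycs Q)

       turnAll : List (Item X) → List (Conf X)
       turnAll []        = []
       turnAll (it ∷ lv) = map (turn it) (confs it) ++ turnAll lv

       turn-mass : ∀ {lv} → All (λ it → depth it ≡ 0) lv → length (turnAll lv) ≡ ∑ lv mass
       turn-mass {[]} [] = refl
       turn-mass {item h .0 cs ∷ lv} (refl ∷ fl) = trans (length-++ (map (turn (item h 0 cs)) cs))
         (cong₂ _+_ (trans (length-map _ cs) (sym (*-identityʳ (length cs)))) (turn-mass fl))

       turn-end : ∀ lv {Q} → Q ∈ turnAll lv → end Q ∈ map hed lv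
       turn-end (it ∷ lv) i with ∈-++⁻ (map (turn it) (confs it)) i
       ... | inj₂ j = there (turn-end lv j)
       ... | inj₁ j with ∈-map⁻ (turn it) j
       ...   | _ , _ , refl = here refl

       -- Within an item the stored ends are distinct and all equal to `(b , true)`, so a leaf of
       -- the first tree carries at most one path; distinct leaves have distinct half-edges, which
       -- become the new stored ends.
       turn-unique : ∀ {s Nw} lv → All (ItemOK s Nw) lv → Unique (map hed lv) → Unique (map end (turnAll lv))
       turn-unique [] [] u = []
       turn-unique (it ∷ lv) (ok ∷ oks) u = subst Unique (sym (Data.List.Properties.map-++ end (map (turn it) (confs it)) (turnAll lv)))
         (unique-++⁺ (single (confs it) (ItemOK.uends ok) (ItemOK.ends ok)) (turn-unique lv oks (unique-tail u)) disj)
         where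
         single : ∀ cs → Unique (map end cs) → (∀ {e} → e ∈ map end cs → e ∈ E₁) → Unique (map end (map (turn it) cs))
         single [] _ _ = []
         single (_ ∷ []) _ _ = unique-∷ (λ ()) []
         single (Q ∷ Q′ ∷ cs) uq sub with sub (here refl) | sub (there (here refl))
         ... | here e | here e′ = ⊥-elim (unique-head uq (here (trans e (sym e′))))
         disj : ∀ {z} → z ∈ map end (map (turn it) (confs it)) → z ∉ map end (turnAll lv)
         disj i i′ with ∈-map⁻ end i | ∈-map⁻ end i′
         ... | Q , Q∈ , refl | Q′ , Q′∈ , e with ∈-map⁻ (turn it) Q∈
         ...   | _ , _ , refl = unique-head u (subst (_∈ map hed lv) (sym e) (turn-end lv Q′∈))

       turn-good : ∀ {s Nw} lv → All (ItemOK s Nw) lv → All (λ Q → Good (K s Nw) b Q × Located allRuns (suc j) Q) (turnAll lv)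
       turn-good [] [] = []
       turn-good {s} {Nw} (it ∷ lv) (ok ∷ oks) = AllP.++⁺ (AllP.map⁺ (All.tabulate (λ Q∈ → one Q∈ (All.lookup (ItemOK.good ok) Q∈)))) (turn-good lv oks)
         where
         relocate : ∀ {Q} → Located allRuns (suc j) Q → Located allRuns (suc j) (turn it Q)
         relocate (inj₁ (rs , cs , lt)) = inj₁ (All.map ⊑±-reverse rs , cs , lt)
         relocate (inj₂ w) = inj₂ w
         one : ∀ {Q} → Q ∈ confs it → Good (K s Nw) (proj₁ (hed it)) Q × Located allRuns (suc j) Q →
           Good (K s Nw) b (turn it Q) × Located allRuns (suc j) (turn it Q)
         one {Q} Q∈ (g , l) with ItemOK.ends ok (∈-map⁺ end Q∈)
         ... | here e = subst (λ z → Good (K s Nw) z (turn it Q)) (cong proj₁ e) (good-reverse (proj₂ (hed it)) K-sym g) , relocate {Q} l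

       tip : Conf X → F × Bool
       tip Q = fib (proj₁ (end Q)) , proj₂ (end Q)

       _≟T_ : (f g : F × Bool) → Dec (f ≡ g)
       _≟T_ = ≡-dec _≟F_ Bool._≟_

       -- A closing exposure aims at one fibre in one direction, so only one class of ends, of at
       -- least average size, is kept.
       second : ∀ {s Nw lv} → State s Nw [] lv → length Nw + 4 * length lv ≤ capA → 1 * 2 ^ dA ≤ 2 * ∑ lv mass →
         ∃ λ Qs → Second s (Nw ++ Ex₁) CutL₁ R₀ Rm Rs (suc j) p Qs b
       second {s} {Nw} {lv} st small heavy = Qs , record
         { inv = record
           { fresh = Inv.fresh (State.inv st)
           ; kept = λ {a} {c} i → inj₁ (hed-of i)
           ; cut = Inv.cut (State.inv st)
           ; prot = λ () }
         ; b∈ = proj₁ (Inv.prot (State.inv st) (here refl))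
         ; b-fr = proj₂ (Inv.prot (State.inv st) (here refl))
         ; good = All.tabulate (λ i → All.lookup (turn-good lv (State.okL st)) (sub i))
         ; uends = unique-map-filter (λ Q → tip Q ≟T cl) end all (turn-unique lv (State.okL st) (State.uniq st))
         ; dir = proj₂ cl ; fibre₀ = proj₁ cl
         ; class = class′
         ; many = ≤-trans (≤-reflexive (sym (*-identityˡ (2 ^ dA)))) (≤-trans heavy (*-monoʳ-≤ 2 (≤-trans (≤-reflexive (sym all-len)) (proj₂ ph))))
         ; runs-unique = runs-unique
         ; R₀-run = proj₁ (run-data runs) ; Rm-run = proj₁ (proj₂ (run-data runs))
         ; R₀-len = proj₁ (proj₂ (proj₂ (run-data runs))) ; Rm-len = proj₁ (proj₂ (proj₂ (proj₂ (run-data runs))))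
         ; Ex-small = ≤-trans (≤-trans (≤-reflexive (length-++ Nw)) (+-monoˡ-≤ (length Ex₁) Nw≤)) (≤-trans (m≤m+n _ (capT + j * growth)) (≤-trans (≤-reflexive (e₁ capA (length Used) capT (j * growth))) Ex-room))
         ; Cut-small = Cut₁-small
         ; runs-small = runs-small
         -- Both trees, the trials and the ends `x`, `b` together stay within one `growth`; the
         -- closed path is the new big cycle.
         ; closing = λ {s′} {Nw′} {big′} {cs′} inv′ small′ bc cc cov rs ci lt → ih record
           { fresh = Phase.fresh inv′ ; cut = Phase.cut inv′ ; big-closed = bc ; cs-closed = cc ; cover = cov
           ; runs = proj₂ (proj₂ (proj₂ (proj₂ (run-data runs)))) ; runs-unique = unique-++ʳ Rm (unique-++ʳ R₀ runs-unique)
           ; in-big = rs ; cuts = ci ; few = s≤s⁻¹ lt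
           ; Ex-small = ≤-trans (+-monoˡ-≤ (j * growth) (≤-trans (≤-reflexive (trans (length-++ Nw′) (cong (length Nw′ +_) (length-++ Nw)))) (+-mono-≤ small′ (+-monoˡ-≤ (length Ex₁) Nw≤))))
               (≤-trans (≤-reflexive (e₂ capT capA (length Used) (j * growth))) Ex-room)
           ; Cut-small = Cut₁-small
           ; runs-small = ≤-trans (≤-trans (m≤n+m (length (concat Rs)) (length Rm)) (≤-trans (≤-reflexive (sym (length-++ Rm))) (≤-trans (m≤n+m _ (length R₀)) (≤-reflexive (sym (length-++ R₀)))))) runs-small } }
         where
         Nw≤ : length Nw ≤ capA
         Nw≤ = ≤-trans (m≤m+n (length Nw) _) small
         e₁ : ∀ a x t g → a + (2 + x) + (t + g) ≡ x + 2 + a + t + g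
         e₁ = solve-∀
         e₂ : ∀ t a x g → t + (a + (2 + x)) + g ≡ x + 2 + a + t + g
         e₂ = solve-∀
         run-data : ∀ {j R₀ Rm Rs} → Runs (suc j) (R₀ ∷ Rm ∷ Rs) →
           RunOf St false R₀ × RunOf St false Rm × 1 + L * h ≤ length R₀ × kmax * (1 + L * h) ≤ length Rm × Runs j Rs
         run-data (more a b c d e) = a , b , c , d , e
         all : List (Conf X)
         all = turnAll lv
         all-len : length all ≡ ∑ lv mass
         all-len = turn-mass (State.flat st)
         pos : ∀ q → 1 * 2 ^ dA ≤ 2 * q → 0 < q
         pos zero le = ⊥-elim (1+n≰n (≤-trans (2^≥1 dA) (≤-trans (≤-reflexive (sym (*-identityˡ (2 ^ dA)))) le)))
         pos (suc q) _ = s≤s z≤n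
         ph = pigeonhole-class tip _≟T_ classes all (λ {Q} _ → ∈-classes (fib (proj₁ (end Q))) (proj₂ (end Q)))
           (pos (length all) (subst (λ z → 1 * 2 ^ dA ≤ 2 * z) (sym all-len) heavy))
         cl = proj₁ ph
         Qs : List (Conf X)
         Qs = filter (λ Q → tip Q ≟T cl) all
         sub : ∀ {Q} → Q ∈ Qs → Q ∈ all
         sub i = proj₁ (∈-filter⁻ (λ Q → tip Q ≟T cl) {xs = all} i)
         item-of : ∀ {e} → e ∈ map end Qs → ∃ λ it → it ∈ lv × e ≡ hed it
         item-of i with ∈-map⁻ end i
         ... | Q , Q∈ , refl = ∈-map⁻ hed (turn-end lv (sub Q∈))
         hed-of : ∀ {a c} → (a , c) ∈ map end Qs → Fresh s a c
         hed-of i with item-of i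
         ... | it , it∈ , refl = ItemOK.hed-fr (All.lookup (State.okL st) it∈)
         class′ : ∀ {e} → e ∈ map end Qs → proj₂ e ≡ proj₂ cl × fib (proj₁ e) ≡ proj₁ cl × proj₁ e ∈ Nw ++ Ex₁
         class′ {e} i = proj₂ te , proj₁ te , subst (λ z → proj₁ z ∈ Nw ++ Ex₁) (sym (proj₂ (proj₂ io))) (ItemOK.hed∈ (All.lookup (State.okL st) (proj₁ (proj₂ io))))
           where
           io = item-of i
           te : fib (proj₁ e) ≡ proj₁ cl × proj₂ e ≡ proj₂ cl
           te with ∈-map⁻ end i
           ... | Q , Q∈ , refl with proj₂ (∈-filter⁻ (λ Q → tip Q ≟T cl) {xs = all} Q∈)
           ...   | q = cong proj₁ q , cong proj₂ q

       firstPhase : D * cnt s ≤ (p + loss) * W s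
       firstPhase = subst (λ z → D * cnt s ≤ z * W s) (e p dA dB)
         (Explored.explore St Ex₁ CutL₁ E₁ allRuns (suc j) E₁ exploreData root
           (λ st small heavy → SecondPhase.secondPhase (proj₂ (second st small heavy))))
         where
         e : ∀ p a b → p + 2 + (2 * b + 1) + (2 * a + 1) ≡ p + (2 + (2 * b + 1) + (2 * a + 1))
         e = solve-∀

     -- When no small cycle is left, the big one spans all vertices and `finished` leaves no bad
     -- lift; otherwise the first small cycle is cut and merged at the price `loss`.
     mergeAll : ∀ j {s Ex CutL Rs big cs} → Merging j s Ex CutL Rs big cs → D * cnt s ≤ (j * loss) * W s
     mergeAll j {s} {Ex} {big = big} {[]} mg = ≤-trans (≤-reflexive (trans (cong (D *_)
       (finished s big (closed-map proj₁ big (Merging.big-closed mg)) (↭-trans (↭-reflexive (sym (++-identityʳ big))) (Merging.cover mg)))) (*-zeroʳ D))) z≤n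
     mergeAll zero {cs = c ∷ cs} mg with Merging.few mg
     ... | ()
     mergeAll (suc j) {s} {cs = c ∷ cs} mg with Merging.runs mg | All.head (Merging.cuts mg)
     ... | more _ _ _ _ _ | x , mid , b , refl , x∈ , b∈ = subst (λ z → D * cnt s ≤ z * W s) (+-comm (j * loss) loss)
       (FirstPhase.firstPhase mg x∈ b∈ {j * loss} (λ {s} {Ex} {CutL} {big} {cs} m → mergeAll j m))

-- Exposure along a Hamilton cycle of the base graph.

module HalfEdgeOracle where

 open ListTools
 open LiftCounting
 open ExposureOracle

 LiftAdj-sym : ∀ (G : Graph) {n} (σ : LiftData G n) {x y} → LiftAdj G σ x y → LiftAdj G σ y x
 LiftAdj-sym G σ (e , r) = e , swap r

 not-≡ : ∀ {a b : Bool} → a ≢ b → a ≡ not b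
 not-≡ = ¬-not

 module _ (G : Graph) (n : ℕ) (L : List (LiftData G n)) (liftL : All (IsLift G) L) (uL : Unique L) where
   open Count G n L liftL uL

   Adj-at : S → X → X → Set
   Adj-at s x y = ∀ σ → Cons s σ → LiftAdj G σ x y

   module HalfEdges (H : HamRot G) where
     open HamRot H

     Fresh : S → X → Bool → Set
     Fresh s (u , i) d = ¬ Exposed s (ed d u) (fl d u) i

     go-distinct : ∀ {c d} v → go c v ≡ go d v → c ≡ d
     go-distinct {c} {d} v eq with c ≟ᵇ d
     ... | yes e = e
     ... | no ne = ⊥-elim (go-≢² d v (trans (sym eq) (cong (λ c → go c v) (not-≡ ne))))

     module Reveal (s : S) (u : Fin (V G)) (i : Fin n) (d : Bool) (fr : Fresh s (u , i) d) where
       module Ed = Edge s (ed d u) (fl d u) i fr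

       -- An exposed pair uses up two half-edges only. For a half-edge stored on the same edge, the
       -- flags determine its vertex `v`: `u` if they agree, `go d u` if they differ; `go-distinct`
       -- then fixes its direction.
       transfer : ∀ {j} (j∈ : j ∈ Ed.outs) {z c} → Fresh s z c → ¬ (z ≡ (u , i) × c ≡ d) → ¬ (z ≡ (go d u , j) × c ≡ not d) →
         Fresh (Ed.next j) z c
       transfer {j} j∈ {v , l} {c} f ≢x ≢w ex with subst (λ t → l ∈ map (pr (fl c v)) (t (ed c v))) (Ed.next-≡ j∈) ex
       ... | ex′ with ed c v Fin.≟ ed d u
       ...   | no _ = f ex′
       ...   | yes e≡ with ex′
       ...     | there q = f q
       ...     | here l≡ with fl c v ≟ᵇ fl d u
       ...       | yes b≡ with mk-injective (fl d u) {v} {go c v} (trans (cong (λ b → mk b v (go c v)) (sym b≡)) (trans (sym (ed-ok c v)) (trans (cong (lookup (edges G)) e≡) (ed-ok d u))))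
       ...         | refl , g≡ = ≢x (cong (v ,_) (trans l≡ (trans (cong (λ b → pr b (mk (fl d v) i j)) b≡) (pr-mk (fl d v)))) , go-distinct v g≡)
       transfer {j} j∈ {v , l} {c} f ≢x ≢w ex | ex′ | yes e≡ | here l≡ | no b≢
         with mk-injective (fl d u) {go c v} {v} (trans (sym (mk-not (fl d u))) (trans (cong (λ b → mk b v (go c v)) (sym (not-≡ b≢))) (trans (sym (ed-ok c v)) (trans (cong (lookup (edges G)) e≡) (ed-ok d u)))))
       ...         | g≡ , refl = ≢w (cong (v ,_) (trans l≡ (trans (cong (λ b → pr b (mk (fl d u) i j)) (not-≡ b≢)) (pr-not-mk (fl d u)))) ,
                                    go-distinct v (trans g≡ (sym (go-inv d u))))

       fresh-target : ∀ {j} → j ∈ Ed.outs → Fresh s (go d u , j) (not d)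
       fresh-target {j} j∈ ex = Ed.outs-fresh j∈ (subst₂ (λ e b → j ∈ map (pr b) (proj₁ s e)) (ed-rev d u) (fl-rev d u) ex)

       target-complete : ∀ {j} → Fresh s (go d u , j) (not d) → j ∈ Ed.outs
       target-complete {j} f = Ed.outs-complete (λ ex → f (subst₂ (λ e b → j ∈ map (pr b) (proj₁ s e)) (sym (ed-rev d u)) (sym (fl-rev d u)) ex))

       match-adj : ∀ {j} σ → Match σ (ed d u) (mk (fl d u) i j) → LiftAdj G σ (u , i) (go d u , j)
       match-adj {j} σ mt = ed d u , orient (fl d u) (ed-ok d u) mt
         where
         orient : ∀ b → lookup (edges G) (ed d u) ≡ mk b u (go d u) → Match σ (ed d u) (mk b i j) →
           (lookup (edges G) (ed d u) ≡ (u , go d u) × lookup (lookup σ (ed d u)) i ≡ j) ⊎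
           (lookup (edges G) (ed d u) ≡ (go d u , u) × lookup (lookup σ (ed d u)) j ≡ i)
         orient false eq mt = inj₁ (eq , mt)
         orient true  eq mt = inj₂ (eq , mt)

     exposure : Exposure
     exposure = record
       { X = X ; F = Fin (V G) ; S = S ; _≟_ = _≟X_ ; fib = proj₁ ; n = n ; go = go ; cnt = cnt ; W = W
       ; cnt≤W = cnt≤W ; W-pos = W-pos ; Fresh = Fresh ; Ad = Adj-at ; Ad-sym = λ a σ c → LiftAdj-sym G σ (a σ c) }

     oracle : Oracle
     oracle = record
       { exposure = exposure ; go-inv = go-inv ; query = qry
       ; fibre = λ f → map (f ,_) (allFin n) , Uniq.map⁺ (λ { refl → refl }) (Uniq.allFin⁺ n) ,
           trans (length-map (f ,_) (allFin n)) (length-fins n) , λ i → let (_ , _ , e) = ∈-map⁻ (f ,_) i in cong proj₁ e }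
       where
       qry : ∀ s x d → Fresh s x d → Exposure.Query exposure s x d
       qry s (u , i) d fr = record
         { outs = map (go d u ,_) outs ; next = next ∘ proj₂ ; W′ = w′ outs refl
         ; unique = Uniq.map⁺ (λ { refl → refl }) outs-unique
         ; complete = λ { {_ , j} refl f → ∈-map⁺ (go d u ,_) (target-complete f) }
         ; outcome = λ w∈ → out (∈-map⁻ (go d u ,_) w∈)
         ; cnt-next = ≤-trans cnt-next (≤-reflexive (sym (∑-map outs)))
         ; W-next = λ w∈ → let (j , j∈ , e) = ∈-map⁻ (go d u ,_) w∈ in trans (cong (W ∘ next ∘ proj₂) e) (w′-eq outs refl j∈)
         ; W-split = split outs refl
         ; outs≤n = ≤-trans (≤-reflexive (trans (length-map _ outs) length-outs)) (m∸n≤m n k) }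
         where
         open Reveal s u i d fr
         open Ed
         ∑-map : ∀ js → ∑ (map (go d u ,_) js) (cnt ∘ next ∘ proj₂) ≡ ∑ js (cnt ∘ next)
         ∑-map [] = refl
         ∑-map (j ∷ js) = cong (cnt (next j) +_) (∑-map js)
         -- The common weight is read off at the first outcome; the value 0 for an empty list does
         -- not occur, as `split` shows.
         w′ : ∀ os → os ≡ outs → ℕ
         w′ [] _ = 0
         w′ (j ∷ _) _ = W (next j)
         w′-eq : ∀ os (e : os ≡ outs) {j} → j ∈ outs → W (next j) ≡ w′ os e
         w′-eq [] e {j} j∈ with subst (j ∈_) (sym e) j∈
         ... | ()
         w′-eq (j₀ ∷ os) e j∈ = W-next-const j∈ (subst (j₀ ∈_) e (here refl))
         split : ∀ os (e : os ≡ outs) → W s ≡ length (map (go d u ,_) outs) * w′ os e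
         split [] e = ⊥-elim (<-irrefl (trans (cong length e) length-outs) (m<n⇒0<n∸m k<n))
         split (j₀ ∷ os) e = trans (W-next (subst (j₀ ∈_) e (here refl))) (cong (_* W (next j₀)) (sym (length-map (go d u ,_) outs)))
         out : ∀ {w} → (∃ λ j → j ∈ outs × w ≡ (go d u , j)) → Exposure.Outcome exposure s (u , i) d w (next (proj₂ w))
         out (j , j∈ , refl) = record
           { fib-eq = refl ; fresh-w = fresh-target j∈
           ; adjacent = λ σ c → match-adj σ (next-match j∈ σ c)
           ; Ad-mono = λ a σ c → a σ (next-cons j∈ σ c)
           ; transfer = transfer j∈ }

     rot : ∀ σ → IsLift G σ → Bool → X → X
     rot σ lf d (u , i) = go d u , proj₁ (act σ lf (ed d u) (fl d u) i)

     rot-unique : ∀ σ lf d {u i j} → Match σ (ed d u) (mk (fl d u) i j) → rot σ lf d (u , i) ≡ (go d u , j)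
     rot-unique σ lf d {u} {i} mt = cong (go d u ,_) (match-unique σ lf (ed d u) (fl d u) (proj₂ (act σ lf (ed d u) (fl d u) i)) mt refl)

     rot-inv : ∀ σ lf d x → rot σ lf (not d) (rot σ lf d x) ≡ x
     rot-inv σ lf d (u , i) = trans (rot-unique σ lf (not d)
       (subst₂ (λ e b → Match σ e (mk b j i)) (sym (ed-rev d u)) (sym (fl-rev d u)) (subst (Match σ (ed d u)) (sym (mk-not (fl d u))) mt)))
       (cong (_, i) (go-inv d u))
       where
       j = proj₁ (act σ lf (ed d u) (fl d u) i)
       mt = proj₂ (act σ lf (ed d u) (fl d u) i)

-- The number of cycles in the lift of the first Hamilton cycle.

module FirstHamiltonCycle where

 open ListTools
 open LiftCounting
 open ExposureOracle
 open PathRotation using (concat-mid)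
 open HalfEdgeOracle

 closed-pred : ∀ {A : Set} {K : A → A → Set} c {y} → Closed K c → y ∈ c → ∃ λ z → K z y
 closed-pred {K = K} c {y} cl y∈ with ∈-∃++ y∈
 ... | us , vs , refl with snoc-view y (vs ++ us) | closed-rotate us y vs cl
 ...   | m , z , e | ch = z , chain-mid m {r = []} (subst (Chain K) (trans (cong (y ∷_) (sym (++-assoc vs us [ y ]))) (trans (cong (_++ [ y ]) e) (++-assoc m [ z ] [ y ]))) ch)

 headOr : ∀ {A : Set} → A → List A → A
 headOr x []      = x
 headOr x (y ∷ _) = y

 headOr-eq : ∀ {A : Set} (x : A) t {y vs} → t ++ [ x ] ≡ y ∷ vs → headOr x t ≡ y
 headOr-eq x []      e = ∷-injectiveˡ e
 headOr-eq x (_ ∷ _) e = ∷-injectiveˡ e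

 concat-singletons : ∀ {A : Set} (xs : List A) → concat (map [_] xs) ≡ xs
 concat-singletons []       = refl
 concat-singletons (x ∷ xs) = cong (x ∷_) (concat-singletons xs)

 module _ (G : Graph) (n : ℕ) (L : List (LiftData G n)) (liftL : All (IsLift G) L) (uL : Unique L) where
   open Count G n L liftL uL

   vertices : List X
   vertices = cartesianProduct (allFin (V G)) (allFin n)

   vertices-complete : ∀ x → x ∈ vertices
   vertices-complete (u , i) = ∈-cartesianProduct⁺ (∈-allFin u) (∈-allFin i)

   vertices-unique : Unique vertices
   vertices-unique = Uniq.cartesianProduct⁺ (Uniq.allFin⁺ (V G)) (Uniq.allFin⁺ n)

   unexposed : S
   unexposed = (λ _ → []) , λ _ _ → []

   module _ (H : HamRot G) where
     open HamRot H
     open HalfEdges G n L liftL uL H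

     Succ : S → X → X → Set
     Succ s (u , i) (v , j) = v ≡ go true u × mk (fl true u) i j ∈ proj₁ s (ed true u)

     succ-stale : ∀ {s x y} → Succ s x y → ¬ Fresh s y false
     succ-stale {s} {u , i} {_ , j} (refl , mem) f = f (subst₂ (λ e b → j ∈ map (pr b) (proj₁ s e)) (sym (ed-rev true u)) (sym (fl-rev true u))
       (subst (_∈ map (pr (not (fl true u))) (proj₁ s (ed true u))) (pr-not-mk (fl true u)) (∈-map⁺ (pr (not (fl true u))) mem)))

     -- The exposed part of the first lift as paths and cycles covering all vertices, initially
     -- single vertices. `others` keeps all other edges of `G` unexposed, among them those of the
     -- second Hamilton cycle.
     record Gluing (s : S) (opens closeds : List (List X)) : Set where
       field
         links  : All (Chain (Succ s)) opens
         loops  : All (Closed (Succ s)) closeds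
         tails  : All (λ p → ∃ λ t → ∃ λ x → p ≡ t ++ [ x ] × Fresh s x true) opens
         cover  : concat opens ++ concat closeds ↭ vertices
         others : ∀ e → (∀ u → e ≢ ed true u) → proj₁ s e ≡ []
     open Gluing

     -- 2^(number of closed cycles) * ψ is a martingale: with r ends left, one exposure closes a cycle
     -- for at most one of its r outcomes.
     ψ : S → ℕ
     ψ s = ∏ (λ e → suc (unexp s e))

     module Step {s : S} {u : Fin (V G)} {i : Fin n} (fr : Fresh s (u , i) true) where
       open Reveal s u i true fr public
       open Ed hiding (k) renaming (k<n to exposed<n) public

       mono : ∀ {j} → j ∈ outs → ∀ {x y} → Succ s x y → Succ (next j) x y
       mono {j} j∈ {v , k} {w , l} (e , mem) = e , subst (λ f → mk (fl true v) k l ∈ f (ed true v)) (sym (next-≡ j∈)) grown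
         where
         grown : mk (fl true v) k l ∈ reveal (proj₁ s) (ed true u) (mk (fl true u) i j) (ed true v)
         grown with ed true v Fin.≟ ed true u
         ... | yes _ = there mem
         ... | no _  = mem

       new : ∀ {j} → j ∈ outs → Succ (next j) (u , i) (go true u , j)
       new {j} j∈ = refl , subst (λ f → mk (fl true u) i j ∈ f (ed true u)) (sym (next-≡ j∈))
         (subst (mk (fl true u) i j ∈_) (sym (reveal-≡ (proj₁ s) (ed true u) _)) (here refl))

       keep-fresh : ∀ {j} → j ∈ outs → ∀ {z} → z ≢ (u , i) → Fresh s z true → Fresh (next j) z true
       keep-fresh j∈ ne f = transfer j∈ f (λ e → ne (proj₁ e)) (λ { (_ , ()) })

       keep-others : ∀ {j} → j ∈ outs → ∀ e → (∀ u → e ≢ ed true u) → proj₁ s e ≡ [] → proj₁ (next j) e ≡ []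
       keep-others j∈ e ne eq = trans (cong (λ f → f e) (next-≡ j∈)) (trans (reveal-≢ (proj₁ s) _ (ne u)) eq)

       ψ-next : ∀ {j} → j ∈ outs → length outs * ψ s ≡ suc (length outs) * ψ (next j)
       ψ-next {j} j∈ = ∏-update (ed true u) (length outs) (suc (length outs)) (λ e′ ne → cong suc (unexp-next-≢ j∈ e′ ne))
         (trans (cong₂ _*_ (unexp-next j∈) (cong suc (sym length-outs))) (*-comm (suc (unexp (next j) (ed true u))) (suc (length outs))))

     module _ (A P B : ℕ)
       (final : ∀ {s closeds} → Gluing s [] closeds → A * cnt s ≤ (P + B * 2 ^ length closeds) * W s) where

       Bound : S → ℕ → Set
       Bound s c = A * cnt s ≤ (P + B * 2 ^ c * ψ s) * W s

       -- Among the `r` outcomes at most one, the head of the same path, doubles `2 ^ c`, so the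
       -- mean grows by at most `(r + 1) / r`, and `ψ` falls by exactly this factor.
       glue : ∀ k {s opens closeds} → length opens ≤ k → Gluing s opens closeds → Bound s (length closeds)
       glue k {s} {[]} {closeds} le g = ≤-trans (final g) (*-monoˡ-≤ (W s) (+-monoʳ-≤ P (≤-trans (≤-reflexive (sym (*-identityʳ _)))
         (*-monoʳ-≤ (B * 2 ^ length closeds) (∏-pos _ (λ e → s≤s (z≤n {unexp s e})))))))
       glue (suc k) {s} {_ ∷ ps} {closeds} (s≤s le) g with All.head (tails g)
       -- `r * suc r` clears the denominators: `r` from `W-next` and `r + 1` from `ψ-next`.
       ... | t , (u , i) , refl , fr = *-cancelˡ-≤ (r * suc r) {{>-nonZero (*-mono-≤ r>0 (s≤s (z≤n {r})))}} (begin
         r * suc r * (A * cnt s)                                   ≤⟨ *-monoʳ-≤ (r * suc r) (*-monoʳ-≤ A cnt-next) ⟩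
         r * suc r * (A * ∑ outs (cnt ∘ next))                     ≡⟨ cong (r * suc r *_) (sym (∑-*ˡ outs A _)) ⟩
         r * suc r * ∑ outs (λ j → A * cnt (next j))               ≡⟨ sym (∑-*ˡ outs (r * suc r) _) ⟩
         ∑ outs (λ j → r * suc r * (A * cnt (next j)))             ≤⟨ ∑-mono outs each ⟩
         ∑ outs (λ j → (base + ind (head? j) * T) * W s)           ≡⟨ ∑-*ʳ outs (W s) _ ⟩
         ∑ outs (λ j → base + ind (head? j) * T) * W s             ≤⟨ *-monoˡ-≤ (W s) sums ⟩
         r * suc r * (P + B * 2 ^ c * ψ s) * W s                   ≡⟨ *-assoc (r * suc r) _ (W s) ⟩
         r * suc r * ((P + B * 2 ^ c * ψ s) * W s)                 ∎)
         where
         open ≤-Reasoning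
         open Step {s} {u} {i} fr
         c = length closeds
         x = (u , i)
         r = length outs
         r>0 : 1 ≤ r
         r>0 = ≤-trans (m<n⇒0<n∸m exposed<n) (≤-reflexive (sym length-outs))
         T = B * 2 ^ c * (r * ψ s)
         base = suc r * P + T
         -- The path is `t ++ [ x ]`; with empty `t` its head is `x` itself, hence the default.
         first : X
         first = headOr x t
         head? : ∀ j → Dec ((go true u , j) ≡ first)
         head? j = (go true u , j) ≟X first
         sums : ∑ outs (λ j → base + ind (head? j) * T) ≤ r * suc r * (P + B * 2 ^ c * ψ s)
         sums = begin
           ∑ outs (λ j → base + ind (head? j) * T)                 ≡⟨ ∑-+ outs _ _ ⟩
           ∑ outs (λ _ → base) + ∑ outs (λ j → ind (head? j) * T)  ≡⟨ cong₂ _+_ (∑-const outs base) (∑-*ʳ outs T _) ⟩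
           r * base + ∑ outs (λ j → ind (head? j)) * T             ≤⟨ +-monoʳ-≤ (r * base) (*-monoˡ-≤ T (∑-ind≤ head? {[ proj₂ first ]} outs-unique (λ _ e → here (cong proj₂ e)))) ⟩
           r * base + 1 * T                                        ≡⟨ e r P (B * 2 ^ c) (ψ s) ⟩
           r * suc r * (P + B * 2 ^ c * ψ s) ∎
           where
           e : ∀ r P b ψ → r * (suc r * P + b * (r * ψ)) + 1 * (b * (r * ψ)) ≡ r * suc r * (P + b * ψ)
           e = solve-∀
         expand : ∀ {j} → j ∈ outs → ∀ c′ → r * suc r * ((P + B * 2 ^ c′ * ψ (next j)) * W (next j)) ≡ (suc r * P + B * 2 ^ c′ * (r * ψ s)) * W s
         expand {j} j∈ c′ = trans (e₁ r P (B * 2 ^ c′) (ψ (next j)) (W (next j)))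
           (cong₂ (λ a w → (suc r * P + B * 2 ^ c′ * a) * w) (sym (ψ-next j∈)) (sym (W-next j∈)))
           where
           e₁ : ∀ r P b ψ w → r * suc r * ((P + b * ψ) * w) ≡ (suc r * P + b * (suc r * ψ)) * (r * w)
           e₁ = solve-∀
         p = t ++ [ x ]
         uniq : Unique (p ++ concat ps ++ concat closeds)
         uniq = subst Unique (++-assoc p (concat ps) (concat closeds)) (unique-↭ (↭-sym (cover g)) vertices-unique)
         ≢x : ∀ {q z} → q ∈ ps → z ∈ q → z ≢ x
         ≢x q∈ z∈ refl = unique-disj p uniq (∈-++⁺ʳ t (here refl)) (∈-++⁺ˡ (∈-concat⁺′ z∈ q∈))
         not-preceded : ∀ {j} → j ∈ outs → ∀ {z} → ¬ Succ s z (go true u , j)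
         not-preceded j∈ {z} sc = succ-stale {s} {z} sc (fresh-target j∈)
         at-head : ∀ {j} → j ∈ outs → ∀ q → Chain (Succ s) q → (go true u , j) ∈ q → ∃ λ vs → q ≡ (go true u , j) ∷ vs
         at-head {j} j∈ q ch y∈ with ∈-∃++ y∈
         ... | [] , vs , e = vs , e
         ... | a ∷ as , vs , refl with snoc-view a as
         ...   | m , z , e = ⊥-elim (not-preceded j∈ (chain-mid m (subst (Chain (Succ s)) (trans (cong (_++ (go true u , j) ∷ vs) e) (++-assoc m [ z ] _)) ch)))
         tails′ : ∀ {j} → j ∈ outs → ∀ {qs} → (∀ {q} → q ∈ qs → q ∈ ps) →
           All (λ p → ∃ λ t → ∃ λ x → p ≡ t ++ [ x ] × Fresh (next j) x true) qs
         tails′ j∈ sub = All.tabulate λ {q} q∈ → let (t′ , z , e , f) = All.lookup (All.tail (tails g)) (sub q∈) in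
           t′ , z , e , keep-fresh j∈ (≢x (sub q∈) (subst (z ∈_) (sym e) (∈-++⁺ʳ t′ (here refl)))) f
         up-chain : ∀ {j} (j∈ : j ∈ outs) q → Chain (Succ s) q → Chain (Succ (next j)) q
         up-chain j∈ = chain-map (λ {a} {b} → mono j∈ {a} {b})
         up-loops : ∀ {j} → j ∈ outs → All (Closed (Succ (next j))) closeds
         up-loops j∈ = All.map (λ {c} → closed-map (λ {a} {b} → mono j∈ {a} {b}) c) (loops g)
         others′ : ∀ {j} → j ∈ outs → ∀ e → (∀ u → e ≢ ed true u) → proj₁ (next j) e ≡ []
         others′ j∈ e ne = keep-others j∈ e ne (others g e ne)
         close : ∀ {j vs} → j ∈ outs → p ≡ (go true u , j) ∷ vs → Gluing (next j) ps (p ∷ closeds)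
         close {j} {vs} j∈ pe = record
           { links = All.map (λ {q} → up-chain j∈ q) (All.tail (links g))
           ; loops = subst (Closed (Succ (next j))) (sym pe) (subst (λ z → Chain (Succ (next j)) (z ++ [ go true u , j ])) pe
               (subst (Chain (Succ (next j))) (sym (++-assoc t [ x ] _)) (chain-glue t {x} (up-chain j∈ p (All.head (links g))) (new j∈ , tt)))) ∷ up-loops j∈
           ; tails = tails′ j∈ (λ q → q)
           ; cover = ↭-trans (shifts (concat ps) p) (↭-trans (↭-reflexive (sym (++-assoc p (concat ps) (concat closeds)))) (cover g))
           ; others = others′ j∈ }
         join : ∀ {j} ps₁ {vs ps₂} → j ∈ outs → ps ≡ ps₁ ++ ((go true u , j) ∷ vs) ∷ ps₂ →
           Gluing (next j) ((p ++ (go true u , j) ∷ vs) ∷ ps₁ ++ ps₂) closeds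
         join {j} ps₁ {vs} {ps₂} j∈ pe = record
           { links = subst (Chain (Succ (next j))) (sym (++-assoc t [ x ] _)) (chain-glue t {x} (up-chain j∈ p (All.head (links g)))
               (new j∈ , up-chain j∈ q (All.lookup (All.tail (links g)) q∈))) ∷ All.tabulate (λ {a} a∈ → up-chain j∈ a (All.lookup (All.tail (links g)) (sub a∈)))
           ; loops = up-loops j∈
           ; tails = (let (t′ , z , e , f) = All.head (tails′ j∈ {q ∷ []} (λ { (here refl) → q∈ })) in
                       p ++ t′ , z , trans (cong (p ++_) e) (sym (++-assoc p t′ [ z ])) , f) ∷ tails′ j∈ sub
           ; cover = ↭-trans (++⁺ʳ (concat closeds) (↭-trans (↭-reflexive (++-assoc p q (concat (ps₁ ++ ps₂)))) (++⁺ˡ p (↭-trans (↭-sym (concat-mid ps₁)) (↭-reflexive (cong concat (sym pe))))))) (cover g)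
           ; others = others′ j∈ }
           where
           q = (go true u , j) ∷ vs
           q∈ : q ∈ ps
           q∈ = subst (q ∈_) (sym pe) (∈-++⁺ʳ ps₁ (here refl))
           sub : ∀ {a} → a ∈ ps₁ ++ ps₂ → a ∈ ps
           sub {a} a∈ with ∈-++⁻ ps₁ a∈
           ... | inj₁ i = subst (a ∈_) (sym pe) (∈-++⁺ˡ i)
           ... | inj₂ i = subst (a ∈_) (sym pe) (∈-++⁺ʳ ps₁ (there i))
         -- The target has no known predecessor, so it is on no closed cycle and can only be the
         -- first vertex of an open path, possibly of the same one.
         place : ∀ {j} → j ∈ outs → (∃ λ vs → p ≡ (go true u , j) ∷ vs) ⊎ (∃ λ ps₁ → ∃ λ vs → ∃ λ ps₂ → ps ≡ ps₁ ++ ((go true u , j) ∷ vs) ∷ ps₂)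
         place {j} j∈ with ∈-++⁻ p (subst ((go true u , j) ∈_) (++-assoc p (concat ps) (concat closeds)) (∈-resp-↭ (↭-sym (cover g)) (vertices-complete (go true u , j))))
         ... | inj₁ y∈ = inj₁ (at-head j∈ p (All.head (links g)) y∈)
         ... | inj₂ y∈ with ∈-++⁻ (concat ps) y∈
         ...   | inj₂ y∈c with ∈-concat⁻′ closeds y∈c
         ...     | c′ , y∈c′ , c∈ = ⊥-elim (not-preceded j∈ (proj₂ (closed-pred c′ (All.lookup (loops g) c∈) y∈c′)))
         place {j} j∈ | inj₂ y∈ | inj₁ y∈p with ∈-concat⁻′ ps y∈p
         ... | q , y∈q , q∈ with at-head j∈ q (All.lookup (All.tail (links g)) q∈) y∈q | ∈-∃++ q∈
         ...   | vs , refl | ps₁ , ps₂ , e = inj₂ (ps₁ , vs , ps₂ , e)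
         each : ∀ {j} → j ∈ outs → r * suc r * (A * cnt (next j)) ≤ (base + ind (head? j) * T) * W s
         each {j} j∈ with place j∈
         ... | inj₁ (vs , pe) = begin
           r * suc r * (A * cnt (next j))
             ≤⟨ *-monoʳ-≤ (r * suc r) (glue k {next j} {ps} le (close j∈ pe)) ⟩
           r * suc r * ((P + B * 2 ^ suc c * ψ (next j)) * W (next j))
             ≡⟨ expand j∈ (suc c) ⟩
           (suc r * P + B * (2 * 2 ^ c) * (r * ψ s)) * W s
             ≡⟨ cong (_* W s) (e (suc r * P) B (2 ^ c) (r * ψ s)) ⟩
           (base + 1 * T) * W s
             ≡⟨ cong (λ z → (base + z * T) * W s) (sym one) ⟩
           (base + ind (head? j) * T) * W s ∎
           where
           e : ∀ a b t w → a + b * (2 * t) * w ≡ a + b * t * w + 1 * (b * t * w)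
           e = solve-∀
           one : ind (head? j) ≡ 1
           one with head? j
           ... | yes _ = refl
           ... | no ne = ⊥-elim (ne (sym (headOr-eq x t pe)))
         ... | inj₂ (ps₁ , vs , ps₂ , pe) = begin
           r * suc r * (A * cnt (next j))
             ≤⟨ *-monoʳ-≤ (r * suc r) (glue k {next j} {(p ++ (go true u , j) ∷ vs) ∷ ps₁ ++ ps₂} (≤-trans (≤-reflexive (sym len)) le) (join ps₁ j∈ pe)) ⟩
           r * suc r * ((P + B * 2 ^ c * ψ (next j)) * W (next j))
             ≡⟨ expand j∈ c ⟩
           base * W s
             ≤⟨ *-monoˡ-≤ (W s) (m≤m+n base _) ⟩
           (base + ind (head? j) * T) * W s ∎
           where
           len : length ps ≡ suc (length (ps₁ ++ ps₂))
           len = trans (cong length pe) (trans (length-++ ps₁) (trans (+-suc (length ps₁) (length ps₂)) (cong suc (sym (length-++ ps₁)))))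

       singletons : Gluing unexposed (map [_] vertices) []
       singletons = record
         { links = AllP.map⁺ (All.tabulate (λ _ → tt)) ; loops = []
         ; tails = AllP.map⁺ (All.tabulate (λ {x} _ → [] , x , refl , λ ()))
         ; cover = ↭-reflexive (trans (cong (_++ []) (concat-singletons vertices)) (Data.List.Properties.++-identityʳ vertices))
         ; others = λ _ _ → refl }

       -- Initially `ψ` is `(n + 1) ^ m` and there is no cycle: the polynomial bound on the
       -- expectation of 2 to the number of cycles.
       exposeFirst : A * length L ≤ (P + B * suc n ^ m G) * (n ! ) ^ m G
       exposeFirst = begin
         A * length L                                ≡⟨ cong (A *_) (sym all) ⟩
         A * cnt unexposed                           ≤⟨ glue (length (map [_] vertices)) {unexposed} {map [_] vertices} ≤-refl singletons ⟩
         (P + B * 1 * ψ unexposed) * W unexposed     ≡⟨ cong₂ (λ a w → (P + a) * w) (cong₂ _*_ (*-identityʳ B) (∏-const (m G) (suc n))) (∏-const (m G) (n !)) ⟩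
         (P + B * suc n ^ m G) * (n !) ^ m G         ∎
         where
         open ≤-Reasoning
         all : cnt unexposed ≡ length L
         all = trans (count-all L) (*-identityʳ (length L))
           where
           one : ∀ σ → ind (cons? unexposed σ) ≡ 1
           one σ with cons? unexposed σ
           ... | yes _ = refl
           ... | no ¬c = ⊥-elim (¬c (λ _ → []))
           count-all : ∀ xs → ∑ xs (λ σ → ind (cons? unexposed σ)) ≡ length xs * 1
           count-all xs = trans (∑-cong xs one) (∑-const xs 1)

-- From the two exposures to a bound on the number of bad lifts.

module Assembly where

 open ListTools
 open LiftCounting
 open ExposureOracle
 open PathRotation
 open RotationSetting
 open ClosingTrials
 open RootedExploration
 open CycleMerging
 open HalfEdgeOracle
 open FirstHamiltonCycle

 zip-chain : ∀ {A : Set} {K : A → A → Set} x xs {z a b} → Chain K (x ∷ xs ++ [ z ]) → (a , b) ∈ zip (x ∷ xs) (xs ++ [ z ]) → K a b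
 zip-chain x []       (k , _) (here refl) = k
 zip-chain x (y ∷ ys) (k , _) (here refl) = k
 zip-chain x (y ∷ ys) (_ , c) (there i)   = zip-chain y ys c i

 cyclicPairs-closed : ∀ {A : Set} {K : A → A → Set} c {a b} → Closed K c → (a , b) ∈ cyclicPairs c → K a b
 cyclicPairs-closed (x ∷ xs) cl i = zip-chain x xs cl i

 longest : ∀ {A : Set} (cs : List (List A)) → 1 ≤ length cs →
   ∃ λ pre → ∃ λ big → ∃ λ post → cs ≡ pre ++ big ∷ post × length (concat cs) ≤ length cs * length big
 longest (c ∷ []) _ = [] , c , [] , refl , ≤-reflexive (trans (length-++ c) refl)
 longest (c ∷ cs@(_ ∷ _)) _ with longest cs (s≤s z≤n)
 ... | pre , big , post , e , le with ≤-total (length c) (length big)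
 ...   | inj₁ c≤ = c ∷ pre , big , post , cong (c ∷_) e , ≤-trans (≤-reflexive (length-++ c)) (+-mono-≤ c≤ le)
 ...   | inj₂ b≤ = [] , c , cs , refl , ≤-trans (≤-reflexive (length-++ c)) (+-monoʳ-≤ (length c) (≤-trans le (*-monoʳ-≤ (length cs) b≤)))

 concat-infix : ∀ {A : Set} {r : List A} {rs} → r ∈ rs → Infix r (concat rs)
 concat-infix {r = r} i with ∈-∃++ i
 ... | as , bs , refl = concat as , concat bs , sym (concat-++ as (r ∷ bs))

 moves : {F : Set} → (F → F) → (Bool → F → F) → F → List Bool → F
 moves s t f []       = f
 moves s t f (d ∷ ds) = moves s t (s (t d f)) ds

 -- Sizes used in the exposure argument: V fibres of size n, m edges, words of length at most kmax,
 -- and the target probability 1 / (k + 1).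
 record Sizes (V m kmax n k : ℕ) : Set where
   field
     D L Lh G dA dB cutN runN capX K₀ : ℕ
   capA : ℕ
   capA = 4 * pathCost dA
   capB : ℕ
   capB = 4 * treeCost dB
   capT : ℕ
   capT = capB * (kmax + 3)
   capE : ℕ
   capE = capT + 3 * cutN
   growth : ℕ
   growth = capT + capA + 2
   loss : ℕ
   loss = 2 + (2 * dB + 1) + (2 * dA + 1)
   field
     1≤n      : 1 ≤ n
     1≤D      : 1 ≤ D
     1≤G      : 1 ≤ G
     bad-ok   : 2 * (D * (3 * (capA + capT + capX) + runN)) ≤ n
     cat-ok   : 4 * (D * ((3 * cutN + 2) * (pathCost dA + treeCost dB))) ≤ n
     L-big    : Lh + 3 * (capT + capX + cutN) ≤ L
     n≤GL     : n ≤ G * Lh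
     trial-ok : 2 * ((3 * cutN + capB) * D) * ((kmax + 2) * capB) ≤ n
     mass-ok  : 2 * (4 * n * G ^ (kmax + 1) * D + 4 * capE * capB) * (2 * (V * 2)) ≤ 2 ^ dA * 2 ^ dB
     cycles-ok : D * suc n ^ m ≤ 2 ^ K₀
     grow-ok  : K₀ * growth ≤ capX
     cut-ok   : 2 * K₀ ≤ cutN
     run-ok   : K₀ * ((1 + kmax) * (1 + L * V)) ≤ runN
     long-ok  : K₀ * (K₀ * ((1 + kmax) * (1 + L * V))) ≤ V * n
     final-ok : suc k * (K₀ * loss + 1) ≤ D

 -- What is needed about the base graph: the two Hamilton cycles H₁, H₂ share no edge, and words in
 -- the moves f ↦ go₁ η (go₂ d f) act transitively (this is where non-bipartiteness enters).
 record TwoCycles (G : Graph) : Set where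
   field
     H₁ H₂    : HamRot G
     disjoint : ∀ c u d v → HamRot.ed H₁ c u ≢ HamRot.ed H₂ d v
     orbit    : ∀ d f g → ∃ λ i → i < V G × iter (HamRot.go H₁ d) (suc i) f ≡ g
     kmax     : ℕ
     reach    : ∀ η f g → ∃ λ word → length word ≤ kmax × moves (HamRot.go H₁ η) (HamRot.go H₂) f word ≡ g
     3≤V      : 3 ≤ V G

 module _ (G : Graph) (TC : TwoCycles G) (n k : ℕ) (sz : Sizes (V G) (m G) (TwoCycles.kmax TC) n k)
   (L : List (LiftData G n)) (uL : Unique L) (badL : All (λ σ → IsLift G σ × ¬ Hamiltonian (LiftAdj G σ)) L) where

   open TwoCycles TC
   open Sizes sz hiding (G; L)
   private
     module Z = Sizes sz
     liftL : All (IsLift G) L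
     liftL = All.map proj₁ badL
   open Count G n L liftL uL
   private
     module A₁ = HalfEdges G n L liftL uL H₁
     module A₂ = HalfEdges G n L liftL uL H₂
     module C₁ = HamRot H₁
     vs : List X
     vs = vertices G n L liftL uL
     vs-unique : Unique vs
     vs-unique = vertices-unique G n L liftL uL
     Next : S → X → X → Set
     Next = Succ G n L liftL uL H₁

   length-cartesian : ∀ {A B : Set} (xs : List A) (ys : List B) → length (cartesianProduct xs ys) ≡ length xs * length ys
   length-cartesian [] ys = refl
   length-cartesian (x ∷ xs) ys = trans (length-++ (map (x ,_) ys)) (cong₂ _+_ (Data.List.Properties.length-map _ ys) (length-cartesian xs ys))

   vs-length : length vs ≡ V G * n
   vs-length = trans (length-cartesian (allFin (V G)) (allFin n)) (cong₂ _*_ (length-fins (V G)) (length-fins n))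

   -- `L` lists non-Hamiltonian lifts only, and a lift agreeing with `s` contains all edges known in
   -- `s`, hence would contain this spanning cycle.
   finished : ∀ s c → Closed (Adj-at G n L liftL uL s) c → c ↭ vs → cnt s ≡ 0
   finished s c cl cov = trans (∑-zero L (λ {σ} σ∈ → none σ σ∈)) refl
     where
     ∑-zero : ∀ {A : Set} (xs : List A) {f} → (∀ {x} → x ∈ xs → f x ≡ 0) → ∑ xs f ≡ 0
     ∑-zero [] h = refl
     ∑-zero (x ∷ xs) h = cong₂ _+_ (h (here refl)) (∑-zero xs (h ∘ there))
     none : ∀ σ → σ ∈ L → ind (cons? s σ) ≡ 0
     none σ σ∈ with cons? s σ
     ... | no _ = refl
     ... | yes cs = ⊥-elim (proj₂ (All.lookup badL σ∈) (c , unique-↭ (↭-sym cov) vs-unique ,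
       (λ a → ∈-resp-↭ (↭-sym cov) (vertices-complete G n L liftL uL a)) ,
       subst (3 ≤_) (sym (trans (↭-length cov) vs-length)) (*-mono-≤ 3≤V Z.1≤n) ,
       λ i → cyclicPairs-closed c (closed-map (λ a → a σ cs) c cl) i))

   -- The merging needs a concrete permutation `ρ`, read off from any lift that agrees with `s`; if
   -- there is none in the list, the bounds on `cnt s` are trivial.
   consistent? : ∀ s → cnt s ≡ 0 ⊎ ∃ λ σ → IsLift G σ × Cons s σ
   consistent? s = search L liftL
     where
     search : ∀ xs → All (IsLift G) xs → ∑ xs (λ σ → ind (cons? s σ)) ≡ 0 ⊎ ∃ λ σ → IsLift G σ × Cons s σ
     search [] [] = inj₁ refl
     search (σ ∷ xs) (lf ∷ lfs) with cons? s σ | search xs lfs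
     ... | yes c | _      = inj₂ (σ , lf , c)
     ... | no _  | r      = r

   module Known {s : S} {closeds : List (List X)} (gl : Gluing G n L liftL uL H₁ s [] closeds)
     (few : length closeds ≤ K₀) (σ : LiftData G n) (lf : IsLift G σ) (cs : Cons s σ) where
     open Gluing gl

     setting : Setting
     setting = record
       { oracle = A₂.oracle ; go₁ = C₁.go ; ρ = A₁.rot σ lf ; ρ-inv = A₁.rot-inv σ lf
       ; ρ-≢ = λ d x e → C₁.go-≢ d (proj₁ x) (cong proj₁ e)
       ; ρ-≢² = λ x e → C₁.go-≢² true (proj₁ x) (cong proj₁ e)
       ; fib-ρ = λ _ _ → refl ; allX = vs ; all-unique = vs-unique ; all-complete = vertices-complete G n L liftL uL
       ; finished = finished }

     walk-moves : ∀ η f word → walk setting η f word ≡ moves (C₁.go η) (HamRot.go H₂) f word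
     walk-moves η f []       = refl
     walk-moves η f (d ∷ ds) = walk-moves η _ ds

     mergeData : MergeData setting
     mergeData = record
       { _≟F_ = Fin._≟_ ; h = V G ; orbit = orbit ; kmax = kmax
       ; reach = λ η f g → let (w , l , e) = reach η f g in w , l , trans (walk-moves η f w) e
       ; fibs = allFin (V G) ; fibs-complete = ∈-allFin
       ; D = D ; L = Z.L ; Lh = Lh ; G = Z.G ; dA = dA ; dB = dB ; cutN = cutN ; runN = runN ; capX = capX
       ; 1≤n = 1≤n ; 1≤D = 1≤D ; 1≤G = 1≤G ; bad-ok = bad-ok ; cat-ok = cat-ok ; L-big = L-big ; n≤GL = n≤GL
       ; trial-ok = trial-ok
       ; mass-ok = subst (λ z → 2 * (4 * n * Z.G ^ (kmax + 1) * D + 4 * capE * capB) * (2 * z) ≤ 2 ^ dA * 2 ^ dB)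
           (sym (trans (length-cartesian (allFin (V G)) (true ∷ false ∷ [])) (cong (_* 2) (length-fins (V G))))) mass-ok }

     open WithData setting mergeData

     next-ρ : ∀ {x y} → Next s x y → y ≡ A₁.rot σ lf true x
     next-ρ {u , i} {_ , j} (refl , mem) = sym (A₁.rot-unique σ lf true (All.lookup (cs (C₁.ed true u)) mem))

     next-K : ∀ {x y} → Next s x y → Kx s [] x y
     next-K {u , i} {_ , j} sc@(refl , mem) = (λ τ c → adj τ (C₁.fl true u) (C₁.ed-ok true u) (All.lookup (c (C₁.ed true u)) mem)) , inj₁ (true , next-ρ sc)
       where
       adj : ∀ τ b → Data.Vec.lookup (edges G) (C₁.ed true u) ≡ mk b u (C₁.go true u) → Match τ (C₁.ed true u) (mk b i j) → LiftAdj G τ (u , i) (C₁.go true u , j)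
       adj τ false e mt = C₁.ed true u , inj₁ (e , mt)
       adj τ true  e mt = C₁.ed true u , inj₂ (e , mt)

     next-run : ∀ {x y} → Next s x y → x ≡ A₁.rot σ lf false y
     next-run {x} {y} sc = trans (sym (A₁.rot-inv σ lf true x)) (cong (A₁.rot σ lf false) (sym (next-ρ sc)))

     Cutting-mono : ∀ {C C′ c} → (∀ {z} → z ∈ C → z ∈ C′) → Cutting C c → Cutting C′ c
     Cutting-mono f (x , mid , b , e , i , j) = x , mid , b , e , f i , f j

     -- First and last vertex of each small cycle are reserved. They are distinct entries, as a
     -- one-element cycle would make the rotation of the base graph fix a vertex.
     cutEnds : ∀ ds → All (Closed (Next s)) ds → ∃ λ C → length C ≡ 2 * length ds × All (Cutting C) ds
     cutEnds [] [] = [] , refl , []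
     cutEnds ((x ∷ []) ∷ ds) (cl ∷ cls) = ⊥-elim (C₁.go-≢ true (proj₁ x) (sym (proj₁ (proj₁ cl))))
     cutEnds ((x ∷ y ∷ l) ∷ ds) (cl ∷ cls) with cutEnds ds cls | snoc-view y l
     ... | C , len , ok | mid , b , e = x ∷ b ∷ C , trans (cong (2 +_) len) (two (length ds)) ,
       (x , mid , b , cong (x ∷_) e , here refl , there (here refl)) ∷ All.map (Cutting-mono (there ∘ there)) ok
       where
       two : ∀ l → 2 + 2 * l ≡ 2 * suc l
       two = solve-∀

     B₀ : ℕ
     B₀ = 1 + Z.L * V G

     chop : ∀ j l → RunOf setting false l → j * ((1 + kmax) * B₀) ≤ length l →
       ∃ λ Rs → ∃ λ rest → l ≡ concat Rs ++ rest × Runs j Rs × length (concat Rs) ≡ j * ((1 + kmax) * B₀)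
     chop zero l run le = [] , l , refl , none , refl
     chop (suc j) l run le = R₀ ∷ Rm ∷ Rs , rest ,
         trans l-eq (trans (cong (λ z → R₀ ++ Rm ++ z) e) (trans (cong (R₀ ++_) (sym (++-assoc Rm (concat Rs) rest))) (sym (++-assoc R₀ _ rest)))) ,
         more (chain-left R₀ run₀) (chain-left Rm run₁) (≤-reflexive (sym len₀)) (≤-reflexive (sym lenm)) rs ,
         trans (length-++ R₀) (trans (cong₂ _+_ len₀ (trans (length-++ Rm) (cong₂ _+_ lenm len))) (arith B₀ kmax (j * ((1 + kmax) * B₀))))
       where
       R₀ = take B₀ l
       l₁ = drop B₀ l
       Rm = take (kmax * B₀) l₁
       l₂ = drop (kmax * B₀) l₁
       arith : ∀ b k t → b + (k * b + t) ≡ (1 + k) * b + t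
       arith = solve-∀
       le′ : B₀ + (kmax * B₀ + j * ((1 + kmax) * B₀)) ≤ length l
       le′ = ≤-trans (≤-reflexive (arith B₀ kmax (j * ((1 + kmax) * B₀)))) le
       l-eq : l ≡ R₀ ++ Rm ++ l₂
       l-eq = sym (trans (cong (R₀ ++_) (take++drop≡id (kmax * B₀) l₁)) (take++drop≡id B₀ l))
       run₀ : RunOf setting false (R₀ ++ Rm ++ l₂)
       run₀ = subst (RunOf setting false) l-eq run
       run₁ : RunOf setting false (Rm ++ l₂)
       run₁ = chain-right R₀ run₀
       le₁ : kmax * B₀ + j * ((1 + kmax) * B₀) ≤ length l₁
       le₁ = subst (kmax * B₀ + j * ((1 + kmax) * B₀) ≤_) (sym (length-drop B₀ l)) (m+n≤o⇒m≤o∸n _ (≤-trans (≤-reflexive (+-comm _ B₀)) le′))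
       le₂ : j * ((1 + kmax) * B₀) ≤ length l₂
       le₂ = subst (j * ((1 + kmax) * B₀) ≤_) (sym (length-drop (kmax * B₀) l₁)) (m+n≤o⇒m≤o∸n _ (≤-trans (≤-reflexive (+-comm _ (kmax * B₀))) le₁))
       len₀ : length R₀ ≡ B₀
       len₀ = trans (length-take B₀ l) (m≤n⇒m⊓n≡m (≤-trans (m≤m+n B₀ _) le′))
       lenm : length Rm ≡ kmax * B₀
       lenm = trans (length-take (kmax * B₀) l₁) (m≤n⇒m⊓n≡m (≤-trans (m≤m+n (kmax * B₀) _) le₁))
       rec = chop j l₂ (chain-right Rm run₁) le₂
       Rs = proj₁ rec
       rest = proj₁ (proj₂ rec)
       e = proj₁ (proj₂ (proj₂ rec))
       rs = proj₁ (proj₂ (proj₂ (proj₂ rec)))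
       len = proj₂ (proj₂ (proj₂ (proj₂ rec)))

     closeds-pos : 1 ≤ length closeds
     closeds-pos = pos closeds cover
       where
       pos : ∀ ds → concat ds ↭ vs → 1 ≤ length ds
       pos [] cov = ⊥-elim (1+n≰n (≤-trans (≤-trans (s≤s z≤n) (*-mono-≤ 3≤V 1≤n)) (≤-reflexive (trans (sym vs-length) (sym (↭-length cov))))))
       pos (_ ∷ _) _ = s≤s z≤n

     -- The longest of at most `K₀` cycles has at least `V * n / K₀` vertices, by `long-ok` enough
     -- for `K₀` pairs of runs.
     merged : D * cnt s ≤ (K₀ * Z.loss) * W s
     merged with longest closeds closeds-pos
     ... | pre , big , post , refl , long = mergeAll K₀ {s} {[]} {proj₁ cutL} {Rs} {big} {pre ++ post} (record
       { fresh = λ { (u , i) _ c ex → no-exposed u c ex }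
       ; cut = λ _ ()
       ; big-closed = closed-map next-K big big-cl
       ; cs-closed = All.map (λ {c} → closed-map next-K c) rest-cl
       ; cover = ↭-trans (↭-sym (concat-mid pre {big} {post})) cover
       ; runs = proj₁ (proj₂ (proj₂ (proj₂ chopped)))
       ; runs-unique = unique-++ˡ (concat Rs) (subst Unique big-eq (unique-++ˡ big (unique-↭ (↭-sym (↭-trans (↭-sym (concat-mid pre)) cover)) vs-unique)))
       ; in-big = All.tabulate (λ {r} r∈ → inj₁ (subst (Infix r) (sym big-eq) (infix-++ʳ (proj₁ (proj₂ chopped)) (concat-infix r∈))))
       ; cuts = proj₂ (proj₂ cutL)
       ; few = ≤-trans rest≤ few
       ; Ex-small = grow-ok
       ; Cut-small = ≤-trans (≤-reflexive (proj₁ (proj₂ cutL))) (≤-trans (*-monoʳ-≤ 2 (≤-trans rest≤ few)) cut-ok)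
       ; runs-small = ≤-trans (≤-reflexive (proj₂ (proj₂ (proj₂ (proj₂ chopped))))) run-ok })
       where
       -- Edge-disjointness of the Hamilton cycles: exposing the first lift has revealed nothing
       -- about the second.
       no-exposed : ∀ u c {i} → ¬ Exposed s (HamRot.ed H₂ c u) (HamRot.fl H₂ c u) i
       no-exposed u c {i} ex with subst (λ l → i ∈ map (pr (HamRot.fl H₂ c u)) l) (others (HamRot.ed H₂ c u) (λ v e → disjoint true v c u (sym e))) ex
       ... | ()
       big-cl : Closed (Next s) big
       big-cl = All.head (AllP.++⁻ʳ pre loops)
       rest-cl : All (Closed (Next s)) (pre ++ post)
       rest-cl = AllP.++⁺ (AllP.++⁻ˡ pre loops) (All.tail (AllP.++⁻ʳ pre loops))
       cutL = cutEnds (pre ++ post) rest-cl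
       rest≤ : length (pre ++ post) ≤ length (pre ++ big ∷ post)
       rest≤ = subst₂ _≤_ (sym (length-++ pre)) (sym (length-++ pre)) (+-monoʳ-≤ (length pre) (n≤1+n _))
       1≤K₀ : 1 ≤ K₀
       1≤K₀ = ≤-trans closeds-pos few
       long-big : K₀ * ((1 + kmax) * B₀) ≤ length big
       long-big = *-cancelˡ-≤ K₀ {{>-nonZero 1≤K₀}} (≤-trans long-ok (≤-trans (≤-reflexive (trans (sym vs-length) (sym (↭-length cover))))
         (≤-trans long (*-monoˡ-≤ (length big) few))))
       run-of : ∀ c → Closed (Next s) c → RunOf setting false c
       run-of (x ∷ l) cl = chain-map next-run (x ∷ l) (chain-left (x ∷ l) cl)
       chopped = chop K₀ big (run-of big big-cl) long-big
       Rs = proj₁ chopped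
       big-eq : big ≡ concat Rs ++ proj₁ (proj₂ chopped)
       big-eq = proj₁ (proj₂ (proj₂ chopped))

   bad-bound : suc k * length L ≤ numLifts G n
   bad-bound = *-cancelˡ-≤ D {{>-nonZero 1≤D}} (begin
     D * (suc k * length L)                          ≡⟨ e₁ D (suc k) (length L) ⟩
     suc k * (D * length L)                          ≤⟨ *-monoʳ-≤ (suc k) core ⟩
     suc k * ((K₀ * Z.loss + 1) * numLifts G n)        ≡⟨ sym (*-assoc (suc k) (K₀ * Z.loss + 1) (numLifts G n)) ⟩
     suc k * (K₀ * Z.loss + 1) * numLifts G n          ≤⟨ *-monoˡ-≤ (numLifts G n) final-ok ⟩
     D * numLifts G n                                ∎)
     where
     open ≤-Reasoning
     e₁ : ∀ d k l → d * (k * l) ≡ k * (d * l)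
     e₁ = solve-∀
     T = 2 ^ K₀
     -- Markov's inequality for 2 to the number of cycles: with more than `K₀` cycles the second
     -- term alone is at least `T * D`, otherwise `merged` applies.
     final : ∀ {s closeds} → Gluing G n L liftL uL H₁ s [] closeds → T * D * cnt s ≤ (K₀ * Z.loss * T + D * 2 ^ length closeds) * W s
     final {s} {closeds} gl with length closeds ≤? K₀ | consistent? s
     ... | _ | inj₁ z = ≤-trans (≤-reflexive (trans (cong (T * D *_) z) (*-zeroʳ (T * D)))) z≤n
     ... | yes few | inj₂ (σ , lf , cs) = begin
       T * D * cnt s                           ≡⟨ *-assoc T D (cnt s) ⟩
       T * (D * cnt s)                         ≤⟨ *-monoʳ-≤ T (Known.merged gl few σ lf cs) ⟩
       T * (K₀ * Z.loss * W s)                   ≡⟨ e₂ T (K₀ * Z.loss) (W s) ⟩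
       K₀ * Z.loss * T * W s                     ≤⟨ *-monoˡ-≤ (W s) (m≤m+n (K₀ * Z.loss * T) _) ⟩
       (K₀ * Z.loss * T + D * 2 ^ length closeds) * W s ∎
       where
       e₂ : ∀ t p w → t * (p * w) ≡ p * t * w
       e₂ = solve-∀
     ... | no many | inj₂ _ = *-mono-≤ (≤-trans (≤-trans (≤-reflexive (*-comm T D)) (*-monoʳ-≤ D (^-monoʳ-≤ 2 (<⇒≤ (≰⇒> many))))) (m≤n+m _ (K₀ * Z.loss * T))) (cnt≤W s)
     core : D * length L ≤ (K₀ * Z.loss + 1) * numLifts G n
     core = *-cancelˡ-≤ T {{>-nonZero (2^≥1 K₀)}} (begin
       T * (D * length L)                          ≡⟨ sym (*-assoc T D (length L)) ⟩
       T * D * length L                            ≤⟨ exposeFirst G n L liftL uL H₁ (T * D) (K₀ * Z.loss * T) D final ⟩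
       (K₀ * Z.loss * T + D * suc n ^ m G) * numLifts G n ≤⟨ *-monoˡ-≤ (numLifts G n) (+-monoʳ-≤ (K₀ * Z.loss * T) cycles-ok) ⟩
       (K₀ * Z.loss * T + T) * numLifts G n          ≡⟨ e₃ (K₀ * Z.loss) T (numLifts G n) ⟩
       T * ((K₀ * Z.loss + 1) * numLifts G n)        ∎)
       where
       e₃ : ∀ p t x → (p * t + t) * x ≡ t * ((p + 1) * x)
       e₃ = solve-∀

-- Rotations of the base graph and transitivity of the fibre moves.

module BaseGraph where

 open ListTools
 open LiftCounting
 open ClosingTrials using (iter)
 open Assembly

 module _ {A : Set} where

   zip-∈ : ∀ {xs ys : List A} {a b} → (a , b) ∈ zip xs ys → a ∈ xs × b ∈ ys
   zip-∈ {x ∷ xs} {y ∷ ys} (here refl) = here refl , here refl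
   zip-∈ {x ∷ xs} {y ∷ ys} (there i)   = let (p , q) = zip-∈ i in there p , there q

   zip-functional : ∀ {xs ys : List A} {a b b′} → Unique xs → (a , b) ∈ zip xs ys → (a , b′) ∈ zip xs ys → b ≡ b′
   zip-functional {x ∷ xs} {y ∷ ys} u (here refl) (here refl) = refl
   zip-functional {x ∷ xs} {y ∷ ys} u (here refl) (there j)   = ⊥-elim (unique-head u (proj₁ (zip-∈ j)))
   zip-functional {x ∷ xs} {y ∷ ys} u (there i)   (here refl) = ⊥-elim (unique-head u (proj₁ (zip-∈ i)))
   zip-functional {x ∷ xs} {y ∷ ys} u (there i)   (there j)   = zip-functional (unique-tail u) i j

   zip-injective : ∀ {xs ys : List A} {a a′ b} → Unique ys → (a , b) ∈ zip xs ys → (a′ , b) ∈ zip xs ys → a ≡ a′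
   zip-injective {x ∷ xs} {y ∷ ys} u (here refl) (here refl) = refl
   zip-injective {x ∷ xs} {y ∷ ys} u (here refl) (there j)   = ⊥-elim (unique-head u (proj₂ (zip-∈ {xs} j)))
   zip-injective {x ∷ xs} {y ∷ ys} u (there i)   (here refl) = ⊥-elim (unique-head u (proj₂ (zip-∈ {xs} i)))
   zip-injective {x ∷ xs} {y ∷ ys} u (there i)   (there j)   = zip-injective {xs} (unique-tail u) i j

   zip-total : ∀ {xs ys : List A} {a} → length xs ≡ length ys → a ∈ xs → ∃ λ b → (a , b) ∈ zip xs ys
   zip-total {x ∷ xs} {y ∷ ys} e (here refl) = y , here refl
   zip-total {x ∷ xs} {y ∷ ys} e (there i)   = let (b , j) = zip-total (suc-injective e) i in b , there j

   zip-surjective : ∀ {xs ys : List A} {b} → length xs ≡ length ys → b ∈ ys → ∃ λ a → (a , b) ∈ zip xs ys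
   zip-surjective {x ∷ xs} {y ∷ ys} e (here refl) = x , here refl
   zip-surjective {x ∷ xs} {y ∷ ys} e (there i)   = let (a , j) = zip-surjective {xs} (suc-injective e) i in a , there j

   chain-zip : ∀ {K : A → A → Set} x xs {z} → (∀ {a b} → (a , b) ∈ zip (x ∷ xs) (xs ++ [ z ]) → K a b) → Chain K (x ∷ xs ++ [ z ])
   chain-zip x []       h = h (here refl) , tt
   chain-zip x (y ∷ ys) h = h (here refl) , chain-zip y ys (h ∘ there)

   chain-iter : ∀ (s : A → A) f l {g} → Chain (λ x y → y ≡ s x) (f ∷ l) → g ∈ l → ∃ λ i → i < length l × iter s (suc i) f ≡ g
   chain-iter s f (y ∷ l) (refl , c) (here refl) = 0 , s≤s z≤n , refl
   chain-iter s f (y ∷ l) (refl , c) (there i)   = let (k , lt , e) = chain-iter s y l c i in suc k , s≤s lt , e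

   iter-suc : ∀ (s : A → A) i x → iter s (suc i) x ≡ s (iter s i x)
   iter-suc s zero    x = refl
   iter-suc s (suc i) x = iter-suc s i (s x)

   iter-+ : ∀ (s : A → A) i j x → iter s (i + j) x ≡ iter s j (iter s i x)
   iter-+ s zero    j x = refl
   iter-+ s (suc i) j x = iter-+ s i j (s x)

   iter-injective : ∀ {s : A → A} → (∀ {x y} → s x ≡ s y → x ≡ y) → ∀ i {x y} → iter s i x ≡ iter s i y → x ≡ y
   iter-injective inj zero    e = e
   iter-injective inj (suc i) e = inj (iter-injective inj i e)

   iter-inverse : ∀ {s s⁻¹ : A → A} → (∀ x → s⁻¹ (s x) ≡ x) → ∀ i {x y} → iter s i x ≡ y → iter s⁻¹ i y ≡ x
   iter-inverse inv zero    e = sym e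
   iter-inverse {s} {s⁻¹} inv (suc i) {x} refl = trans (iter-suc s⁻¹ i _) (trans (cong s⁻¹ (iter-inverse inv i refl)) (inv x))

   toList-lookup : ∀ {m} (v : Vec A m) {x} → x ∈ toList v → ∃ λ e → lookup v e ≡ x
   toList-lookup (x ∷ v) (here refl) = zero , refl
   toList-lookup (x ∷ v) (there i)   = let (e , q) = toList-lookup v i in suc e , q

 module Ham (G : Graph) (simple : IsSimple G) (c : List (Fin (V G))) (ham : IsHamCycle (Adj G) c) where
   private
     uc = proj₁ ham
     complete = proj₁ (proj₂ ham)
     3≤c = proj₁ (proj₂ (proj₂ ham))
     adj = proj₂ (proj₂ (proj₂ ham))

   Pair : Fin (V G) → Fin (V G) → Set
   Pair x y = (x , y) ∈ cyclicPairs c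

   private
     rotation : List (Fin (V G)) → List (Fin (V G))
     rotation []       = []
     rotation (x ∷ xs) = xs ++ [ x ]

     pairs≡ : ∀ c → cyclicPairs c ≡ zip c (rotation c)
     pairs≡ []      = refl
     pairs≡ (_ ∷ _) = refl

     rot-length : ∀ c → length c ≡ length (rotation c)
     rot-length []       = refl
     rot-length (x ∷ xs) = sym (trans (length-++ xs) (+-comm (length xs) 1))

     rot-∈ : ∀ c {a} → a ∈ c → a ∈ rotation c
     rot-∈ (x ∷ xs) (here refl) = ∈-++⁺ʳ xs (here refl)
     rot-∈ (x ∷ xs) (there i)   = ∈-++⁺ˡ i

     rot-unique : ∀ c → Unique c → Unique (rotation c)
     rot-unique []       u = u
     rot-unique (x ∷ xs) u = unique-↭ (++-comm [ x ] xs) u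

   pair-next : ∀ x → ∃ λ y → Pair x y
   pair-next x = let (y , i) = zip-total (rot-length c) (complete x) in y , subst ((x , y) ∈_) (sym (pairs≡ c)) i

   pair-prev : ∀ y → ∃ λ x → Pair x y
   pair-prev y = let (x , i) = zip-surjective {xs = c} (rot-length c) (rot-∈ c (complete y)) in x , subst ((x , y) ∈_) (sym (pairs≡ c)) i

   pair-functional : ∀ {x y y′} → Pair x y → Pair x y′ → y ≡ y′
   pair-functional i j = zip-functional uc (subst (_ ∈_) (pairs≡ c) i) (subst (_ ∈_) (pairs≡ c) j)

   pair-injective : ∀ {x x′ y} → Pair x y → Pair x′ y → x ≡ x′
   pair-injective i j = zip-injective {xs = c} (rot-unique c uc) (subst (_ ∈_) (pairs≡ c) i) (subst (_ ∈_) (pairs≡ c) j)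

   go : Bool → Fin (V G) → Fin (V G)
   go true  x = proj₁ (pair-next x)
   go false y = proj₁ (pair-prev y)

   go-inv : ∀ d u → go (not d) (go d u) ≡ u
   go-inv true  u = pair-injective (proj₂ (pair-prev (go true u))) (proj₂ (pair-next u))
   go-inv false u = pair-functional (proj₂ (pair-next (go false u))) (proj₂ (pair-prev u))

   pair-go : ∀ {x y} → Pair x y → y ≡ go true x
   pair-go i = pair-functional i (proj₂ (pair-next _))

   closed-go : ∀ c → (∀ {x y} → (x , y) ∈ cyclicPairs c → y ≡ go true x) → 3 ≤ length c → Closed (λ x y → y ≡ go true x) c
   closed-go (x ∷ xs) h _ = chain-zip x xs h

   orbit-true : ∀ f g → ∃ λ i → i < V G × iter (go true) (suc i) f ≡ g
   orbit-true f g with ∈-∃++ (complete f)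
   ... | us , vs , e = let (i , lt , q) = chain-iter (go true) f (vs ++ us ++ [ f ]) (closed-rotate us f vs (subst (Closed _) e (closed-go c pair-go 3≤c))) g∈
                       in i , <-≤-trans lt len , q
     where
     g∈ : g ∈ vs ++ us ++ [ f ]
     g∈ with ∈-++⁻ us (subst (g ∈_) e (complete g))
     ... | inj₁ j = ∈-++⁺ʳ vs (∈-++⁺ˡ j)
     ... | inj₂ (here refl) = ∈-++⁺ʳ vs (∈-++⁺ʳ us (here refl))
     ... | inj₂ (there j) = ∈-++⁺ˡ j
     len : length (vs ++ us ++ [ f ]) ≤ V G
     len = ≤-trans (≤-reflexive (trans (↭-length (++-comm vs (us ++ [ f ]))) (trans (cong length (++-assoc us [ f ] vs)) (cong length (sym e)))))
       (≤-trans (Unique⊆⇒length≤ uc (λ {z} _ → ∈-allFin z)) (≤-reflexive (Data.List.Properties.length-tabulate {n = V G} (λ i → i))))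

   orbit : ∀ d f g → ∃ λ i → i < V G × iter (go d) (suc i) f ≡ g
   orbit true  f g = orbit-true f g
   orbit false f g = let (i , lt , e) = orbit-true g f in i , lt , iter-inverse (go-inv true) (suc i) e

   adj-irrefl : ∀ {u} → ¬ Adj G u u
   adj-irrefl (inj₁ i) = let (e , q) = toList-lookup (edges G) i in <-irrefl (cong toℕ (trans (cong proj₁ q) (sym (cong proj₂ q)))) (proj₁ simple e)
   adj-irrefl (inj₂ i) = let (e , q) = toList-lookup (edges G) i in <-irrefl (cong toℕ (trans (cong proj₁ q) (sym (cong proj₂ q)))) (proj₁ simple e)

   3≤V : 3 ≤ V G
   3≤V = ≤-trans 3≤c (≤-trans (Unique⊆⇒length≤ uc (λ {z} _ → ∈-allFin z)) (≤-reflexive (Data.List.Properties.length-tabulate {n = V G} (λ i → i))))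

   go-≢ : ∀ d u → go d u ≢ u
   go-≢ true  u e = adj-irrefl (subst (Adj G u) e (adj (proj₂ (pair-next u))))
   go-≢ false u e = adj-irrefl (subst (λ z → Adj G z u) e (adj (proj₂ (pair-prev u))))

   -- Otherwise the orbit of `u` under `go d` would consist of `u` and `go d u`; but it is the whole
   -- vertex set, of size at least 3.
   go-≢² : ∀ d u → go d u ≢ go (not d) u
   go-≢² d u e = 1+n≰n (≤-trans 3≤c (Unique⊆⇒length≤ uc (λ {z} _ → two z)))
     where
     invol : go d (go d u) ≡ u
     invol = trans (cong (go d) e) (subst (λ c → go c (go (not d) u) ≡ u) (not-involutive d) (go-inv (not d) u))
     stays : ∀ i → iter (go d) i u ∈ u ∷ go d u ∷ []
     stays zero = here refl
     stays (suc zero) = there (here refl)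
     stays (suc (suc i)) = subst (λ z → iter (go d) i z ∈ u ∷ go d u ∷ []) (sym invol) (stays i)
     two : ∀ z → z ∈ u ∷ go d u ∷ []
     two z = let (i , _ , q) = orbit d u z in subst (_∈ u ∷ go d u ∷ []) q (stays (suc i))

   arc : ∀ u → ∃ λ e → ∃ λ b → lookup (edges G) e ≡ mk b u (go true u)
   arc u with adj (proj₂ (pair-next u))
   ... | inj₁ i = let (e , q) = toList-lookup (edges G) i in e , false , q
   ... | inj₂ i = let (e , q) = toList-lookup (edges G) i in e , true , q

   ed : Bool → Fin (V G) → Fin (m G)
   ed true  u = proj₁ (arc u)
   ed false u = proj₁ (arc (go false u))

   fl : Bool → Fin (V G) → Bool
   fl true  u = proj₁ (proj₂ (arc u))
   fl false u = not (proj₁ (proj₂ (arc (go false u))))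

   hamRot : HamRot G
   hamRot = record
     { go = go ; go-inv = go-inv ; go-≢ = go-≢ ; go-≢² = go-≢² ; ed = ed ; fl = fl
     ; ed-ok = λ { true u → proj₂ (proj₂ (arc u))
                 ; false u → trans (proj₂ (proj₂ (arc (go false u)))) (trans (cong (mk (fl true (go false u)) (go false u)) (go-inv false u)) (sym (mk-not (fl true (go false u))))) }
     ; ed-rev = λ { true u → cong (ed true) (go-inv true u) ; false u → refl }
     ; fl-rev = λ { true u → cong (not ∘ fl true) (go-inv true u) ; false u → sym (not-involutive _) } }

   ed-pair : ∀ d u → ∃ λ x → ∃ λ y → ∃ λ b → Pair x y × lookup (edges G) (ed d u) ≡ mk b x y
   ed-pair true  u = u , go true u , fl true u , proj₂ (pair-next u) , proj₂ (proj₂ (arc u))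
   ed-pair false u = ed-pair true (go false u)

 module _ (G : Graph) (simple : IsSimple G) (c₁ c₂ : List (Fin (V G))) (ham₁ : IsHamCycle (Adj G) c₁) (ham₂ : IsHamCycle (Adj G) c₂)
   (disj : EdgeDisjoint c₁ c₂) (nonbip : ¬ UnionBipartite c₁ c₂) where

   private
     module M₁ = Ham G simple c₁ ham₁
     module M₂ = Ham G simple c₂ ham₂
     N : ℕ
     N = V G
     s t : Bool → Fin N → Fin N
     s = M₁.go
     t = M₂.go

   ed-disjoint : ∀ c u d v → M₁.ed c u ≢ M₂.ed d v
   ed-disjoint c u d v e with M₁.ed-pair c u | M₂.ed-pair d v
   ... | x , y , b , p , q | x′ , y′ , b′ , p′ , q′ = disj p p′ (same b b′ (trans (sym q) (trans (cong (lookup (edges G)) e) q′)))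
     where
     same : ∀ b b′ → mk b x y ≡ mk b′ x′ y′ → (x , y) ≡ (x′ , y′) ⊎ (x , y) ≡ Data.Product.swap (x′ , y′)
     same false false refl = inj₁ refl
     same true  true  refl = inj₁ refl
     same false true  refl = inj₂ refl
     same true  false refl = inj₂ refl

   module Reach (η : Bool) where

     _⇝_ : Fin N → Fin N → Set
     f ⇝ g = ∃ λ word → moves (s η) t f word ≡ g

     ⇝-trans : ∀ {f g h} → f ⇝ g → g ⇝ h → f ⇝ h
     ⇝-trans {f} (v , refl) (w , refl) = v ++ w , append f v
       where
       append : ∀ f v → moves (s η) t f (v ++ w) ≡ moves (s η) t (moves (s η) t f v) w
       append f []      = refl
       append f (d ∷ v) = append (s η (t d f)) v

     ⇝-≡ : ∀ {f g} → f ≡ g → f ⇝ g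
     ⇝-≡ e = [] , e

     move : Bool → Fin N → Fin N
     move d = s η ∘ t d

     move-injective : ∀ d {x y} → move d x ≡ move d y → x ≡ y
     move-injective d {x} {y} e = trans (sym (M₂.go-inv d x)) (trans (cong (t (not d))
       (trans (sym (M₁.go-inv η (t d x))) (trans (cong (s (not η)) e) (M₁.go-inv η (t d y))))) (M₂.go-inv d y))

     iterate : ∀ d i f → f ⇝ iter (move d) i f
     iterate d zero    f = ⇝-≡ refl
     iterate d (suc i) f = ⇝-trans (d ∷ [] , refl) (iterate d i (move d f))

     -- Among `N + 1` iterates two coincide, and injectivity removes the common initial part. Hence
     -- inverse moves are compositions of moves.
     period : ∀ d f → ∃ λ i → iter (move d) (suc i) f ≡ f
     period d f with Fin.pigeonhole (n<1+n N) (λ i → iter (move d) (toℕ i) f)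
     ... | i , j , i<j , e = k , iter-injective (move-injective d) (toℕ i) (trans (sym (iter-+ (move d) (suc k) (toℕ i) f)) (trans (cong (λ z → iter (move d) z f) split) (sym e)))
       where
       k = toℕ j ∸ suc (toℕ i)
       split : suc k + toℕ i ≡ toℕ j
       split = trans (sym (+-suc k (toℕ i))) (m∸n+n≡m i<j)

     unmove : ∀ d f → move d f ⇝ f
     unmove d f = let (i , e) = period d f in ⇝-trans (iterate d i (move d f)) (⇝-≡ e)

     ⇝-sym : ∀ {f g} → f ⇝ g → g ⇝ f
     ⇝-sym (word , refl) = back word _
       where
       back : ∀ word f → moves (s η) t f word ⇝ f
       back []      f = ⇝-≡ refl
       back (d ∷ w) f = ⇝-trans (back w (move d f)) (unmove d f)

     -- t² f = M₋⁻¹ (M₊ f) for the moves M± = s^η t^±1, which are invertible in ⇝ by finiteness.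
     two-steps : ∀ f → f ⇝ t true (t true f)
     two-steps f = ⇝-trans (true ∷ [] , refl) (⇝-trans (⇝-≡ (cong (s η) (sym (M₂.go-inv true (t true f))))) (unmove false (t true (t true f))))

     base : Fin N
     base = Data.Fin.fromℕ< {0} (≤-trans (s≤s z≤n) M₁.3≤V)

     even : ℕ → Bool
     even zero    = true
     even (suc i) = not (even i)

     anchor : Bool → Fin N
     anchor true  = base
     anchor false = t true base

     -- By `two-steps`, only the parity of the position on the second cycle matters.
     anchored : ∀ i → anchor (even i) ⇝ iter (t true) i base
     anchored zero = ⇝-≡ refl
     anchored (suc zero) = ⇝-≡ refl
     anchored (suc (suc i)) = ⇝-trans (subst (λ z → anchor z ⇝ iter (t true) i base) (sym (not-involutive (even i))) (anchored i))
       (⇝-trans (two-steps (iter (t true) i base)) (⇝-≡ (trans (cong (t true) (sym (iter-suc (t true) i base))) (sym (iter-suc (t true) (suc i) base)))))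

     index : Fin N → ℕ
     index f = suc (proj₁ (M₂.orbit true base f))

     index-ok : ∀ f → iter (t true) (index f) base ≡ f
     index-ok f = proj₂ (proj₂ (M₂.orbit true base f))

     col : Fin N → Bool
     col f = even (index f)

     at : ∀ f → anchor (col f) ⇝ f
     at f = ⇝-trans (anchored (index f)) (⇝-≡ (index-ok f))

     after : ∀ f → anchor (not (col f)) ⇝ t true f
     after f = ⇝-trans (anchored (suc (index f))) (⇝-≡ (trans (iter-suc (t true) (index f) base) (cong (t true) (index-ok f))))

     -- One step back is one step forward and then two steps back, so the wrap-around of `index` at
     -- `base` needs no separate case.
     before : ∀ f → anchor (not (col f)) ⇝ t false f
     before f = ⇝-trans (after f) (⇝-sym (⇝-trans (two-steps (t false f)) (⇝-≡ (cong (t true) (M₂.go-inv false f)))))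

     Joined : Set
     Joined = ∃ λ c → anchor c ⇝ anchor (not c)

     join₂ : ∀ {x y} → M₂.Pair x y → col x ≡ col y → Joined
     join₂ {x} {y} p e = col x , ⇝-trans (subst (λ z → anchor z ⇝ y) (sym e) (at y)) (⇝-sym (⇝-trans (after x) (⇝-≡ (sym (M₂.pair-go p)))))

     -- The move `true` at `t false x` leads to `s η x`, so an edge of the first cycle changes the
     -- class like one step of the second; depending on `η` it is traversed from `x` or from `y`.
     join₁ : ∀ {x y} → M₁.Pair x y → col x ≡ col y → Joined
     join₁ {x} {y} p e = go-η η refl
       where
       y≡ : y ≡ s true x
       y≡ = M₁.pair-go p
       x≡ : x ≡ s false y
       x≡ = trans (sym (M₁.go-inv true x)) (cong (s false) (sym y≡))
       go-η : ∀ η′ → η ≡ η′ → Joined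
       go-η true eq = col y , ⇝-trans (at y) (⇝-sym (⇝-trans (subst (λ z → anchor (not z) ⇝ t false x) e (before x))
         (true ∷ [] , trans (cong (s η) (M₂.go-inv false x)) (trans (cong (λ h → s h x) eq) (sym y≡)))))
       go-η false eq = col x , ⇝-trans (at x) (⇝-sym (⇝-trans (subst (λ z → anchor (not z) ⇝ t false y) (sym e) (before y))
         (true ∷ [] , trans (cong (s η) (M₂.go-inv false y)) (trans (cong (λ h → s h y) eq) (sym x≡)))))

     same-coloured : ∀ ps → ¬ All (λ (x , y) → ¬ (col x ≡ col y)) ps → ∃ λ x → ∃ λ y → (x , y) ∈ ps × col x ≡ col y
     same-coloured [] ¬a = ⊥-elim (¬a [])
     same-coloured ((x , y) ∷ ps) ¬a with col x ≟ᵇ col y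
     ... | yes e = x , y , here refl , e
     ... | no ne = let (x′ , y′ , i , e) = same-coloured ps (λ a → ¬a (ne ∷ a)) in x′ , y′ , there i , e

     -- `col` cannot be a proper colouring of the union, so some edge of one of the cycles has equal
     -- colours at its ends and links the two classes.
     monochromatic : Joined
     monochromatic with All.all? (λ (x , y) → ¬? (col x ≟ᵇ col y)) (cyclicPairs c₁) | All.all? (λ (x , y) → ¬? (col x ≟ᵇ col y)) (cyclicPairs c₂)
     ... | yes a₁ | yes a₂ = ⊥-elim (nonbip (col , λ { (inj₁ i) → All.lookup a₁ i ; (inj₂ i) → All.lookup a₂ i }))
     ... | no ¬a | _     = let (x , y , i , e) = same-coloured (cyclicPairs c₁) ¬a in join₁ i e
     ... | yes _ | no ¬a = let (x , y , i , e) = same-coloured (cyclicPairs c₂) ¬a in join₂ i e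

     all-linked : ∀ f g → f ⇝ g
     all-linked f g = ⇝-trans (⇝-sym (at f)) (⇝-trans (anchors (col f) (col g)) (at g))
       where
       flip : ∀ {c} → anchor c ⇝ anchor (not c) → ∀ a b → anchor a ⇝ anchor b
       flip {c} l true  true  = ⇝-≡ refl
       flip {c} l false false = ⇝-≡ refl
       flip {true}  l true  false = l
       flip {false} l true  false = ⇝-sym l
       flip {true}  l false true  = ⇝-sym l
       flip {false} l false true  = l
       anchors : ∀ a b → anchor a ⇝ anchor b
       anchors = flip {proj₁ monochromatic} (proj₂ monochromatic)

   twoCycles : TwoCycles G
   twoCycles = record
     { H₁ = M₁.hamRot ; H₂ = M₂.hamRot ; disjoint = ed-disjoint ; orbit = M₁.orbit ; kmax = bound
     ; reach = λ η f g → let (w , e) = Reach.all-linked η f g in w , within η f g , e ; 3≤V = M₁.3≤V }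
     where
     word : Bool → Fin N → Fin N → List Bool
     word η f g = proj₁ (Reach.all-linked η f g)
     bools : List Bool
     bools = true ∷ false ∷ []
     bound : ℕ
     bound = ∑ bools (λ η → ∑ (allFin N) (λ f → ∑ (allFin N) (λ g → length (word η f g))))
     term : ∀ {A : Set} (xs : List A) {x} (h : A → ℕ) → x ∈ xs → h x ≤ ∑ xs h
     term (x ∷ xs) h (here refl) = m≤m+n _ _
     term (x ∷ xs) h (there i)   = ≤-trans (term xs h i) (m≤n+m _ _)
     η∈ : ∀ η → η ∈ bools
     η∈ true  = here refl
     η∈ false = there (here refl)
     within : ∀ η f g → length (word η f g) ≤ bound
     within η f g = ≤-trans (term (allFin N) (λ g → length (word η f g)) (∈-allFin g))
       (≤-trans (term (allFin N) (λ f → ∑ (allFin N) (λ g → length (word η f g))) (∈-allFin f))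
         (term bools (λ η → ∑ (allFin N) (λ f → ∑ (allFin N) (λ g → length (word η f g)))) (η∈ η)))

-- Choice of the sizes for large `n`.

module SizeChoice where

 open RootedExploration
 open Assembly

 n<2^n : ∀ n → n < 2 ^ n
 n<2^n zero    = s≤s z≤n
 n<2^n (suc n) = ≤-trans (≤-reflexive (cong suc (+-comm 1 n))) (≤-trans (+-mono-≤ (n<2^n n) (2^≥1 n)) (+-monoʳ-≤ (2 ^ n) (≤-reflexive (sym (+-identityʳ (2 ^ n))))))

 -- `u` is the integer part of `log₂ n / c`.
 scale : ∀ c n → 1 ≤ c → 1 ≤ n → ∃ λ u → 2 ^ (c * u) ≤ n × n < 2 ^ (c * suc u)
 scale c (suc zero) 1≤c _ = 0 , ≤-reflexive (cong (2 ^_) (*-zeroʳ c)) , ≤-trans (s≤s (s≤s z≤n)) (^-monoʳ-≤ 2 {1} (≤-trans 1≤c (≤-reflexive (sym (*-identityʳ c)))))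
 scale c (suc (suc n)) 1≤c _ with scale c (suc n) 1≤c (s≤s z≤n)
 ... | u , lo , hi with suc (suc n) <? 2 ^ (c * suc u)
 ...   | yes lt = u , ≤-trans lo (n≤1+n _) , lt
 ...   | no ≥ = suc u , ≮⇒≥ ≥ , ≤-<-trans hi (^-monoʳ-< 2 (s≤s (s≤s z≤n)) (<-≤-trans (m<n+m (c * suc u) 1≤c) (≤-reflexive (sym (*-suc c (suc u))))))

 module Powers (y : ℕ) (2≤y : 2 ≤ y) where

   infix 4 _⊑_
   infixl 7 _⊗_
   -- A record rather than a plain inequality, so that the exponent can be inferred from a proof. A
   -- constant factor or a sum of two terms costs one exponent, as `2 ≤ y`.
   record _⊑_ (x e : ℕ) : Set where
     constructor le
     field get : x ≤ y ^ e
   open _⊑_ public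

   1≤y : 1 ≤ y
   1≤y = ≤-trans (s≤s z≤n) 2≤y

   y≢0 : NonZero y
   y≢0 = >-nonZero 1≤y

   _⊗_ : ∀ {x z e f} → x ⊑ e → z ⊑ f → x * z ⊑ e + f
   _⊗_ {e = e} {f} (le p) (le q) = le (≤-trans (*-mono-≤ p q) (≤-reflexive (sym (^-distribˡ-+-* y e f))))

   plus : ∀ {x z e} → x ⊑ e → z ⊑ e → x + z ⊑ suc e
   plus {e = e} (le p) (le q) = le (≤-trans (+-mono-≤ p q) (≤-trans (≤-reflexive (cong (y ^ e +_) (sym (+-identityʳ (y ^ e))))) (*-monoˡ-≤ (y ^ e) 2≤y)))

   up : ∀ {x e f} d → e + d ≡ f → x ⊑ e → x ⊑ f
   up {e = e} d refl (le p) = le (≤-trans p (^-monoʳ-≤ y {{y≢0}} (m≤m+n e d)))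

   small : ∀ {x} → x ≤ y → x ⊑ 1
   small p = le (≤-trans p (≤-reflexive (sym (*-identityʳ y))))

   itself : ∀ e → y ^ e ⊑ e
   itself e = le ≤-refl

   powers : ∀ {x e} k → x ⊑ e → x ^ k ⊑ e * k
   powers {e = e} k (le p) = le (≤-trans (^-monoˡ-≤ k p) (≤-reflexive (^-*-assoc y e k)))

   via : ∀ {x z e} → x ≤ z → z ⊑ e → x ⊑ e
   via p (le q) = le (≤-trans p q)

 -- All quantities are compared with powers of y = 2^u, where y^c ≤ n < y^(c + 1) and y exceeds every
 -- constant depending on the graph; b and a are the exponents of the sizes of the two trees.
 module Choice (V m κ k : ℕ) (1≤V : 1 ≤ V) (b : ℕ) (b-def : 16 * (κ + 1) + 40 ≡ b) where

   -- In `bad-ok` the runs have exponent `a + 15` and `D` adds 6, which with constants gives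
   -- `c = a + 24`. In `mass-ok`, `b` outweighs `c - a`, the `κ + 1` factors `G`, and `D`. The
   -- second tree may make about `y ^ (2 * b)` exposures and `trial-ok` squares this, hence `4 * b`
   -- in `a`. `q` adds up the quantities that have to be at most `y`.
   a c q : ℕ
   a = 4 * b + 20
   c = a + 24
   q = 2 ^ c + V + (6 + (c + 1) * m) + (4 + 2 * (a + b)) + (κ + 3) + suc k + 10

   2≤q : 2 ≤ q
   2≤q = ≤-trans (s≤s (s≤s z≤n)) (m≤n+m 10 (2 ^ c + V + (6 + (c + 1) * m) + (4 + 2 * (a + b)) + (κ + 3) + suc k))

   module AtScale (u n y : ℕ) (y-def : 2 ^ u ≡ y) (2≤y : 2 ≤ y) (q≤u : q ≤ u) (lo : 2 ^ (c * u) ≤ n) (hi : n < 2 ^ (c * suc u)) where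

     u≤y : u ≤ y
     u≤y = ≤-trans (<⇒≤ (n<2^n u)) (≤-reflexive y-def)

     q≤y : q ≤ y
     q≤y = ≤-trans q≤u u≤y

     10≤y : 10 ≤ y
     10≤y = ≤-trans (m≤n+m 10 (2 ^ c + V + (6 + (c + 1) * m) + (4 + 2 * (a + b)) + (κ + 3) + suc k)) q≤y

     open Powers y 2≤y

     pow : ∀ e → 2 ^ (e * u) ≡ y ^ e
     pow e = trans (cong (2 ^_) (*-comm e u)) (trans (sym (^-*-assoc 2 u e)) (cong (_^ e) y-def))

     p₂ p₃ p₄ p₅ p₆ : ℕ
     p₂ = 2 ^ c + V
     p₃ = p₂ + (6 + (c + 1) * m)
     p₄ = p₃ + (4 + 2 * (a + b))
     p₅ = p₄ + (κ + 3)
     p₆ = p₅ + suc k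

     p₆≤y : p₆ ≤ y
     p₆≤y = ≤-trans (m≤m+n p₆ 10) q≤y
     p₅≤y : p₅ ≤ y
     p₅≤y = ≤-trans (m≤m+n p₅ (suc k)) p₆≤y
     p₄≤y : p₄ ≤ y
     p₄≤y = ≤-trans (m≤m+n p₄ (κ + 3)) p₅≤y
     p₃≤y : p₃ ≤ y
     p₃≤y = ≤-trans (m≤m+n p₃ (4 + 2 * (a + b))) p₄≤y

     le₂ : 2 ^ c + V ≤ y
     le₂ = ≤-trans (m≤m+n p₂ (6 + (c + 1) * m)) p₃≤y
     le₃ : 6 + (c + 1) * m ≤ y
     le₃ = ≤-trans (m≤n+m (6 + (c + 1) * m) p₂) p₃≤y
     le₄ : 4 + 2 * (a + b) ≤ y
     le₄ = ≤-trans (m≤n+m (4 + 2 * (a + b)) p₃) p₄≤y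
     le₅ : κ + 3 ≤ y
     le₅ = ≤-trans (m≤n+m (κ + 3) p₄) p₅≤y
     le₆ : suc k ≤ y
     le₆ = ≤-trans (m≤n+m (suc k) p₅) p₆≤y

     n-lo : y ^ c ≤ n
     n-lo = ≤-trans (≤-reflexive (sym (pow c))) lo

     n-hi : suc n ⊑ c + 1
     n-hi = via (≤-trans hi (≤-reflexive (trans (cong (2 ^_) (trans (*-suc c u) (+-comm c (c * u)))) (trans (^-distribˡ-+-* 2 (c * u) c) (cong (_* 2 ^ c) (pow c))))))
       (itself c ⊗ small (≤-trans (m≤m+n (2 ^ c) V) le₂))

     n⊑ : n ⊑ c + 1
     n⊑ = via (n≤1+n n) n-hi

     below : ∀ {x e} d → e + d ≡ c → x ⊑ e → x ≤ n
     below d eq p = ≤-trans (get (up d eq p)) n-lo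

     lit : ∀ {x} → x ≤ 10 → x ⊑ 1
     lit p = small (≤-trans p 10≤y)

     D L Lh G dA dB K₀ cutN : ℕ
     -- `D` comes from `final-ok`, `K₀` from `2 ^ K₀ = D * y ^ ((c + 1) * m)` in `cycles-ok`, `Lh`
     -- from the exponent `a + 8` of the caps; `L` and `G` then follow from `L-big` and `n≤GL`.
     D = y ^ 6
     L = y ^ (a + 10)
     Lh = y ^ (a + 9)
     G = y ^ 16
     dA = a * u
     dB = b * u
     K₀ = (6 + (c + 1) * m) * u
     cutN = 2 * K₀
     capA capB capT capE growth capX loss runN : ℕ
     capA = 4 * pathCost dA
     capB = 4 * treeCost dB
     capT = capB * (κ + 3)
     capE = capT + 3 * cutN
     growth = capT + capA + 2
     capX = K₀ * growth
     loss = 2 + (2 * dB + 1) + (2 * dA + 1)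
     runN = K₀ * ((1 + κ) * (1 + L * V))

     ten : ∀ {x} (p : (x ≤ᵇ 10) ≡ Data.Bool.true) → x ⊑ 1
     ten {x} p = lit (≤ᵇ⇒≤ x 10 (subst Data.Bool.T (sym p) _))

     one : ∀ {e} → 1 ⊑ e
     one {e} = le (m^n>0 y {{y≢0}} e)

     V⊑ : V ⊑ 1
     V⊑ = small (≤-trans (m≤n+m V (2 ^ c)) le₂)

     path⊑ : pathCost dA ⊑ a + 1
     path⊑ = via (≤-trans (≤-trans (m≤m+n _ 1) (pathCost≤ dA)) (≤-reflexive (trans (cong (2 *_) (pow a)) (*-comm 2 (y ^ a))))) (itself a ⊗ ten refl)

     capA⊑ : capA ⊑ a + 1
     capA⊑ = via (≤-trans (*-monoʳ-≤ 4 (≤-trans (m≤m+n _ 1) (pathCost≤ dA))) (≤-reflexive (trans (cong (λ z → 4 * (2 * z)) (pow a)) (e (y ^ a))))) (itself a ⊗ ten {8} refl)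
       where
       e : ∀ t → 4 * (2 * t) ≡ t * 8
       e = solve-∀

     tree-raw : treeCost dB ≤ 2 * (y ^ b * y ^ b)
     tree-raw = ≤-trans (≤-trans (m≤m+n _ 1) (treeCost≤ dB)) (≤-reflexive (cong (λ z → 2 * (z * z)) (pow b)))

     tree⊑ : treeCost dB ⊑ b + b + 1
     tree⊑ = via (≤-trans tree-raw (≤-reflexive (*-comm 2 (y ^ b * y ^ b)))) (itself b ⊗ itself b ⊗ ten {2} refl)

     capB⊑ : capB ⊑ b + b + 1
     capB⊑ = via (≤-trans (*-monoʳ-≤ 4 tree-raw) (≤-reflexive (e (y ^ b * y ^ b)))) (itself b ⊗ itself b ⊗ ten {8} refl)
       where
       e : ∀ t → 4 * (2 * t) ≡ t * 8
       e = solve-∀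

     capT⊑ : capT ⊑ b + b + 1 + 1
     capT⊑ = capB⊑ ⊗ small le₅

     K₀⊑ : K₀ ⊑ 2
     K₀⊑ = small le₃ ⊗ small u≤y

     cut⊑ : cutN ⊑ 3
     cut⊑ = ten {2} refl ⊗ K₀⊑

     3cut⊑ : 3 * cutN ⊑ 4
     3cut⊑ = ten {3} refl ⊗ cut⊑

     capE⊑ : capE ⊑ b + b + 3
     capE⊑ = up 0 (e b) (plus capT⊑ (via (get 3cut⊑) (le (^-monoʳ-≤ y {{y≢0}} 4≤))))
       where
       e : ∀ b → suc (b + b + 1 + 1) + 0 ≡ b + b + 3
       e = solve-∀
       1≤b : 1 ≤ b
       1≤b = subst (1 ≤_) b-def (≤-trans (s≤s z≤n) (m≤n+m 40 (16 * (κ + 1))))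
       4≤ : 4 ≤ b + b + 1 + 1
       4≤ = +-monoˡ-≤ 1 (+-monoˡ-≤ 1 (+-mono-≤ 1≤b 1≤b))

     growth⊑ : growth ⊑ a + 4
     growth⊑ = up 0 (e a) (plus (plus (up (2 * b + 20) (e₁ b) capT⊑) (up 1 (e₂ a) capA⊑)) (up (a + 2) (e₃ a) (ten {2} refl)))
       where
       e : ∀ a → suc (suc (a + 2)) + 0 ≡ a + 4
       e = solve-∀
       e₁ : ∀ b → b + b + 1 + 1 + (2 * b + 20) ≡ 4 * b + 20 + 2
       e₁ = solve-∀
       e₂ : ∀ a → a + 1 + 1 ≡ a + 2
       e₂ = solve-∀
       e₃ : ∀ a → 1 + (a + 2) ≡ suc (a + 2)
       e₃ = solve-∀

     capX⊑ : capX ⊑ 2 + (a + 4)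
     capX⊑ = K₀⊑ ⊗ growth⊑

     run⊑ : runN ⊑ 2 + (1 + (a + 12))
     run⊑ = K₀⊑ ⊗ (small (≤-trans (≤-trans (≤-reflexive (+-comm 1 κ)) (+-monoʳ-≤ κ (s≤s (z≤n {2})))) le₅) ⊗ up 0 (e a) (plus one (itself (a + 10) ⊗ V⊑)))
       where
       e : ∀ a → suc (a + 10 + 1) + 0 ≡ a + 12
       e = solve-∀

     caps⊑ : capT + capX + cutN ⊑ a + 8
     caps⊑ = up 0 (e a) (plus (plus (up (2 * b + 24) (e₁ b) capT⊑) (up 0 (e₂ a) capX⊑)) (up (a + 4) (e₃ a) cut⊑))
       where
       e : ∀ a → suc (suc (a + 6)) + 0 ≡ a + 8
       e = solve-∀
       e₁ : ∀ b → b + b + 1 + 1 + (2 * b + 24) ≡ 4 * b + 20 + 6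
       e₁ = solve-∀
       e₂ : ∀ a → 2 + (a + 4) + 0 ≡ a + 6
       e₂ = solve-∀
       e₃ : ∀ a → 3 + (a + 4) ≡ suc (a + 6)
       e₃ = solve-∀

     bad-ok : 2 * (D * (3 * (capA + capT + capX) + runN)) ≤ n
     bad-ok = below 1 (e a) (ten {2} refl ⊗ (itself 6 ⊗ plus (up 6 (e₀ a) (ten {3} refl ⊗ plus (plus (up 5 (e₁ a) capA⊑) (up (2 * b + 24) (e₂ b) capT⊑)) (up 1 (e₃ a) capX⊑))) run⊑))
       where
       e : ∀ a → 1 + (6 + suc (2 + (1 + (a + 12)))) + 1 ≡ a + 24
       e = solve-∀
       e₀ : ∀ a → 1 + suc (suc (a + 6)) + 6 ≡ 2 + (1 + (a + 12))
       e₀ = solve-∀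
       e₁ : ∀ a → a + 1 + 5 ≡ a + 6
       e₁ = solve-∀
       e₂ : ∀ b → b + b + 1 + 1 + (2 * b + 24) ≡ 4 * b + 20 + 6
       e₂ = solve-∀
       e₃ : ∀ a → 2 + (a + 4) + 1 ≡ suc (a + 6)
       e₃ = solve-∀

     cat-ok : 4 * (D * ((3 * cutN + 2) * (pathCost dA + treeCost dB))) ≤ n
     cat-ok = below 10 (e a) (ten {4} refl ⊗ (itself 6 ⊗ (plus 3cut⊑ (up 3 refl (ten {2} refl)) ⊗ plus path⊑ (up (2 * b + 20) (e₁ b) tree⊑))))
       where
       e : ∀ a → 1 + (6 + (5 + suc (a + 1))) + 10 ≡ a + 24
       e = solve-∀
       e₁ : ∀ b → b + b + 1 + (2 * b + 20) ≡ 4 * b + 20 + 1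
       e₁ = solve-∀

     L-big : Lh + 3 * (capT + capX + cutN) ≤ L
     L-big = get (up 0 (e a) (plus (itself (a + 9)) (up 0 (e₁ a) (ten {3} refl ⊗ caps⊑))))
       where
       e : ∀ a → suc (a + 9) + 0 ≡ a + 10
       e = solve-∀
       e₁ : ∀ a → 1 + (a + 8) + 0 ≡ a + 9
       e₁ = solve-∀

     n≤GL : n ≤ G * Lh
     n≤GL = ≤-trans (get n⊑) (≤-reflexive (trans (cong (y ^_) (e a)) (^-distribˡ-+-* y 16 (a + 9))))
       where
       e : ∀ a → a + 24 + 1 ≡ 16 + (a + 9)
       e = solve-∀

     trial-ok : 2 * ((3 * cutN + capB) * D) * ((κ + 2) * capB) ≤ n
     trial-ok = below 30 (e b) (ten {2} refl ⊗ (plus (up (2 * b) (e₁ b) 3cut⊑) (up 3 (e₂ b) capB⊑) ⊗ itself 6) ⊗ (small (≤-trans (+-monoʳ-≤ κ (s≤s (s≤s (z≤n {1})))) le₅) ⊗ capB⊑))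
       where
       e : ∀ b → 1 + (suc (b + b + 4) + 6) + (1 + (b + b + 1)) + 30 ≡ 4 * b + 20 + 24
       e = solve-∀
       e₁ : ∀ b → 4 + 2 * b ≡ b + b + 4
       e₁ = solve-∀
       e₂ : ∀ b → b + b + 1 + 3 ≡ b + b + 4
       e₂ = solve-∀

     mass-ok : 2 * (4 * n * G ^ (κ + 1) * D + 4 * capE * capB) * (2 * (V * 2)) ≤ 2 ^ dA * 2 ^ dB
     mass-ok = ≤-trans (get (up 3 (trans (e a κ) (cong (a +_) b-def)) (ten {2} refl ⊗ plus (ten {4} refl ⊗ n⊑ ⊗ powers (κ + 1) (itself 16) ⊗ itself 6)
         (up (47 + 16 * (κ + 1)) (e₁ b κ) (ten {4} refl ⊗ capE⊑ ⊗ capB⊑)) ⊗ (ten {2} refl ⊗ (V⊑ ⊗ ten {2} refl)))))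
       (≤-reflexive (trans (^-distribˡ-+-* y a b) (cong₂ _*_ (sym (pow a)) (sym (pow b)))))
       where
       e : ∀ a κ → 1 + suc (1 + (a + 24 + 1) + 16 * (κ + 1) + 6) + (1 + (1 + 1)) + 3 ≡ a + (16 * (κ + 1) + 40)
       e = solve-∀
       e₁ : ∀ b κ → 1 + (b + b + 3) + (b + b + 1) + (47 + 16 * (κ + 1)) ≡ 1 + (4 * b + 20 + 24 + 1) + 16 * (κ + 1) + 6
       e₁ = solve-∀

     cycles-ok : D * suc n ^ m ≤ 2 ^ K₀
     cycles-ok = ≤-trans (get (itself 6 ⊗ powers m n-hi)) (≤-reflexive (sym (pow (6 + (c + 1) * m))))

     loss⊑ : loss ⊑ 2
     loss⊑ = via (≤-trans (≤-trans (≤-reflexive (e a b u)) (+-monoˡ-≤ (2 * (a + b) * u) (*-monoʳ-≤ 4 {1} {u} 1≤u))) (≤-reflexive (e′ (2 * (a + b)) u))) (small le₄ ⊗ small u≤y)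
       where
       1≤u : 1 ≤ u
       1≤u = ≤-trans (≤-trans (s≤s z≤n) (m≤n+m 10 _)) q≤u
       e : ∀ a b u → 2 + (2 * (b * u) + 1) + (2 * (a * u) + 1) ≡ 4 * 1 + 2 * (a + b) * u
       e = solve-∀
       e′ : ∀ t u → 4 * u + t * u ≡ (4 + t) * u
       e′ = solve-∀

     long-ok : K₀ * (K₀ * ((1 + κ) * (1 + L * V))) ≤ V * n
     long-ok = ≤-trans (below 7 (e a) (K₀⊑ ⊗ run⊑)) (≤-trans (≤-reflexive (sym (*-identityˡ n))) (*-monoˡ-≤ n 1≤V))
       where
       e : ∀ a → 2 + (2 + (1 + (a + 12))) + 7 ≡ a + 24
       e = solve-∀

     final-ok : suc k * (K₀ * loss + 1) ≤ D
     final-ok = get (small le₆ ⊗ plus (K₀⊑ ⊗ loss⊑) one)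

     sizes : Sizes V m κ n k
     sizes = record
       { D = D ; L = L ; Lh = Lh ; G = G ; dA = dA ; dB = dB ; cutN = cutN ; runN = runN ; capX = capX ; K₀ = K₀
       ; 1≤n = ≤-trans (get (one {c})) n-lo ; 1≤D = get (one {6}) ; 1≤G = get (one {16})
       ; bad-ok = bad-ok ; cat-ok = cat-ok ; L-big = L-big ; n≤GL = n≤GL ; trial-ok = trial-ok ; mass-ok = mass-ok
       ; cycles-ok = cycles-ok ; grow-ok = ≤-refl ; cut-ok = ≤-refl ; run-ok = ≤-refl ; long-ok = long-ok ; final-ok = final-ok }

   fits : ∀ n → 2 ^ (c * q) ≤ n → (∃ λ u → 2 ^ (c * u) ≤ n × n < 2 ^ (c * suc u)) → Sizes V m κ n k
   fits n N≤n (u , lo , hi) = AtScale.sizes u n (2 ^ u) refl (≤-trans 2≤q (≤-trans q≤u (<⇒≤ (n<2^n u)))) q≤u lo hi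
     where
     q≤u : q ≤ u
     q≤u = ≮⇒≥ (λ u<q → <⇒≱ hi (≤-trans (^-monoʳ-≤ 2 (*-monoʳ-≤ c u<q)) N≤n))

   large : ∃ λ N → ∀ n → N ≤ n → Sizes V m κ n k
   large = 2 ^ (c * q) , λ n N≤n → fits n N≤n (scale c n (≤-trans (s≤s z≤n) (m≤n+m 24 a)) (≤-trans (2^≥1 (c * q)) N≤n))

 sizes-exist : ∀ V m κ k → 1 ≤ V → ∃ λ N → ∀ n → N ≤ n → Sizes V m κ n k
 sizes-exist V m κ k 1≤V = Choice.large V m κ k 1≤V (16 * (κ + 1) + 40) refl

open Assembly using (TwoCycles; bad-bound)
open BaseGraph using (twoCycles)
open SizeChoice using (sizes-exist)

theorem1 : (G : Graph) → IsSimple G → (∀ u → 5 ≤ degree G u) →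
    (∃ λ H₁ → ∃ λ H₂ → IsHamCycle (Adj G) H₁ × IsHamCycle (Adj G) H₂
    × EdgeDisjoint H₁ H₂ × ¬ UnionBipartite H₁ H₂) →
    ∀ (k : ℕ) → ∃ λ N → ∀ n → N ≤ n →
    ∀ (L : List (LiftData G n)) → Unique L →
    All (λ σ → IsLift G σ × ¬ Hamiltonian (LiftAdj G σ)) L →
    suc k * length L ≤ numLifts G n
theorem1 G simple _ (c₁ , c₂ , ham₁ , ham₂ , disj , nonbip) k =
  let tc = twoCycles G simple c₁ c₂ ham₁ ham₂ disj nonbip
      (N , sizes) = sizes-exist (V G) (m G) (TwoCycles.kmax tc) k (≤-trans (m≤m+n 1 2) (TwoCycles.3≤V tc))
  in N , λ n N≤n L uL bad → bad-bound G tc n k (sizes n N≤n) L uL bad
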